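{- The category $\mathcal{SOAT}$ of second-order algebraic theories and algebraic translations is equivalent to the category $\mathcal{SOEP}$ of second-order equational presentations and syntactic translations.
   Context: Signatures and terms. A (unityped second-order) signature $\Sigma=(O,|\cdot|)$ is a set $O$ of operators with an arity function $|\cdot|:O\to\mathbb{N}^*$ (finite sequences of naturals); write $\mathsf{o}:\langle n_1,\dots,n_k\rangle$ when $|\mathsf{o}|=\langle n_1,\dots,n_k\rangle$ ($\mathsf{o}$ takes $k$ arguments, the $i$-th binding $n_i$ variables). A context $\Theta\rhd\Gamma$ consists of a list $\Theta=(\mathsf{m}_1:[m_1],\dots,\mathsf{m}_k:[m_k])$ of distinct metavariables, each with a natural-number arity, and a list $\Gamma$ of distinct variables. Terms $\Theta\rhd\Gamma\vdash t$ are generated by: $x$ for $x\in\Gamma$; $\mathsf{m}[t_1,\dots,t_m]$ for $(\mathsf{m}:[m])\in\Theta$ and terms $\Theta\rhd\Gamma\vdash t_i$; $\mathsf{o}((\vec x_1)t_1,\dots,(\vec x_k)t_k)$ for $\mathsf{o}:\langle n_1,\dots,n_k\rangle$ and terms $\Theta\rhd\Gamma,\vec x_i\vdash t_i$ where $\vec x_i$ is a list of $n_i$ variables, bound in $t_i$; terms are taken up to $\alpha$-equivalence. $t[t_i/x_i]_i$ denotes capture-avoiding simultaneous substitution of terms for variables. Metasubstitution: for $\mathsf{m}_1:[m_1],\dots,\mathsf{m}_k:[m_k]\rhd\Gamma\vdash t$ and $\Theta\rhd\Gamma,\vec x_i\vdash t_i$ ($\vec x_i$ of length $m_i$), the term $\Theta\rhd\Gamma\vdash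 t\{\mathsf{m}_i:=(\vec x_i)t_i\}_{i}$ is defined by $x\mapsto x$; $\mathsf{m}_\ell[s_1,\dots,s_{m_\ell}]\mapsto t_\ell[s'_j/x_{\ell,j}]_{j}$ where $s'_j=s_j\{\mathsf{m}_i:=(\vec x_i)t_i\}_i$; $\mathsf{o}(\dots,(\vec y)s,\dots)\mapsto\mathsf{o}(\dots,(\vec y)s\{\mathsf{m}_i:=(\vec x_i)t_i\}_i,\dots)$. Presentations and logic. A second-order equational presentation $(\Sigma,E)$ is a signature with a set $E$ of axioms, each a pair of terms in the same context, written $\Theta\rhd\Gamma\vdash s\equiv t$. Second-order equational logic derives such judgements by: the axioms of $E$; reflexivity, symmetry and transitivity; and extended metasubstitution: from $\mathsf{m}_1:[m_1],\dots,\mathsf{m}_k:[m_k]\rhd\Gamma\vdash s\equiv t$ and $\Theta\rhd\Delta,\vec x_i\vdash s_i\equiv t_i$ ($1\le i\le k$, $\vec x_i$ of length $m_i$) infer $\Theta\rhd\Gamma,\Delta\vdash s\{\mathsf{m}_i:=(\vec x_i)s_i\}_i\equiv t\{\mathsf{m}_i:=(\vec x_i)t_i\}_i$. The category $\mathbb{M}$. Objects are elements of $\mathbb{N}^*$; a morphism $\langle m_1,\dots,m_k\rangle\to\langle n_1,\dots,n_\ell\rangle$ is a tuple $\langle t_1,\dots,t_\ell\rangle$ with $t_i$ a term over the empty signature in context $\mathsf{m}_1:[m_1],\dots,\mathsf{m}_k:[m_k]\rhd x_1,\dots,x_{n_i}$. The identity on $\langle m_1,\dots,m_k\rangle$ is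 $\langle\mathsf{m}_i[x_1,\dots,x_{m_i}]\rangle_{i}$; the composite of $\langle s_p\rangle_{p\le j}:\langle l_1,\dots,l_i\rangle\to\langle m_1,\dots,m_j\rangle$ and $\langle t_q\rangle_{q\le k}:\langle m_1,\dots,m_j\rangle\to\langle n_1,\dots,n_k\rangle$ is $\langle t_q\{\mathsf{m}_p:=(x_1,\dots,x_{m_p})s_p\}_{p\le j}\rangle_{q\le k}$. $\mathbb{M}$ is strict cartesian (terminal object the empty sequence, products by concatenation), and $\langle 0\rangle$ is exponentiable, with $\langle0\rangle\Rightarrow\langle m_1,\dots,m_k\rangle=\langle m_1+1,\dots,m_k+1\rangle$ and evaluation $\langle m_1+1,\dots,m_k+1,0\rangle\to\langle m_1,\dots,m_k\rangle$ given by $\langle \mathsf{m}_i[x_1,\dots,x_{m_i},\mathsf{m}_{k+1}[\,]]\rangle_{i\le k}$. Theories. A second-order algebraic theory is a cartesian category $\mathbb{T}$ together with a strict cartesian identity-on-objects functor $T:\mathbb{M}\to\mathbb{T}$ that preserves the exponentiable object $\langle0\rangle$. An algebraic translation from $T:\mathbb{M}\to\mathbb{T}$ to $T':\mathbb{M}\to\mathbb{T}'$ is a functor $F:\mathbb{T}\to\mathbb{T}'$ with $T'=F\circ T$; these form the category $\mathcal{SOAT}$. Syntactic translations. A translation $\tau:\Sigma\to\Sigma'$ of signatures assigns to each operator $\mathsf{o}:\langle m_1,\dots,m_k\rangle$ of $\Sigma$ a term $\mathsf{m}_1:[m_1],\dots,\mathsf{m}_k:[m_k]\rhd\cdot\vdash\tau_{\mathsf{o}}$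 over $\Sigma'$; it extends to terms by $\tau(x)=x$, $\tau(\mathsf{m}[t_1,\dots,t_m])=\mathsf{m}[\tau(t_1),\dots,\tau(t_m)]$, $\tau(\mathsf{o}((\vec x_1)t_1,\dots,(\vec x_k)t_k))=\tau_{\mathsf{o}}\{\mathsf{m}_i:=(\vec x_i)\tau(t_i)\}_{i\le k}$. A syntactic translation $(\Sigma,E)\to(\Sigma',E')$ is a translation $\tau:\Sigma\to\Sigma'$ such that for every axiom $\Theta\rhd\Gamma\vdash s\equiv t$ in $E$, the judgement $\Theta\rhd\Gamma\vdash\tau(s)\equiv\tau(t)$ is derivable from $E'$. These form the category $\mathcal{SOEP}$: the identity sends $\mathsf{o}:\langle m_1,\dots,m_k\rangle$ to $\mathsf{o}(\dots,(x_1,\dots,x_{m_i})\mathsf{m}_i[x_1,\dots,x_{m_i}],\dots)$, and the composite of $\tau$ followed by $\tau'$ sends $\mathsf{o}$ to $\tau'(\tau_{\mathsf{o}})$.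
   Formalization: Syntactic translations are identified when, operator by operator, their terms are provably equal in the target presentation; with syntactic equality the claim fails, since the category of theories has a terminal object and that of presentations has none. -}

module Defs where

-- Second-order algebraic theories (SOAT) vs. second-order equational
-- presentations (SOEP).  Terms use de Bruijn / intrinsically scoped syntax,
-- so alpha-equivalence is syntactic equality.

open import Level using (Level; 0ℓ) renaming (suc to lsuc)
open import Data.Nat using (ℕ; zero; suc; _+_)
open import Data.Fin using (Fin; zero; suc; _↑ˡ_; _↑ʳ_; splitAt)
open import Data.List using (List; []; _∷_; _++_) renaming (map to lmap)
open import Data.Sum using (_⊎_; inj₁; inj₂)
open import Data.Product using (Σ; _×_; _,_; proj₁; proj₂)
open import Data.Empty using (⊥)
import Data.Unit
open import Relation.Binary.Structures using (IsEquivalence)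

-- Metavariable contexts: a list of arities; a metavariable of arity k
-- is a position in the list carrying k.

infix 4 _∋_
data _∋_ : List ℕ → ℕ → Set where
  here  : ∀ {k Θ} → (k ∷ Θ) ∋ k
  there : ∀ {j k Θ} → Θ ∋ k → (j ∷ Θ) ∋ k

∋-inl : ∀ {a k} (b : List ℕ) → a ∋ k → (a ++ b) ∋ k
∋-inl b here      = here
∋-inl b (there p) = there (∋-inl b p)

∋-inr : ∀ {b k} (a : List ℕ) → b ∋ k → (a ++ b) ∋ k
∋-inr []      p = p
∋-inr (_ ∷ a) p = there (∋-inr a p)

∋-suc : ∀ {a k} → a ∋ k → lmap suc a ∋ suc k
∋-suc here      = here
∋-suc (there p) = there (∋-suc p)

record Signature (ℓ : Level) : Set (lsuc ℓ) where
  field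
    Op    : Set ℓ
    arity : Op → List ℕ
open Signature public

EmptySig : Signature 0ℓ
EmptySig = record { Op = ⊥ ; arity = λ () }

module Syntax {ℓ : Level} (S : Signature ℓ) where

  mutual
    data Tm (Θ : List ℕ) : ℕ → Set ℓ where
      var  : ∀ {n} → Fin n → Tm Θ n
      mvar : ∀ {n k} → Θ ∋ k → Tms Θ n k → Tm Θ n
      op   : ∀ {n} (o : Op S) → Args Θ n (arity S o) → Tm Θ n

    data Tms (Θ : List ℕ) : ℕ → ℕ → Set ℓ where
      []  : ∀ {n} → Tms Θ n zero
      _∷_ : ∀ {n k} → Tm Θ n → Tms Θ n k → Tms Θ n (suc k)

    -- for each k in ks, a term in context n + k (k bound variables);
    -- used for operator arguments and for metasubstitutions
    data Args (Θ : List ℕ) : ℕ → List ℕ → Set ℓ where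
      []  : ∀ {n} → Args Θ n []
      _∷_ : ∀ {n k ks} → Tm Θ (n + k) → Args Θ n ks → Args Θ n (k ∷ ks)

  tabTms : ∀ {Θ n k} → (Fin k → Tm Θ n) → Tms Θ n k
  tabTms {k = zero}  f = []
  tabTms {k = suc k} f = f zero ∷ tabTms (λ i → f (suc i))

  indexTms : ∀ {Θ n k} → Tms Θ n k → Fin k → Tm Θ n
  indexTms (t ∷ ts) zero    = t
  indexTms (t ∷ ts) (suc i) = indexTms ts i

  snocTms : ∀ {Θ n k} → Tms Θ n k → Tm Θ n → Tms Θ n (suc k)
  snocTms []       u = u ∷ []
  snocTms (t ∷ ts) u = t ∷ snocTms ts u

  tabArgs : ∀ {Θ n} (ks : List ℕ) → (∀ {k} → ks ∋ k → Tm Θ (n + k)) → Args Θ n ks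
  tabArgs []       f = []
  tabArgs (k ∷ ks) f = f here ∷ tabArgs ks (λ p → f (there p))

  lookupArgs : ∀ {Θ n ks k} → Args Θ n ks → ks ∋ k → Tm Θ (n + k)
  lookupArgs (t ∷ ts) here      = t
  lookupArgs (t ∷ ts) (there p) = lookupArgs ts p

  allVars : ∀ {Θ k} → Tms Θ k k
  allVars = tabTms var

  liftRen : ∀ {n p} k → (Fin n → Fin p) → Fin (n + k) → Fin (p + k)
  liftRen {n} {p} k ρ i with splitAt n i
  ... | inj₁ j = ρ j ↑ˡ k
  ... | inj₂ j = p ↑ʳ j

  mutual
    ren : ∀ {Θ n p} → (Fin n → Fin p) → Tm Θ n → Tm Θ p
    ren ρ (var i)     = var (ρ i)
    ren ρ (mvar m ts) = mvar m (renTms ρ ts)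
    ren ρ (op o as)   = op o (renArgs ρ as)

    renTms : ∀ {Θ n p k} → (Fin n → Fin p) → Tms Θ n k → Tms Θ p k
    renTms ρ []       = []
    renTms ρ (t ∷ ts) = ren ρ t ∷ renTms ρ ts

    renArgs : ∀ {Θ n p ks} → (Fin n → Fin p) → Args Θ n ks → Args Θ p ks
    renArgs ρ []                 = []
    renArgs ρ (_∷_ {k = k} t ts) = ren (liftRen k ρ) t ∷ renArgs ρ ts

  liftSub : ∀ {Θ n p} k → (Fin n → Tm Θ p) → Fin (n + k) → Tm Θ (p + k)
  liftSub {n = n} {p} k σ i with splitAt n i
  ... | inj₁ j = ren (_↑ˡ k) (σ j)
  ... | inj₂ j = var (p ↑ʳ j)

  mutual
    sub : ∀ {Θ n p} → (Fin n → Tm Θ p) → Tm Θ n → Tm Θ p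
    sub σ (var i)     = σ i
    sub σ (mvar m ts) = mvar m (subTms σ ts)
    sub σ (op o as)   = op o (subArgs σ as)

    subTms : ∀ {Θ n p k} → (Fin n → Tm Θ p) → Tms Θ n k → Tms Θ p k
    subTms σ []       = []
    subTms σ (t ∷ ts) = sub σ t ∷ subTms σ ts

    subArgs : ∀ {Θ n p ks} → (Fin n → Tm Θ p) → Args Θ n ks → Args Θ p ks
    subArgs σ []                 = []
    subArgs σ (_∷_ {k = k} t ts) = sub (liftSub k σ) t ∷ subArgs σ ts

  instSub : ∀ {Θ n k} → Tms Θ n k → Fin (n + k) → Tm Θ n
  instSub {n = n} ts i with splitAt n i
  ... | inj₁ j = var j
  ... | inj₂ j = indexTms ts j

  -- metasubstitution  t{ m_i := (x⃗_i) t_i }_i ;  the t_i are given as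
  -- an Args Θ' n Θ  (t_i in context Γ , x⃗_i)
  mutual
    msub : ∀ {Θ Θ' n} → Args Θ' n Θ → Tm Θ n → Tm Θ' n
    msub ρ (var i)     = var i
    msub ρ (mvar m ts) = sub (instSub (msubTms ρ ts)) (lookupArgs ρ m)
    msub ρ (op o as)   = op o (msubArgs ρ as)

    msubTms : ∀ {Θ Θ' n k} → Args Θ' n Θ → Tms Θ n k → Tms Θ' n k
    msubTms ρ []       = []
    msubTms ρ (t ∷ ts) = msub ρ t ∷ msubTms ρ ts

    msubArgs : ∀ {Θ Θ' n ks} → Args Θ' n Θ → Args Θ n ks → Args Θ' n ks
    msubArgs ρ []                 = []
    msubArgs ρ (_∷_ {k = k} t ts) = msub (renArgs (_↑ˡ k) ρ) t ∷ msubArgs ρ ts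

open Syntax public

RawTrans : ∀ {ℓ} → Signature ℓ → Signature ℓ → Set ℓ
RawTrans S S' = (o : Op S) → Tm S' (arity S o) 0

module _ {ℓ} {S S' : Signature ℓ} (τ : RawTrans S S') where
  mutual
    translate : ∀ {Θ n} → Tm S Θ n → Tm S' Θ n
    translate (var i)     = var i
    translate (mvar m ts) = mvar m (transTms ts)
    translate (op o as)   = msub S' (transArgs as) (ren S' (λ ()) (τ o))

    transTms : ∀ {Θ n k} → Tms S Θ n k → Tms S' Θ n k
    transTms []       = []
    transTms (t ∷ ts) = translate t ∷ transTms ts

    transArgs : ∀ {Θ n ks} → Args S Θ n ks → Args S' Θ n ks
    transArgs []       = []
    transArgs (t ∷ ts) = translate t ∷ transArgs ts

idArgs : ∀ {ℓ} (S : Signature ℓ) (Θ : List ℕ) → Args S Θ 0 Θ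
idArgs S Θ = tabArgs S Θ (λ p → mvar p (allVars S))

idRaw : ∀ {ℓ} (S : Signature ℓ) → RawTrans S S
idRaw S o = op o (idArgs S (arity S o))

compRaw : ∀ {ℓ} {S S' S'' : Signature ℓ} → RawTrans S S' → RawTrans S' S'' → RawTrans S S''
compRaw τ τ' o = translate τ' (τ o)

record Presentation (ℓ : Level) : Set (lsuc ℓ) where
  field
    sig    : Signature ℓ
    Ax     : Set ℓ
    axMeta : Ax → List ℕ
    axVars : Ax → ℕ
    lhs    : (a : Ax) → Tm sig (axMeta a) (axVars a)
    rhs    : (a : Ax) → Tm sig (axMeta a) (axVars a)
open Presentation public

module Logic {ℓ} (P : Presentation ℓ) where
  S = sig P

  wkL : ∀ {Θ n} m → Tm S Θ n → Tm S Θ (n + m)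
  wkL m = ren S (_↑ˡ m)

  wkR : ∀ {Θ Θ₀ m} n → Args S Θ m Θ₀ → Args S Θ (n + m) Θ₀
  wkR n = renArgs S (n ↑ʳ_)

  infix 3 _⊢_≡_
  mutual
    data _⊢_≡_ : ∀ {Θ n} → Tm S Θ n → Tm S Θ n → Set ℓ where
      axiom  : (a : Ax P) → _⊢_≡_ (lhs P a) (rhs P a)
      refl   : ∀ {Θ n} {t : Tm S Θ n} → _⊢_≡_ t t
      sym    : ∀ {Θ n} {s t : Tm S Θ n} → _⊢_≡_ s t → _⊢_≡_ t s
      trans  : ∀ {Θ n} {s t u : Tm S Θ n} → _⊢_≡_ s t → _⊢_≡_ t u → _⊢_≡_ s u
      msubst : ∀ {Θ₀ Θ n m} {s t : Tm S Θ₀ n} {ss ts : Args S Θ m Θ₀} →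
               _⊢_≡_ s t → ArgsDeriv ss ts →
               _⊢_≡_ (msub S (wkR n ss) (wkL m s)) (msub S (wkR n ts) (wkL m t))

    data ArgsDeriv {Θ : List ℕ} {m : ℕ} : ∀ {ks} → Args S Θ m ks → Args S Θ m ks → Set ℓ where
      []  : ArgsDeriv [] []
      _∷_ : ∀ {k ks} {s t : Tm S Θ (m + k)} {ss ts : Args S Θ m ks} →
            _⊢_≡_ s t → ArgsDeriv ss ts → ArgsDeriv (s ∷ ss) (t ∷ ts)

  Derivable : ∀ {Θ n} → Tm S Θ n → Tm S Θ n → Set ℓ
  Derivable s t = _⊢_≡_ s t

open Logic public using (Derivable; ArgsDeriv)

record SynTrans {ℓ} (P P' : Presentation ℓ) : Set ℓ where
  field
    τ        : RawTrans (sig P) (sig P')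
    preserves : (a : Ax P) → Derivable P' (translate τ (lhs P a)) (translate τ (rhs P a))
open SynTrans public

RawEq : ∀ {ℓ} (S : Signature ℓ) (P' : Presentation ℓ) →
        RawTrans S (sig P') → RawTrans S (sig P') → Set ℓ
RawEq S P' τ₁ τ₂ = (o : Op S) → Derivable P' (τ₁ o) (τ₂ o)

MHom : List ℕ → List ℕ → Set
MHom a b = Args EmptySig a 0 b

Mid : (a : List ℕ) → MHom a a
Mid a = idArgs EmptySig a

Mcomp : ∀ {l m n} → MHom l m → MHom m n → MHom l n
Mcomp {l} {m} s [] = []
Mcomp {l} {m} s (_∷_ {k = k} t ts) =
  msub EmptySig (renArgs EmptySig (λ ()) s) t ∷ Mcomp s ts

π₁ : (a b : List ℕ) → MHom (a ++ b) a
π₁ a b = tabArgs EmptySig a (λ p → mvar (∋-inl b p) (allVars EmptySig))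

π₂ : (a b : List ℕ) → MHom (a ++ b) b
π₂ a b = tabArgs EmptySig b (λ p → mvar (∋-inr a p) (allVars EmptySig))

⇒0 : List ℕ → List ℕ
⇒0 a = lmap suc a

ev : (a : List ℕ) → MHom (⇒0 a ++ (0 ∷ [])) a
ev a = tabArgs EmptySig a (λ p →
         mvar (∋-inl (0 ∷ []) (∋-suc p))
              (snocTms EmptySig (allVars EmptySig) (mvar (∋-inr (⇒0 a) here) [])))

-- Second-order algebraic theories  T : 𝕄 → 𝕋
-- (𝕋 has objects ℕ* since T is identity-on-objects; hom-sets are setoids)

∃! : ∀ {ℓ} {A : Set ℓ} → (A → A → Set ℓ) → (A → Set ℓ) → Set ℓ
∃! {A = A} _≈_ P = Σ A (λ x → P x × ((y : A) → P y → y ≈ x))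

record Theory (ℓ : Level) : Set (lsuc ℓ) where
  infix  4 _≈_
  infixr 9 _∘_
  field
    Hom   : List ℕ → List ℕ → Set ℓ
    _≈_   : ∀ {a b} → Hom a b → Hom a b → Set ℓ
    ≈-isEquivalence : ∀ {a b} → IsEquivalence (_≈_ {a} {b})
    id    : ∀ {a} → Hom a a
    _∘_   : ∀ {a b c} → Hom b c → Hom a b → Hom a c
    ∘-resp-≈ : ∀ {a b c} {f f' : Hom b c} {g g' : Hom a b} →
               f ≈ f' → g ≈ g' → f ∘ g ≈ f' ∘ g'
    assoc : ∀ {a b c d} (f : Hom c d) (g : Hom b c) (h : Hom a b) →
            (f ∘ g) ∘ h ≈ f ∘ (g ∘ h)
    identityˡ : ∀ {a b} (f : Hom a b) → id ∘ f ≈ f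
    identityʳ : ∀ {a b} (f : Hom a b) → f ∘ id ≈ f
    T     : ∀ {a b} → MHom a b → Hom a b
    T-id  : ∀ a → T (Mid a) ≈ id
    T-∘   : ∀ {l m n} (s : MHom l m) (t : MHom m n) → T (Mcomp s t) ≈ T t ∘ T s
    -- 𝕋 is cartesian and T is strict cartesian:
    -- ⟨⟩ is terminal and (a ++ b , T π₁ , T π₂) is a product in 𝕋
    terminal : ∀ c → ∃! _≈_ (λ (_ : Hom c []) → Level.Lift ℓ Data.Unit.⊤)
    product  : ∀ {a b c} (f : Hom c a) (g : Hom c b) →
               ∃! _≈_ (λ (h : Hom c (a ++ b)) → (T (π₁ a b) ∘ h ≈ f) × (T (π₂ a b) ∘ h ≈ g))

  ⟨_,_⟩ : ∀ {a b c} → Hom c a → Hom c b → Hom c (a ++ b)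
  ⟨ f , g ⟩ = proj₁ (product f g)

  _×id : ∀ {c a} → Hom c a → Hom (c ++ (0 ∷ [])) (a ++ (0 ∷ []))
  _×id {c} {a} g = ⟨ g ∘ T (π₁ c (0 ∷ [])) , T (π₂ c (0 ∷ [])) ⟩

  field
    -- T preserves the exponentiable object ⟨0⟩:
    -- (⇒0 a , T ev) is an exponential  ⟨0⟩ ⇒ a  in 𝕋
    exponential : ∀ {a c} (f : Hom (c ++ (0 ∷ [])) a) →
                  ∃! _≈_ (λ (g : Hom c (⇒0 a)) → T (ev a) ∘ (g ×id) ≈ f)

record AlgTrans {ℓ} (𝕋 𝕋' : Theory ℓ) : Set ℓ where
  private
    module A = Theory 𝕋
    module B = Theory 𝕋'
  field
    F₁     : ∀ {a b} → A.Hom a b → B.Hom a b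
    F-resp : ∀ {a b} {f g : A.Hom a b} → f A.≈ g → F₁ f B.≈ F₁ g
    F-id   : ∀ {a} → F₁ (A.id {a}) B.≈ B.id
    F-∘    : ∀ {a b c} (f : A.Hom b c) (g : A.Hom a b) → F₁ (f A.∘ g) B.≈ F₁ f B.∘ F₁ g
    F-T    : ∀ {a b} (s : MHom a b) → F₁ (A.T s) B.≈ B.T s
open AlgTrans public

_≈ᴬ_ : ∀ {ℓ} {𝕋 𝕋' : Theory ℓ} → AlgTrans 𝕋 𝕋' → AlgTrans 𝕋 𝕋' → Set ℓ
_≈ᴬ_ {𝕋 = 𝕋} {𝕋'} F G = ∀ {a b} (f : Theory.Hom 𝕋 a b) → Theory._≈_ 𝕋' (F₁ F f) (F₁ G f)

idᴬ : ∀ {ℓ} (𝕋 : Theory ℓ) → AlgTrans 𝕋 𝕋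
idᴬ 𝕋 = record
  { F₁ = λ f → f ; F-resp = λ p → p ; F-id = IsEquivalence.refl ≈-isEquivalence
  ; F-∘ = λ _ _ → IsEquivalence.refl ≈-isEquivalence
  ; F-T = λ _ → IsEquivalence.refl ≈-isEquivalence }
  where open Theory 𝕋

_∘ᴬ_ : ∀ {ℓ} {𝕋₁ 𝕋₂ 𝕋₃ : Theory ℓ} → AlgTrans 𝕋₂ 𝕋₃ → AlgTrans 𝕋₁ 𝕋₂ → AlgTrans 𝕋₁ 𝕋₃
_∘ᴬ_ {𝕋₁ = 𝕋₁} {𝕋₂} {𝕋₃} G F = record
  { F₁ = λ f → F₁ G (F₁ F f)
  ; F-resp = λ p → F-resp G (F-resp F p)
  ; F-id = trans (F-resp G (F-id F)) (F-id G)
  ; F-∘ = λ f g → trans (F-resp G (F-∘ F f g)) (F-∘ G (F₁ F f) (F₁ F g))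
  ; F-T = λ s → trans (F-resp G (F-T F s)) (F-T G s) }
  where trans : ∀ {a b} {x y z : Theory.Hom 𝕋₃ a b} → Theory._≈_ 𝕋₃ x y →
                Theory._≈_ 𝕋₃ y z → Theory._≈_ 𝕋₃ x z
        trans = IsEquivalence.trans (Theory.≈-isEquivalence 𝕋₃)

-- Equivalence of categories  SOAT ≃ SOEP :
-- functors Φ : SOAT → SOEP, Ψ : SOEP → SOAT and natural isomorphisms
-- η : Ψ Φ ≅ Id_SOAT, ε : Φ Ψ ≅ Id_SOEP.
-- Identities/composites of syntactic translations are those of the paper
-- (idRaw, compRaw); equalities between them are stated via RawEq.

record SOAT≃SOEP (ℓ : Level) : Set (lsuc ℓ) where
  field
    Φ₀     : Theory ℓ → Presentation ℓ
    Φ₁     : ∀ {𝕋 𝕋'} → AlgTrans 𝕋 𝕋' → SynTrans (Φ₀ 𝕋) (Φ₀ 𝕋')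
    Φ-resp : ∀ {𝕋 𝕋'} {F G : AlgTrans 𝕋 𝕋'} → F ≈ᴬ G →
             RawEq (sig (Φ₀ 𝕋)) (Φ₀ 𝕋') (τ (Φ₁ F)) (τ (Φ₁ G))
    Φ-id   : ∀ 𝕋 → RawEq (sig (Φ₀ 𝕋)) (Φ₀ 𝕋) (τ (Φ₁ (idᴬ 𝕋))) (idRaw (sig (Φ₀ 𝕋)))
    Φ-∘    : ∀ {𝕋₁ 𝕋₂ 𝕋₃} (F : AlgTrans 𝕋₁ 𝕋₂) (G : AlgTrans 𝕋₂ 𝕋₃) →
             RawEq (sig (Φ₀ 𝕋₁)) (Φ₀ 𝕋₃) (τ (Φ₁ (G ∘ᴬ F))) (compRaw (τ (Φ₁ F)) (τ (Φ₁ G)))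
    Ψ₀     : Presentation ℓ → Theory ℓ
    Ψ₁     : ∀ {P P'} → SynTrans P P' → AlgTrans (Ψ₀ P) (Ψ₀ P')
    Ψ-resp : ∀ {P P'} {σ σ' : SynTrans P P'} → RawEq (sig P) P' (τ σ) (τ σ') →
             Ψ₁ σ ≈ᴬ Ψ₁ σ'
    Ψ-id   : ∀ P (ι : SynTrans P P) → RawEq (sig P) P (τ ι) (idRaw (sig P)) →
             Ψ₁ ι ≈ᴬ idᴬ (Ψ₀ P)
    Ψ-∘    : ∀ {P₁ P₂ P₃} (σ : SynTrans P₁ P₂) (σ' : SynTrans P₂ P₃) (ρ : SynTrans P₁ P₃) →
             RawEq (sig P₁) P₃ (τ ρ) (compRaw (τ σ) (τ σ')) →
             Ψ₁ ρ ≈ᴬ (Ψ₁ σ' ∘ᴬ Ψ₁ σ)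
    η      : ∀ 𝕋 → AlgTrans (Ψ₀ (Φ₀ 𝕋)) 𝕋
    η⁻¹    : ∀ 𝕋 → AlgTrans 𝕋 (Ψ₀ (Φ₀ 𝕋))
    η-iso₁ : ∀ 𝕋 → (η 𝕋 ∘ᴬ η⁻¹ 𝕋) ≈ᴬ idᴬ 𝕋
    η-iso₂ : ∀ 𝕋 → (η⁻¹ 𝕋 ∘ᴬ η 𝕋) ≈ᴬ idᴬ (Ψ₀ (Φ₀ 𝕋))
    η-nat  : ∀ {𝕋 𝕋'} (F : AlgTrans 𝕋 𝕋') → (η 𝕋' ∘ᴬ Ψ₁ (Φ₁ F)) ≈ᴬ (F ∘ᴬ η 𝕋)
    ε      : ∀ P → SynTrans (Φ₀ (Ψ₀ P)) P
    ε⁻¹    : ∀ P → SynTrans P (Φ₀ (Ψ₀ P))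
    ε-iso₁ : ∀ P → RawEq (sig P) P (compRaw (τ (ε⁻¹ P)) (τ (ε P))) (idRaw (sig P))
    ε-iso₂ : ∀ P → RawEq (sig (Φ₀ (Ψ₀ P))) (Φ₀ (Ψ₀ P))
                     (compRaw (τ (ε P)) (τ (ε⁻¹ P))) (idRaw (sig (Φ₀ (Ψ₀ P))))
    ε-nat  : ∀ {P P'} (σ : SynTrans P P') →
             RawEq (sig (Φ₀ (Ψ₀ P))) P'
                   (compRaw (τ (Φ₁ (Ψ₁ σ))) (τ (ε P'))) (compRaw (τ (ε P)) (τ σ))

{-# OPTIONS --safe #-}
module Submission where

-- Ψ sends a presentation to its classifying theory, whose arrows are tuples of terms
-- modulo derivability, and Φ sends a theory to its internal language.  Once every
-- operator o is assigned an arrow arity o → ⟨0⟩ of a theory 𝕋, terms are interpreted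
-- in 𝕋: a variable is a generalised element of ⟨0⟩, a metavariable of arity k one of
-- ⟨k⟩, and binding k variables is transposition across the k-fold exponential ⟨k⟩ of
-- ⟨0⟩.  Interpretation turns (meta)substitution into composition, so it is sound, and
-- an assignment that satisfies the axioms of P extends to an algebraic translation
-- out of Ψ P.  It is also complete: in Ψ P a term denotes its own class, and equations
-- valid in 𝕋 are axioms of Φ 𝕋.  Hence each equation between translations that the
-- equivalence demands can be checked on interpretations of the operators.

open import Defs
open import Level using (Level; lift)
import Level
open import Data.Nat using (ℕ; zero; suc; _+_)
open import Data.Fin using (Fin; zero; suc; _↑ˡ_; _↑ʳ_; splitAt; inject₁; fromℕ)
open import Data.Fin.Properties using (splitAt-↑ˡ; splitAt-↑ʳ)
open import Data.List using (List; []; _∷_; _++_; replicate) renaming (map to lmap)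
open import Data.Sum using (inj₁; inj₂; [_,_]′)
open import Data.Product using (Σ; _×_; _,_; proj₁; proj₂)
open import Data.Unit using (⊤; tt)
open import Function using () renaming (_∘_ to _⊙_)
open import Relation.Binary.Bundles using (Setoid)
open import Relation.Binary.Structures using (IsEquivalence)
import Relation.Binary.Reasoning.Setoid as SetoidReasoning
open import Relation.Binary.PropositionalEquality
  using (_≡_; refl; sym; trans; cong; cong₂; module ≡-Reasoning)

-- Three features of the definitions shape the argument. The only congruence rule of the logic is
-- metasubstitution, so closure of derivability under substitution for variables and under
-- composition must be extracted from it before terms modulo derivability form a category. A theory
-- supplies only a one-variable exponential, whose evaluation adds its argument last; k-fold
-- transposition is built from it and afterwards handled through its universal property. A
-- translation of theories is assumed to respect only the image of `T`; but all that interpretation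
-- uses besides the operators is determined by equations with arrows of that image, so translations
-- commute with interpretation. Terms are evaluated at an arbitrary stage c rather than as one arrow
-- out of `Θ ++ zeros n`: metasubstitution is then a change of environment, without reassociation of
-- products, and every evaluation is the generic one precomposed with an arrow. Since stages are
-- lists of naturals, the equations valid in a theory stay in its own universe and can serve as
-- axioms.

↑-elim : ∀ {a} n {k} (P : Fin (n + k) → Set a) →
         (∀ i → P (i ↑ˡ k)) → (∀ j → P (n ↑ʳ j)) → ∀ i → P i
↑-elim zero    P l r i       = r i
↑-elim (suc n) P l r zero    = l zero
↑-elim (suc n) P l r (suc i) = ↑-elim n (P ⊙ suc) (l ⊙ suc) r i

infixl 5 _⊞_
_⊞_ : ∀ {a} {A : Set a} {n k} → (Fin n → A) → (Fin k → A) → Fin (n + k) → A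
_⊞_ {n = n} f g i = [ f , g ]′ (splitAt n i)

⊞-↑ˡ : ∀ {a} {A : Set a} {n k} (f : Fin n → A) (g : Fin k → A) i → (f ⊞ g) (i ↑ˡ k) ≡ f i
⊞-↑ˡ {n = n} {k} f g i = cong [ f , g ]′ (splitAt-↑ˡ n i k)

⊞-↑ʳ : ∀ {a} {A : Set a} {n k} (f : Fin n → A) (g : Fin k → A) j → (f ⊞ g) (n ↑ʳ j) ≡ g j
⊞-↑ʳ {n = n} {k} f g j = cong [ f , g ]′ (splitAt-↑ʳ n k j)

-- n metavariables of arity 0 model n variables
zeros : ℕ → List ℕ
zeros n = replicate n 0

pos : ∀ {n} → Fin n → zeros n ∋ 0
pos {suc n} zero    = here
pos {suc n} (suc i) = there (pos i)

-- The arity k is an index that does not compute to 0 for an abstract position, so the motive ranges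
-- over all k and the elimination fixes it.
zeros-elim : ∀ {a} n (P : ∀ {k} → zeros n ∋ k → Set a) →
             (∀ i → P (pos i)) → ∀ {k} (p : zeros n ∋ k) → P p
zeros-elim (suc n) P f here      = f zero
zeros-elim (suc n) P f (there p) = zeros-elim n (P ⊙ there) (f ⊙ suc) p

++-elim : ∀ {a} (Θ {Θ′} : List ℕ) (P : ∀ {k} → (Θ ++ Θ′) ∋ k → Set a) →
          (∀ {k} (p : Θ ∋ k) → P (∋-inl Θ′ p)) → (∀ {k} (p : Θ′ ∋ k) → P (∋-inr Θ p)) →
          ∀ {k} (p : (Θ ++ Θ′) ∋ k) → P p
++-elim []      P l r p         = r p
++-elim (_ ∷ Θ) P l r here      = l here
++-elim (_ ∷ Θ) P l r (there p) = ++-elim Θ (P ⊙ there) (l ⊙ there) r p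

lmap-suc-elim : ∀ {a} Θ (P : ∀ {k} → lmap suc Θ ∋ k → Set a) →
                (∀ {k} (p : Θ ∋ k) → P (∋-suc p)) → ∀ {k} (p : lmap suc Θ ∋ k) → P p
lmap-suc-elim (_ ∷ Θ) P f here      = f here
lmap-suc-elim (_ ∷ Θ) P f (there p) = lmap-suc-elim Θ (P ⊙ there) (f ⊙ there) p

-- Renaming, substitution and metasubstitution

module Metatheory {ℓ} (S : Signature ℓ) where

  private variable
    Θ Θ′ Θ″ ks : List ℕ
    n m p q k : ℕ

  mutual
    sub-cong : {σ σ′ : Fin n → Tm S Θ p} → (∀ i → σ i ≡ σ′ i) → ∀ t → sub S σ t ≡ sub S σ′ t
    sub-cong h (var i)     = h i
    sub-cong h (mvar m ts) = cong (mvar m) (subTms-cong h ts)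
    sub-cong h (op o as)   = cong (op o) (subArgs-cong h as)

    subTms-cong : {σ σ′ : Fin n → Tm S Θ p} → (∀ i → σ i ≡ σ′ i) →
                  ∀ (ts : Tms S Θ n k) → subTms S σ ts ≡ subTms S σ′ ts
    subTms-cong h []       = refl
    subTms-cong h (t ∷ ts) = cong₂ _∷_ (sub-cong h t) (subTms-cong h ts)

    subArgs-cong : {σ σ′ : Fin n → Tm S Θ p} → (∀ i → σ i ≡ σ′ i) →
                   ∀ (as : Args S Θ n ks) → subArgs S σ as ≡ subArgs S σ′ as
    subArgs-cong h []                 = refl
    subArgs-cong h (_∷_ {k = k} t ts) = cong₂ _∷_ (sub-cong (liftSub-cong k h) t) (subArgs-cong h ts)

    liftSub-cong : ∀ k {σ σ′ : Fin n → Tm S Θ p} → (∀ i → σ i ≡ σ′ i) →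
                   ∀ i → liftSub S k σ i ≡ liftSub S k σ′ i
    liftSub-cong {n = n} k h i with splitAt n i
    ... | inj₁ j = cong (ren S _) (h j)
    ... | inj₂ _ = refl

  liftRen-↑ˡ : ∀ k (ρ : Fin n → Fin p) i → liftRen S k ρ (i ↑ˡ k) ≡ ρ i ↑ˡ k
  liftRen-↑ˡ {n = n} k ρ i rewrite splitAt-↑ˡ n i k = refl

  liftRen-↑ʳ : ∀ k (ρ : Fin n → Fin p) j → liftRen S k ρ (n ↑ʳ j) ≡ p ↑ʳ j
  liftRen-↑ʳ {n = n} k ρ j rewrite splitAt-↑ʳ n k j = refl

  liftSub-↑ˡ : ∀ k (σ : Fin n → Tm S Θ p) i → liftSub S k σ (i ↑ˡ k) ≡ ren S (_↑ˡ k) (σ i)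
  liftSub-↑ˡ {n = n} k σ i rewrite splitAt-↑ˡ n i k = refl

  liftSub-↑ʳ : ∀ k (σ : Fin n → Tm S Θ p) j → liftSub S k σ (n ↑ʳ j) ≡ var (p ↑ʳ j)
  liftSub-↑ʳ {n = n} k σ j rewrite splitAt-↑ʳ n k j = refl

  instSub-↑ˡ : (ts : Tms S Θ n k) → ∀ i → instSub S ts (i ↑ˡ k) ≡ var i
  instSub-↑ˡ {n = n} {k} ts i rewrite splitAt-↑ˡ n i k = refl

  instSub-↑ʳ : (ts : Tms S Θ n k) → ∀ j → instSub S ts (n ↑ʳ j) ≡ indexTms S ts j
  instSub-↑ʳ {n = n} {k} ts j rewrite splitAt-↑ʳ n k j = refl

  mutual
    ren≡sub : (ρ : Fin n → Fin p) (t : Tm S Θ n) → ren S ρ t ≡ sub S (var ⊙ ρ) t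
    ren≡sub ρ (var i)     = refl
    ren≡sub ρ (mvar m ts) = cong (mvar m) (renTms≡subTms ρ ts)
    ren≡sub ρ (op o as)   = cong (op o) (renArgs≡subArgs ρ as)

    renTms≡subTms : (ρ : Fin n → Fin p) (ts : Tms S Θ n k) → renTms S ρ ts ≡ subTms S (var ⊙ ρ) ts
    renTms≡subTms ρ []       = refl
    renTms≡subTms ρ (t ∷ ts) = cong₂ _∷_ (ren≡sub ρ t) (renTms≡subTms ρ ts)

    renArgs≡subArgs : (ρ : Fin n → Fin p) (as : Args S Θ n ks) →
                      renArgs S ρ as ≡ subArgs S (var ⊙ ρ) as
    renArgs≡subArgs ρ [] = refl
    renArgs≡subArgs {n = n} ρ (_∷_ {k = k} t ts) = cong₂ _∷_
      (trans (ren≡sub (liftRen S k ρ) t) (sub-cong lifted t))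
      (renArgs≡subArgs ρ ts)
      where
      lifted : ∀ i → var (liftRen S k ρ i) ≡ liftSub S k (var ⊙ ρ) i
      lifted i with splitAt n i
      ... | inj₁ _ = refl
      ... | inj₂ _ = refl

  mutual
    sub-ren : (σ : Fin p → Tm S Θ q) (ρ : Fin n → Fin p) (t : Tm S Θ n) →
              sub S σ (ren S ρ t) ≡ sub S (σ ⊙ ρ) t
    sub-ren σ ρ (var i)     = refl
    sub-ren σ ρ (mvar m ts) = cong (mvar m) (subTms-ren σ ρ ts)
    sub-ren σ ρ (op o as)   = cong (op o) (subArgs-ren σ ρ as)

    subTms-ren : (σ : Fin p → Tm S Θ q) (ρ : Fin n → Fin p) (ts : Tms S Θ n k) →
                 subTms S σ (renTms S ρ ts) ≡ subTms S (σ ⊙ ρ) ts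
    subTms-ren σ ρ []       = refl
    subTms-ren σ ρ (t ∷ ts) = cong₂ _∷_ (sub-ren σ ρ t) (subTms-ren σ ρ ts)

    subArgs-ren : (σ : Fin p → Tm S Θ q) (ρ : Fin n → Fin p) (as : Args S Θ n ks) →
                  subArgs S σ (renArgs S ρ as) ≡ subArgs S (σ ⊙ ρ) as
    subArgs-ren σ ρ [] = refl
    subArgs-ren {n = n} σ ρ (_∷_ {k = k} t ts) = cong₂ _∷_
      (trans (sub-ren (liftSub S k σ) (liftRen S k ρ) t) (sub-cong lifted t))
      (subArgs-ren σ ρ ts)
      where
      lifted : ∀ i → liftSub S k σ (liftRen S k ρ i) ≡ liftSub S k (σ ⊙ ρ) i
      lifted i with splitAt n i
      ... | inj₁ j = liftSub-↑ˡ k σ (ρ j)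
      ... | inj₂ j = liftSub-↑ʳ k σ j

  ren-ren : (ρ′ : Fin p → Fin q) (ρ : Fin n → Fin p) (t : Tm S Θ n) →
            ren S ρ′ (ren S ρ t) ≡ ren S (ρ′ ⊙ ρ) t
  ren-ren ρ′ ρ t = trans (ren≡sub ρ′ _) (trans (sub-ren _ ρ t) (sym (ren≡sub _ t)))

  renArgs-ren : (ρ′ : Fin p → Fin q) (ρ : Fin n → Fin p) (as : Args S Θ n ks) →
                renArgs S ρ′ (renArgs S ρ as) ≡ renArgs S (ρ′ ⊙ ρ) as
  renArgs-ren ρ′ ρ as =
    trans (renArgs≡subArgs ρ′ _) (trans (subArgs-ren _ ρ as) (sym (renArgs≡subArgs _ as)))

  ren-cong : {ρ ρ′ : Fin n → Fin p} → (∀ i → ρ i ≡ ρ′ i) → (t : Tm S Θ n) → ren S ρ t ≡ ren S ρ′ t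
  ren-cong h t = trans (ren≡sub _ t) (trans (sub-cong (cong var ⊙ h) t) (sym (ren≡sub _ t)))

  renArgs-cong : {ρ ρ′ : Fin n → Fin p} → (∀ i → ρ i ≡ ρ′ i) → (as : Args S Θ n ks) →
                 renArgs S ρ as ≡ renArgs S ρ′ as
  renArgs-cong h as =
    trans (renArgs≡subArgs _ as) (trans (subArgs-cong (cong var ⊙ h) as) (sym (renArgs≡subArgs _ as)))

  ren-lift : ∀ k (ρ : Fin n → Fin p) (t : Tm S Θ n) →
             ren S (liftRen S k ρ) (ren S (_↑ˡ k) t) ≡ ren S (_↑ˡ k) (ren S ρ t)
  ren-lift k ρ t =
    trans (ren-ren _ _ t) (trans (ren-cong (liftRen-↑ˡ k ρ) t) (sym (ren-ren _ _ t)))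

  renArgs-lift : ∀ k (ρ : Fin n → Fin p) (as : Args S Θ n ks) →
                 renArgs S (liftRen S k ρ) (renArgs S (_↑ˡ k) as) ≡ renArgs S (_↑ˡ k) (renArgs S ρ as)
  renArgs-lift k ρ t =
    trans (renArgs-ren _ _ t) (trans (renArgs-cong (liftRen-↑ˡ k ρ) t) (sym (renArgs-ren _ _ t)))

  mutual
    ren-sub : (ρ : Fin p → Fin q) (σ : Fin n → Tm S Θ p) (t : Tm S Θ n) →
              ren S ρ (sub S σ t) ≡ sub S (ren S ρ ⊙ σ) t
    ren-sub ρ σ (var i)     = refl
    ren-sub ρ σ (mvar m ts) = cong (mvar m) (renTms-sub ρ σ ts)
    ren-sub ρ σ (op o as)   = cong (op o) (renArgs-sub ρ σ as)

    renTms-sub : (ρ : Fin p → Fin q) (σ : Fin n → Tm S Θ p) (ts : Tms S Θ n k) →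
                 renTms S ρ (subTms S σ ts) ≡ subTms S (ren S ρ ⊙ σ) ts
    renTms-sub ρ σ []       = refl
    renTms-sub ρ σ (t ∷ ts) = cong₂ _∷_ (ren-sub ρ σ t) (renTms-sub ρ σ ts)

    renArgs-sub : (ρ : Fin p → Fin q) (σ : Fin n → Tm S Θ p) (as : Args S Θ n ks) →
                  renArgs S ρ (subArgs S σ as) ≡ subArgs S (ren S ρ ⊙ σ) as
    renArgs-sub ρ σ [] = refl
    renArgs-sub {n = n} ρ σ (_∷_ {k = k} t ts) = cong₂ _∷_
      (trans (ren-sub (liftRen S k ρ) (liftSub S k σ) t) (sub-cong lifted t))
      (renArgs-sub ρ σ ts)
      where
      lifted : ∀ i → ren S (liftRen S k ρ) (liftSub S k σ i) ≡ liftSub S k (ren S ρ ⊙ σ) i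
      lifted i with splitAt n i
      ... | inj₁ j = ren-lift k ρ (σ j)
      ... | inj₂ j = cong var (liftRen-↑ʳ k ρ j)

  mutual
    sub-sub : (τ : Fin p → Tm S Θ q) (σ : Fin n → Tm S Θ p) (t : Tm S Θ n) →
              sub S τ (sub S σ t) ≡ sub S (sub S τ ⊙ σ) t
    sub-sub τ σ (var i)     = refl
    sub-sub τ σ (mvar m ts) = cong (mvar m) (subTms-sub τ σ ts)
    sub-sub τ σ (op o as)   = cong (op o) (subArgs-sub τ σ as)

    subTms-sub : (τ : Fin p → Tm S Θ q) (σ : Fin n → Tm S Θ p) (ts : Tms S Θ n k) →
                 subTms S τ (subTms S σ ts) ≡ subTms S (sub S τ ⊙ σ) ts
    subTms-sub τ σ []       = refl
    subTms-sub τ σ (t ∷ ts) = cong₂ _∷_ (sub-sub τ σ t) (subTms-sub τ σ ts)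

    subArgs-sub : (τ : Fin p → Tm S Θ q) (σ : Fin n → Tm S Θ p) (as : Args S Θ n ks) →
                  subArgs S τ (subArgs S σ as) ≡ subArgs S (sub S τ ⊙ σ) as
    subArgs-sub τ σ [] = refl
    subArgs-sub {n = n} τ σ (_∷_ {k = k} t ts) = cong₂ _∷_
      (trans (sub-sub (liftSub S k τ) (liftSub S k σ) t) (sub-cong lifted t))
      (subArgs-sub τ σ ts)
      where
      lifted : ∀ i → sub S (liftSub S k τ) (liftSub S k σ i) ≡ liftSub S k (sub S τ ⊙ σ) i
      lifted i with splitAt n i
      ... | inj₁ j = trans (sub-ren _ _ (σ j))
                       (trans (sub-cong (liftSub-↑ˡ k τ) (σ j)) (sym (ren-sub _ τ (σ j))))
      ... | inj₂ j = liftSub-↑ʳ k τ j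

  mutual
    sub-var : (t : Tm S Θ n) → sub S var t ≡ t
    sub-var (var i)     = refl
    sub-var (mvar m ts) = cong (mvar m) (subTms-var ts)
    sub-var (op o as)   = cong (op o) (subArgs-var as)

    subTms-var : (ts : Tms S Θ n k) → subTms S var ts ≡ ts
    subTms-var []       = refl
    subTms-var (t ∷ ts) = cong₂ _∷_ (sub-var t) (subTms-var ts)

    subArgs-var : (as : Args S Θ n ks) → subArgs S var as ≡ as
    subArgs-var [] = refl
    subArgs-var {n = n} (_∷_ {k = k} t ts) = cong₂ _∷_
      (trans (sub-cong (↑-elim n _ (liftSub-↑ˡ k var) (liftSub-↑ʳ k var)) t) (sub-var t))
      (subArgs-var ts)

  sub-ren-id : (σ : Fin p → Tm S Θ n) (ρ : Fin n → Fin p) → (∀ i → σ (ρ i) ≡ var i) →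
               (t : Tm S Θ n) → sub S σ (ren S ρ t) ≡ t
  sub-ren-id σ ρ h t = trans (sub-ren σ ρ t) (trans (sub-cong h t) (sub-var t))

  subArgs-ren-id : (σ : Fin p → Tm S Θ n) (ρ : Fin n → Fin p) → (∀ i → σ (ρ i) ≡ var i) →
                   (as : Args S Θ n ks) → subArgs S σ (renArgs S ρ as) ≡ as
  subArgs-ren-id σ ρ h t = trans (subArgs-ren σ ρ t) (trans (subArgs-cong h t) (subArgs-var t))

  ren-id : {ρ : Fin n → Fin n} → (∀ i → ρ i ≡ i) → (t : Tm S Θ n) → ren S ρ t ≡ t
  ren-id h t = trans (ren≡sub _ t) (trans (sub-cong (cong var ⊙ h) t) (sub-var t))

  renArgs-id : {ρ : Fin n → Fin n} → (∀ i → ρ i ≡ i) → (as : Args S Θ n ks) → renArgs S ρ as ≡ as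
  renArgs-id h t = trans (renArgs≡subArgs _ t) (trans (subArgs-cong (cong var ⊙ h) t) (subArgs-var t))

  index-tab : (f : Fin k → Tm S Θ n) → ∀ i → indexTms S (tabTms S f) i ≡ f i
  index-tab f zero    = refl
  index-tab f (suc i) = index-tab (f ⊙ suc) i

  index-renTms : (ρ : Fin n → Fin p) (ts : Tms S Θ n k) → ∀ i →
                 indexTms S (renTms S ρ ts) i ≡ ren S ρ (indexTms S ts i)
  index-renTms ρ (t ∷ ts) zero    = refl
  index-renTms ρ (t ∷ ts) (suc i) = index-renTms ρ ts i

  index-subTms : (σ : Fin n → Tm S Θ p) (ts : Tms S Θ n k) → ∀ i →
                 indexTms S (subTms S σ ts) i ≡ sub S σ (indexTms S ts i)
  index-subTms σ (t ∷ ts) zero    = refl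
  index-subTms σ (t ∷ ts) (suc i) = index-subTms σ ts i

  index-msubTms : (γ : Args S Θ′ n Θ) (ts : Tms S Θ n k) → ∀ i →
                  indexTms S (msubTms S γ ts) i ≡ msub S γ (indexTms S ts i)
  index-msubTms γ (t ∷ ts) zero    = refl
  index-msubTms γ (t ∷ ts) (suc i) = index-msubTms γ ts i

  Tms-ext : {ts us : Tms S Θ n k} → (∀ i → indexTms S ts i ≡ indexTms S us i) → ts ≡ us
  Tms-ext {ts = []}     {[]}     h = refl
  Tms-ext {ts = t ∷ ts} {u ∷ us} h = cong₂ _∷_ (h zero) (Tms-ext (h ⊙ suc))

  lookup-tab : ∀ ks (f : ∀ {k} → ks ∋ k → Tm S Θ (n + k)) (p : ks ∋ k) →
               lookupArgs S (tabArgs S ks f) p ≡ f p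
  lookup-tab (_ ∷ ks) f here      = refl
  lookup-tab (_ ∷ ks) f (there p) = lookup-tab ks (f ⊙ there) p

  lookup-renArgs : (ρ : Fin n → Fin m) (as : Args S Θ n ks) (p : ks ∋ k) →
                   lookupArgs S (renArgs S ρ as) p ≡ ren S (liftRen S k ρ) (lookupArgs S as p)
  lookup-renArgs ρ (t ∷ ts) here      = refl
  lookup-renArgs ρ (t ∷ ts) (there p) = lookup-renArgs ρ ts p

  lookup-subArgs : (σ : Fin n → Tm S Θ m) (as : Args S Θ n ks) (p : ks ∋ k) →
                   lookupArgs S (subArgs S σ as) p ≡ sub S (liftSub S k σ) (lookupArgs S as p)
  lookup-subArgs σ (t ∷ ts) here      = refl
  lookup-subArgs σ (t ∷ ts) (there p) = lookup-subArgs σ ts p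

  lookup-msubArgs : (γ : Args S Θ′ n Θ) (as : Args S Θ n ks) (p : ks ∋ k) →
                    lookupArgs S (msubArgs S γ as) p ≡
                    msub S (renArgs S (_↑ˡ k) γ) (lookupArgs S as p)
  lookup-msubArgs γ (t ∷ ts) here      = refl
  lookup-msubArgs γ (t ∷ ts) (there p) = lookup-msubArgs γ ts p

  Args-ext : {as bs : Args S Θ n ks} →
             (∀ {k} (p : ks ∋ k) → lookupArgs S as p ≡ lookupArgs S bs p) → as ≡ bs
  Args-ext {as = []}     {[]}     h = refl
  Args-ext {as = t ∷ ts} {u ∷ us} h = cong₂ _∷_ (h here) (Args-ext (h ⊙ there))

  mutual
    ren-msub : (ρ : Fin n → Fin p) (γ : Args S Θ′ n Θ) (t : Tm S Θ n) →
               ren S ρ (msub S γ t) ≡ msub S (renArgs S ρ γ) (ren S ρ t)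
    ren-msub ρ γ (var i) = refl
    ren-msub {n = n} ρ γ (mvar {k = k} m ts)
      rewrite lookup-renArgs ρ γ m | sym (renTms-msub ρ γ ts) =
      trans (ren-sub ρ _ (lookupArgs S γ m))
        (trans (sub-cong pointwise (lookupArgs S γ m)) (sym (sub-ren _ _ (lookupArgs S γ m))))
      where
      us = msubTms S γ ts
      pointwise : ∀ i → ren S ρ (instSub S us i) ≡ instSub S (renTms S ρ us) (liftRen S k ρ i)
      pointwise i with splitAt n i
      ... | inj₁ j = sym (instSub-↑ˡ (renTms S ρ us) (ρ j))
      ... | inj₂ j = sym (trans (instSub-↑ʳ (renTms S ρ us) j) (index-renTms ρ us j))
    ren-msub ρ γ (op o as) = cong (op o) (renArgs-msub ρ γ as)

    renTms-msub : (ρ : Fin n → Fin p) (γ : Args S Θ′ n Θ) (ts : Tms S Θ n k) →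
                  renTms S ρ (msubTms S γ ts) ≡ msubTms S (renArgs S ρ γ) (renTms S ρ ts)
    renTms-msub ρ γ []       = refl
    renTms-msub ρ γ (t ∷ ts) = cong₂ _∷_ (ren-msub ρ γ t) (renTms-msub ρ γ ts)

    renArgs-msub : (ρ : Fin n → Fin p) (γ : Args S Θ′ n Θ) (as : Args S Θ n ks) →
                   renArgs S ρ (msubArgs S γ as) ≡ msubArgs S (renArgs S ρ γ) (renArgs S ρ as)
    renArgs-msub ρ γ []                 = refl
    renArgs-msub ρ γ (_∷_ {k = k} t ts) = cong₂ _∷_
      (trans (ren-msub (liftRen S k ρ) _ t) (cong (λ γ → msub S γ (ren S (liftRen S k ρ) t)) (renArgs-lift k ρ γ)))
      (renArgs-msub ρ γ ts)

  mutual
    -- At a metavariable both sides are substitutions into the same component of γ′, and it suffices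
    -- to compare the substituted terms. The relation between γ and γ′ is a hypothesis so that one
    -- proof serves instantiation in `msub-msub`, closed metasubstitutions, and metasubstitutions
    -- that move between variable contexts.
    sub-msub : {γ : Args S Θ′ p Θ} {γ′ : Args S Θ′ n Θ} {σ : Fin n → Tm S Θ p} {σ′ : Fin n → Tm S Θ′ p} →
               (∀ i → msub S γ (σ i) ≡ σ′ i) → subArgs S σ′ γ′ ≡ γ →
               (t : Tm S Θ n) → msub S γ (sub S σ t) ≡ sub S σ′ (msub S γ′ t)
    sub-msub hσ hγ (var i) = hσ i
    sub-msub {n = n} {γ = γ} {γ′} {σ} {σ′} hσ refl (mvar {k = k} m ts)
      rewrite lookup-subArgs σ′ γ′ m | subTms-msub {γ′ = γ′} {σ = σ} {σ′} hσ refl ts =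
      trans (sub-sub _ _ (lookupArgs S γ′ m))
        (trans (sub-cong pointwise (lookupArgs S γ′ m)) (sym (sub-sub _ _ (lookupArgs S γ′ m))))
      where
      us = msubTms S γ′ ts
      pointwise : ∀ i → sub S (instSub S (subTms S σ′ us)) (liftSub S k σ′ i) ≡ sub S σ′ (instSub S us i)
      pointwise i with splitAt n i
      ... | inj₁ j = sub-ren-id _ _ (instSub-↑ˡ (subTms S σ′ us)) (σ′ j)
      ... | inj₂ j = trans (instSub-↑ʳ (subTms S σ′ us) j) (index-subTms σ′ us j)
    sub-msub hσ hγ (op o as) = cong (op o) (subArgs-msub hσ hγ as)

    subTms-msub : {γ : Args S Θ′ p Θ} {γ′ : Args S Θ′ n Θ} {σ : Fin n → Tm S Θ p} {σ′ : Fin n → Tm S Θ′ p} →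
                  (∀ i → msub S γ (σ i) ≡ σ′ i) → subArgs S σ′ γ′ ≡ γ →
                  (ts : Tms S Θ n k) → msubTms S γ (subTms S σ ts) ≡ subTms S σ′ (msubTms S γ′ ts)
    subTms-msub hσ hγ []       = refl
    subTms-msub hσ hγ (t ∷ ts) = cong₂ _∷_ (sub-msub hσ hγ t) (subTms-msub hσ hγ ts)

    subArgs-msub : {γ : Args S Θ′ p Θ} {γ′ : Args S Θ′ n Θ} {σ : Fin n → Tm S Θ p} {σ′ : Fin n → Tm S Θ′ p} →
                   (∀ i → msub S γ (σ i) ≡ σ′ i) → subArgs S σ′ γ′ ≡ γ →
                   (as : Args S Θ n ks) → msubArgs S γ (subArgs S σ as) ≡ subArgs S σ′ (msubArgs S γ′ as)
    subArgs-msub hσ hγ [] = refl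
    subArgs-msub {n = n} {γ = γ} {γ′} {σ} {σ′} hσ hγ (_∷_ {k = k} t ts) =
      cong₂ _∷_ (sub-msub liftedσ liftedγ t) (subArgs-msub hσ hγ ts)
      where
      liftedσ : ∀ i → msub S (renArgs S (_↑ˡ k) γ) (liftSub S k σ i) ≡ liftSub S k σ′ i
      liftedσ i with splitAt n i
      ... | inj₁ j = trans (sym (ren-msub _ γ (σ j))) (cong (ren S _) (hσ j))
      ... | inj₂ j = refl
      liftedγ : subArgs S (liftSub S k σ′) (renArgs S (_↑ˡ k) γ′) ≡ renArgs S (_↑ˡ k) γ
      liftedγ = trans (subArgs-ren _ _ γ′) (trans (subArgs-cong (liftSub-↑ˡ k σ′) γ′)
                  (trans (sym (renArgs-sub _ σ′ γ′)) (cong (renArgs S _) hγ)))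

  mutual
    msub-msub : (γ : Args S Θ″ n Θ′) (γ′ : Args S Θ′ n Θ) (t : Tm S Θ n) →
                msub S γ (msub S γ′ t) ≡ msub S (msubArgs S γ γ′) t
    msub-msub γ γ′ (var i) = refl
    msub-msub {n = n} γ γ′ (mvar {k = k} m ts)
      rewrite lookup-msubArgs γ γ′ m | sym (msubTms-msub γ γ′ ts) =
      -- The inner metasubstitution has produced a substitution instance; γ passes it in the form
      -- weakened by k variables, which `instSub` strengthens back to γ.
      sub-msub pointwise (subArgs-ren-id _ _ (instSub-↑ˡ (msubTms S γ us)) γ) (lookupArgs S γ′ m)
      where
      us = msubTms S γ′ ts
      pointwise : ∀ i → msub S γ (instSub S us i) ≡ instSub S (msubTms S γ us) i
      pointwise i with splitAt n i
      ... | inj₁ j = refl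
      ... | inj₂ j = sym (index-msubTms γ us j)
    msub-msub γ γ′ (op o as) = cong (op o) (msubArgs-msub γ γ′ as)

    msubTms-msub : (γ : Args S Θ″ n Θ′) (γ′ : Args S Θ′ n Θ) (ts : Tms S Θ n k) →
                   msubTms S γ (msubTms S γ′ ts) ≡ msubTms S (msubArgs S γ γ′) ts
    msubTms-msub γ γ′ []       = refl
    msubTms-msub γ γ′ (t ∷ ts) = cong₂ _∷_ (msub-msub γ γ′ t) (msubTms-msub γ γ′ ts)

    msubArgs-msub : (γ : Args S Θ″ n Θ′) (γ′ : Args S Θ′ n Θ) (as : Args S Θ n ks) →
                    msubArgs S γ (msubArgs S γ′ as) ≡ msubArgs S (msubArgs S γ γ′) as
    msubArgs-msub γ γ′ []                 = refl
    msubArgs-msub γ γ′ (_∷_ {k = k} t ts) = cong₂ _∷_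
      (trans (msub-msub _ _ t) (cong (λ γ → msub S γ t) (sym (renArgs-msub _ γ γ′))))
      (msubArgs-msub γ γ′ ts)

  -- Metasubstitution descends under binders, whereas `idArgs` lives over no variables. With n
  -- ambient variables the arguments of a metavariable are the last k of n + k.
  idArgsₙ : ∀ n → Args S Θ n Θ
  idArgsₙ n = tabArgs S _ (λ p → mvar p (tabTms S (var ⊙ (n ↑ʳ_))))

  tab-renTms : (ρ : Fin n → Fin p) (f : Fin k → Tm S Θ n) →
               renTms S ρ (tabTms S f) ≡ tabTms S (ren S ρ ⊙ f)
  tab-renTms ρ f = Tms-ext (λ i → trans (index-renTms ρ (tabTms S f) i)
    (trans (cong (ren S ρ) (index-tab f i)) (sym (index-tab (ren S ρ ⊙ f) i))))

  tabTms-cong : {f g : Fin k → Tm S Θ n} → (∀ i → f i ≡ g i) → tabTms S f ≡ tabTms S g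
  tabTms-cong {k = zero}  h = refl
  tabTms-cong {k = suc k} h = cong₂ _∷_ (h zero) (tabTms-cong (h ⊙ suc))

  ren-idArgsₙ : (ρ : Fin n → Fin p) → renArgs S ρ (idArgsₙ {Θ} n) ≡ idArgsₙ p
  ren-idArgsₙ {n = n} {p = p} {Θ = Θ} ρ = Args-ext λ {k} q → begin
    lookupArgs S (renArgs S ρ (idArgsₙ n)) q
      ≡⟨ lookup-renArgs ρ (idArgsₙ n) q ⟩
    ren S (liftRen S k ρ) (lookupArgs S (idArgsₙ n) q)
      ≡⟨ cong (ren S (liftRen S k ρ)) (lookup-tab Θ _ q) ⟩
    mvar q (renTms S (liftRen S k ρ) (tabTms S (var ⊙ (n ↑ʳ_))))
      ≡⟨ cong (mvar q) (trans (tab-renTms _ _) (tabTms-cong (cong var ⊙ liftRen-↑ʳ k ρ))) ⟩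
    mvar q (tabTms S (var ⊙ (p ↑ʳ_)))
      ≡⟨ lookup-tab Θ _ q ⟨
    lookupArgs S (idArgsₙ p) q ∎
    where open ≡-Reasoning

  sub-inst-vars : (us : Tms S Θ n k) →
                  subTms S (instSub S us) (tabTms S (var ⊙ (n ↑ʳ_))) ≡ us
  sub-inst-vars {n = n} us = Tms-ext λ i →
    trans (index-subTms _ (tabTms S (var ⊙ (n ↑ʳ_))) i)
      (trans (cong (sub S _) (index-tab _ i)) (instSub-↑ʳ us i))

  mutual
    msub-id : (t : Tm S Θ n) → msub S (idArgsₙ n) t ≡ t
    msub-id (var i) = refl
    msub-id {Θ = Θ} {n = n} (mvar m ts)
      rewrite lookup-tab {n = n} Θ (λ p → mvar p (tabTms S (var ⊙ (n ↑ʳ_)))) m | msubTms-id ts =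
      cong (mvar m) (sub-inst-vars ts)
    msub-id (op o as) = cong (op o) (msubArgs-id as)

    msubTms-id : (ts : Tms S Θ n k) → msubTms S (idArgsₙ n) ts ≡ ts
    msubTms-id []       = refl
    msubTms-id (t ∷ ts) = cong₂ _∷_ (msub-id t) (msubTms-id ts)

    msubArgs-id : (as : Args S Θ n ks) → msubArgs S (idArgsₙ n) as ≡ as
    msubArgs-id []                 = refl
    msubArgs-id (_∷_ {k = k} t ts) = cong₂ _∷_
      (trans (cong (λ γ → msub S γ t) (ren-idArgsₙ _)) (msub-id t)) (msubArgs-id ts)

zeros-elim-pos : ∀ {a} n (P : ∀ {k} → zeros n ∋ k → Set a) (f : ∀ i → P (pos i)) →
                 ∀ i → zeros-elim n P f (pos i) ≡ f i
zeros-elim-pos (suc n) P f zero    = refl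
zeros-elim-pos (suc n) P f (suc i) = zeros-elim-pos n (P ⊙ there) (f ⊙ suc) i

-- `ev` supplies its argument at the end, while recursion on `Fin` works from the front; `inject₁`
-- and `fromℕ` mark the old indices and the new last one.
snoc : ∀ {a} {A : Set a} {k} → (Fin k → A) → A → Fin (suc k) → A
snoc {k = zero}  f x zero    = x
snoc {k = suc k} f x zero    = f zero
snoc {k = suc k} f x (suc i) = snoc (f ⊙ suc) x i

snoc-inject₁ : ∀ {a} {A : Set a} {k} (f : Fin k → A) x i → snoc f x (inject₁ i) ≡ f i
snoc-inject₁ f x zero    = refl
snoc-inject₁ f x (suc i) = snoc-inject₁ (f ⊙ suc) x i

snoc-fromℕ : ∀ {a} {A : Set a} k (f : Fin k → A) x → snoc f x (fromℕ k) ≡ x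
snoc-fromℕ zero    f x = refl
snoc-fromℕ (suc k) f x = snoc-fromℕ k (f ⊙ suc) x

snoc-elim : ∀ {a} {k} (P : Fin (suc k) → Set a) →
            (∀ i → P (inject₁ i)) → P (fromℕ k) → ∀ i → P i
snoc-elim {k = zero}  P f x zero    = x
snoc-elim {k = suc k} P f x zero    = f zero
snoc-elim {k = suc k} P f x (suc i) = snoc-elim (P ⊙ suc) (f ⊙ suc) x i

-- Metasubstitutions without ambient variables: composition, evaluation, pairing and abstraction

module ClosedArgs {ℓ} (S : Signature ℓ) where
  open Metatheory S

  private variable
    Θ Θ′ Θ″ ks l : List ℕ
    n m p q k : ℕ

  wk₀ : ∀ n → Args S Θ 0 ks → Args S Θ n ks
  wk₀ n = renArgs S (λ ())

  renArgs-wk₀ : (ρ : Fin n → Fin p) (γ : Args S Θ 0 ks) → renArgs S ρ (wk₀ n γ) ≡ wk₀ p γ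
  renArgs-wk₀ ρ γ = trans (renArgs-ren _ _ γ) (renArgs-cong (λ ()) γ)

  subArgs-wk₀ : (σ : Fin n → Tm S Θ p) (γ : Args S Θ 0 ks) → subArgs S σ (wk₀ n γ) ≡ wk₀ p γ
  subArgs-wk₀ σ γ = trans (subArgs-ren _ _ γ)
    (trans (subArgs-cong (λ ()) γ) (sym (renArgs≡subArgs _ γ)))

  wk₀-0 : (γ : Args S Θ 0 ks) → wk₀ 0 γ ≡ γ
  wk₀-0 = renArgs-id (λ ())

  -- `splitAt 0` always answers `inj₂`, so lifting the empty renaming computes to `n ↑ʳ_`.
  lookup-wk₀ : (γ : Args S Θ 0 ks) (p : ks ∋ k) → lookupArgs S (wk₀ n γ) p ≡ ren S (n ↑ʳ_) (lookupArgs S γ p)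
  lookup-wk₀ γ p = lookup-renArgs _ γ p

  -- The components of a closed γ mention no ambient variable, so only the argument half of
  -- `instSub` is ever reached.
  msub-mvar : (γ : Args S Θ′ 0 Θ) (p : Θ ∋ k) (ts : Tms S Θ n k) →
              msub S (wk₀ n γ) (mvar p ts) ≡
              sub S (λ i → msub S (wk₀ n γ) (indexTms S ts i)) (lookupArgs S γ p)
  msub-mvar {n = n} γ p ts rewrite lookup-wk₀ {n = n} γ p =
    trans (sub-ren _ _ (lookupArgs S γ p))
      (sub-cong (λ i → trans (instSub-↑ʳ (msubTms S (wk₀ n γ) ts) i) (index-msubTms (wk₀ n γ) ts i))
        (lookupArgs S γ p))

  msub-allVars : (γ : Args S Θ′ 0 Θ) (p : Θ ∋ k) →
                 msub S (wk₀ k γ) (mvar p (allVars S)) ≡ lookupArgs S γ p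
  msub-allVars γ p = trans (msub-mvar γ p (allVars S))
    (trans (sub-cong (λ i → cong (msub S (wk₀ _ γ)) (index-tab var i)) (lookupArgs S γ p))
           (sub-var (lookupArgs S γ p)))

  msub-wk₀-sub : (γ : Args S Θ′ 0 Θ) (σ : Fin n → Tm S Θ p) (t : Tm S Θ n) →
                 msub S (wk₀ p γ) (sub S σ t) ≡ sub S (msub S (wk₀ p γ) ⊙ σ) (msub S (wk₀ n γ) t)
  msub-wk₀-sub γ σ t = sub-msub (λ _ → refl) (subArgs-wk₀ _ γ) t

  msub-wk₀-ren : (γ : Args S Θ′ 0 Θ) (ρ : Fin n → Fin p) (t : Tm S Θ n) →
                 msub S (wk₀ p γ) (ren S ρ t) ≡ ren S ρ (msub S (wk₀ n γ) t)
  msub-wk₀-ren γ ρ t =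
    trans (cong (λ γ → msub S γ (ren S ρ t)) (sym (renArgs-wk₀ ρ γ))) (sym (ren-msub ρ (wk₀ _ γ) t))

  sub-closed : (σ : Fin 0 → Tm S Θ 0) (t : Tm S Θ 0) → sub S σ t ≡ t
  sub-closed σ t = trans (sub-cong (λ ()) t) (sub-var t)

  -- `Mcomp` over an arbitrary signature: composition in the classifying theory, in diagrammatic
  -- order.
  comp : Args S Θ 0 Θ′ → Args S Θ′ 0 ks → Args S Θ 0 ks
  comp s []                 = []
  comp s (_∷_ {k = k} t ts) = msub S (wk₀ k s) t ∷ comp s ts

  lookup-comp : (s : Args S Θ 0 Θ′) (t : Args S Θ′ 0 ks) (p : ks ∋ k) →
                lookupArgs S (comp s t) p ≡ msub S (wk₀ k s) (lookupArgs S t p)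
  lookup-comp s (t ∷ ts) here      = refl
  lookup-comp s (t ∷ ts) (there p) = lookup-comp s ts p

  wk₀-comp : (s : Args S Θ 0 Θ′) (t : Args S Θ′ 0 ks) → wk₀ n (comp s t) ≡ msubArgs S (wk₀ n s) (wk₀ n t)
  wk₀-comp s []                         = refl
  wk₀-comp {n = n} s (_∷_ {k = k} t ts) = cong₂ _∷_
    (trans (sym (msub-wk₀-ren s _ t))
      (cong (λ γ → msub S γ (ren S (liftRen S k λ ()) t)) (sym (renArgs-wk₀ _ s))))
    (wk₀-comp s ts)

  comp-assoc : (r : Args S Θ 0 Θ′) (s : Args S Θ′ 0 Θ″) (t : Args S Θ″ 0 ks) →
               comp r (comp s t) ≡ comp (comp r s) t
  comp-assoc r s []                 = refl
  comp-assoc r s (_∷_ {k = k} t ts) = cong₂ _∷_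
    (trans (msub-msub _ _ t) (cong (λ γ → msub S γ t) (sym (wk₀-comp r s)))) (comp-assoc r s ts)

  wk₀-idArgs : wk₀ n (idArgs S Θ) ≡ idArgsₙ n
  wk₀-idArgs = ren-idArgsₙ (λ ())

  comp-idˡ : (t : Args S Θ 0 ks) → comp (idArgs S Θ) t ≡ t
  comp-idˡ []                 = refl
  comp-idˡ (_∷_ {k = k} t ts) = cong₂ _∷_
    (trans (cong (λ γ → msub S γ t) wk₀-idArgs) (msub-id t)) (comp-idˡ ts)

  comp-idʳ : (s : Args S Θ 0 Θ′) → comp s (idArgs S Θ′) ≡ s
  comp-idʳ {Θ′ = Θ′} s = Args-ext λ p → begin
    lookupArgs S (comp s (idArgs S Θ′)) p              ≡⟨ lookup-comp s (idArgs S Θ′) p ⟩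
    msub S (wk₀ _ s) (lookupArgs S (idArgs S Θ′) p)    ≡⟨ cong (msub S (wk₀ _ s)) (lookup-tab Θ′ _ p) ⟩
    msub S (wk₀ _ s) (mvar p (allVars S))              ≡⟨ msub-allVars s p ⟩
    lookupArgs S s p                                   ∎
    where open ≡-Reasoning

  index-snocTms : (ts : Tms S Θ n k) (u : Tm S Θ n) →
                  ∀ i → indexTms S (snocTms S ts u) i ≡ snoc (indexTms S ts) u i
  index-snocTms []       u zero    = refl
  index-snocTms (t ∷ ts) u zero    = refl
  index-snocTms (t ∷ ts) u (suc i) = index-snocTms ts u i

  zeroArgs : ∀ k → (Fin k → Tm S Θ (n + 0)) → Args S Θ n (zeros k)
  zeroArgs zero    t = []
  zeroArgs (suc k) t = t zero ∷ zeroArgs k (t ⊙ suc)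

  lookup-zeroArgs : ∀ k (t : Fin k → Tm S Θ (n + 0)) i → lookupArgs S (zeroArgs {n = n} k t) (pos i) ≡ t i
  lookup-zeroArgs (suc k) t zero    = refl
  lookup-zeroArgs {n = n} (suc k) t (suc i) = lookup-zeroArgs {n = n} k (t ⊙ suc) i

  zeroVars : ∀ k → Tms S (ks ++ zeros k) n k
  zeroVars {ks = ks} k = tabTms S (λ i → mvar (∋-inr ks (pos i)) [])

  -- m[m₁[],…,mₖ[]]
  evTm : ∀ k → Tm S (k ∷ zeros k) 0
  evTm k = mvar here (zeroVars {ks = k ∷ []} k)

  -- Through this term metasubstitution simulates substitution for variables. It computes
  -- application in a theory and also yields closure of derivability under substitution.
  msub-evTm : ∀ k (u : Tm S Θ k) (t : Fin k → Tm S Θ 0) →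
              msub S (wk₀ 0 (u ∷ zeroArgs k t)) (evTm k) ≡ sub S t u
  msub-evTm k u t = trans (msub-mvar (u ∷ zeroArgs k t) here ts) (sub-cong pointwise u)
    where
    ts = zeroVars {ks = k ∷ []} k
    γ = wk₀ 0 (u ∷ zeroArgs k t)
    pointwise : ∀ i → msub S γ (indexTms S ts i) ≡ t i
    pointwise i = begin
      msub S γ (indexTms S ts i)
        ≡⟨ cong (msub S γ) (index-tab _ i) ⟩
      msub S γ (mvar (there (pos i)) [])
        ≡⟨ msub-mvar (u ∷ zeroArgs k t) (there (pos i)) [] ⟩
      sub S _ (lookupArgs S (zeroArgs {n = 0} k t) (pos i))
        ≡⟨ sub-closed _ _ ⟩
      lookupArgs S (zeroArgs {n = 0} k t) (pos i)
        ≡⟨ lookup-zeroArgs {n = 0} k t i ⟩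
      t i ∎
      where open ≡-Reasoning

  -- The single component of `ev (k ∷ [])`, over any signature.
  evLastTm : ∀ k → Tm S (suc k ∷ 0 ∷ []) k
  evLastTm k = mvar here (snocTms S (allVars S) (mvar (there here) []))

  msub-evLastTm : ∀ k (u : Tm S Θ (suc k)) (t : Tm S Θ 0) →
                  msub S (wk₀ k (u ∷ t ∷ [])) (evLastTm k) ≡ sub S (snoc var (ren S (λ ()) t)) u
  msub-evLastTm k u t = trans (msub-mvar (u ∷ t ∷ []) here (snocTms S (allVars S) (mvar (there here) [])))
    (sub-cong (λ i → trans (cong (msub S γ) (index-snocTms (allVars S) (mvar (there here) []) i))
                           (pointwise i)) u)
    where
    γ = wk₀ k (u ∷ t ∷ [])
    pointwise : ∀ i → msub S γ (snoc (indexTms S (allVars S)) (mvar (there here) []) i)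
                      ≡ snoc var (ren S (λ ()) t) i
    pointwise = snoc-elim _
      (λ i → trans (cong (msub S γ) (trans (snoc-inject₁ _ _ i) (index-tab var i)))
                   (sym (snoc-inject₁ _ _ i)))
      (trans (cong (msub S γ) (snoc-fromℕ k _ _))
        (trans (msub-mvar (u ∷ t ∷ []) (there here) [])
          (trans (trans (sub-cong (λ ()) t) (sym (ren≡sub _ t))) (sym (snoc-fromℕ k _ _)))))

  appendArgs : Args S Θ n ks → Args S Θ n l → Args S Θ n (ks ++ l)
  appendArgs []       bs = bs
  appendArgs (t ∷ as) bs = t ∷ appendArgs as bs

  lookup-inl : (as : Args S Θ n ks) (bs : Args S Θ n l) (p : ks ∋ k) →
               lookupArgs S (appendArgs as bs) (∋-inl l p) ≡ lookupArgs S as p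
  lookup-inl (t ∷ as) bs here      = refl
  lookup-inl (t ∷ as) bs (there p) = lookup-inl as bs p

  lookup-inr : (as : Args S Θ n ks) (bs : Args S Θ n l) (p : l ∋ k) →
               lookupArgs S (appendArgs as bs) (∋-inr ks p) ≡ lookupArgs S bs p
  lookup-inr []       bs p = refl
  lookup-inr (t ∷ as) bs p = lookup-inr as bs p

  renArgs-append : (ρ : Fin n → Fin p) (as : Args S Θ n ks) (bs : Args S Θ n l) →
                   renArgs S ρ (appendArgs as bs) ≡ appendArgs (renArgs S ρ as) (renArgs S ρ bs)
  renArgs-append ρ []       bs = refl
  renArgs-append ρ (t ∷ as) bs = cong (_ ∷_) (renArgs-append ρ as bs)

  subArgs-append : (σ : Fin n → Tm S Θ p) (as : Args S Θ n ks) (bs : Args S Θ n l) →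
                   subArgs S σ (appendArgs as bs) ≡ appendArgs (subArgs S σ as) (subArgs S σ bs)
  subArgs-append σ []       bs = refl
  subArgs-append σ (t ∷ as) bs = cong (_ ∷_) (subArgs-append σ as bs)

  subArgs-idArgsₙ : (σ : Fin n → Tm S Θ p) → subArgs S σ (idArgsₙ {Θ} n) ≡ idArgsₙ p
  subArgs-idArgsₙ {Θ = Θ} σ = trans (cong (subArgs S σ) (sym wk₀-idArgs))
    (trans (subArgs-wk₀ σ (idArgs S Θ)) wk₀-idArgs)

  -- A component of arity 0 lives over n + 0 variables, which is not n by computation; hence the
  -- renaming along `_↑ˡ 0`.
  valueArgs : ∀ k → (Fin k → Tm S Θ n) → Args S Θ n (zeros k)
  valueArgs k t = zeroArgs k (λ i → ren S (_↑ˡ 0) (t i))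

  subArgs-valueArgs : ∀ k (σ : Fin n → Tm S Θ p) (t : Fin k → Tm S Θ n) →
                      subArgs S σ (valueArgs k t) ≡ valueArgs k (sub S σ ⊙ t)
  subArgs-valueArgs zero    σ t = refl
  subArgs-valueArgs (suc k) σ t = cong₂ _∷_
    (trans (sub-ren _ _ (t zero))
      (trans (sub-cong (liftSub-↑ˡ 0 σ) (t zero)) (sym (ren-sub _ σ (t zero)))))
    (subArgs-valueArgs k σ (t ⊙ suc))

  msub-inl : (b : Args S Θ n l) (p : Θ ∋ k) (ts : Tms S (Θ ++ l) n k) →
             msub S (appendArgs (idArgsₙ n) b) (mvar (∋-inl l p) ts)
             ≡ mvar p (msubTms S (appendArgs (idArgsₙ n) b) ts)
  msub-inl {Θ = Θ} {n = n} b p ts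
    rewrite lookup-inl (idArgsₙ n) b p | lookup-tab {n = n} Θ (λ p → mvar p (tabTms S (var ⊙ (n ↑ʳ_)))) p =
    cong (mvar p) (sub-inst-vars _)

  msub-inr-value : ∀ k (as : Args S Θ n ks) (t : Fin k → Tm S Θ n) i →
                   msub S (appendArgs as (valueArgs k t)) (mvar (∋-inr ks (pos i)) []) ≡ t i
  msub-inr-value {n = n} k as t i
    rewrite lookup-inr as (valueArgs k t) (pos i) | lookup-zeroArgs {n = n} k (λ i → ren S (_↑ˡ 0) (t i)) i =
    sub-ren-id _ _ (instSub-↑ˡ []) (t i)

  inlArgs : ∀ Θ l → Args S (Θ ++ l) 0 Θ
  inlArgs Θ l = tabArgs S Θ (λ p → mvar (∋-inl l p) (allVars S))

  inrArgs : ∀ Θ l → Args S (Θ ++ l) 0 l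
  inrArgs Θ l = tabArgs S l (λ p → mvar (∋-inr Θ p) (allVars S))

  tab-msubTms-var : (γ : Args S Θ′ n Θ) (f : Fin k → Fin n) → msubTms S γ (tabTms S (var ⊙ f)) ≡ tabTms S (var ⊙ f)
  tab-msubTms-var γ f = Tms-ext λ i → trans (index-msubTms γ (tabTms S (var ⊙ f)) i)
    (trans (cong (msub S γ) (index-tab (var ⊙ f) i)) (sym (index-tab (var ⊙ f) i)))

  lookup-wk₀-mvar : (γ : Args S Θ 0 ks) (p : ks ∋ k) {q : Θ ∋ k} → lookupArgs S γ p ≡ mvar q (allVars S) →
                    lookupArgs S (wk₀ n γ) p ≡ mvar q (tabTms S (var ⊙ (n ↑ʳ_)))
  lookup-wk₀-mvar {n = n} γ p e = trans (lookup-wk₀ γ p)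
    (trans (cong (ren S (n ↑ʳ_)) e) (cong (mvar _) (tab-renTms (n ↑ʳ_) var)))

  -- Metavariables that were added for the time being disappear again without trace, whatever they
  -- are instantiated by.
  msubArgs-inl : (b : Args S Θ n l) → msubArgs S (appendArgs (idArgsₙ n) b) (wk₀ n (inlArgs Θ l)) ≡ idArgsₙ n
  msubArgs-inl {Θ = Θ} {n = n} {l = l} b = Args-ext λ {k} p → begin
    lookupArgs S (msubArgs S γ (wk₀ n (inlArgs Θ l))) p
      ≡⟨ lookup-msubArgs γ (wk₀ n (inlArgs Θ l)) p ⟩
    msub S (renArgs S (_↑ˡ k) γ) (lookupArgs S (wk₀ n (inlArgs Θ l)) p)
      ≡⟨ cong (msub S _) (lookup-wk₀-mvar (inlArgs Θ l) p (lookup-tab Θ _ p)) ⟩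
    msub S (renArgs S (_↑ˡ k) γ) (mvar (∋-inl l p) (tabTms S (var ⊙ (n ↑ʳ_))))
      ≡⟨ cong (λ γ → msub S γ (mvar (∋-inl l p) (tabTms S (var ⊙ (n ↑ʳ_)))))
           (trans (renArgs-append _ (idArgsₙ n) b) (cong (λ a → appendArgs a (renArgs S (_↑ˡ k) b)) (ren-idArgsₙ _))) ⟩
    msub S (appendArgs (idArgsₙ (n + k)) (renArgs S (_↑ˡ k) b)) (mvar (∋-inl l p) (tabTms S (var ⊙ (n ↑ʳ_))))
      ≡⟨ msub-inl (renArgs S (_↑ˡ k) b) p _ ⟩
    mvar p (msubTms S _ (tabTms S (var ⊙ (n ↑ʳ_))))
      ≡⟨ cong (mvar p) (tab-msubTms-var _ _) ⟩
    mvar p (tabTms S (var ⊙ (n ↑ʳ_)))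
      ≡⟨ lookup-tab Θ _ p ⟨
    lookupArgs S (idArgsₙ n) p ∎
    where
    open ≡-Reasoning
    γ = appendArgs (idArgsₙ n) b

  lookup-comp-mvar : (h : Args S Θ 0 Θ′) (t : Args S Θ′ 0 ks) (p : ks ∋ k) {q : Θ′ ∋ k} →
                     lookupArgs S t p ≡ mvar q (allVars S) → lookupArgs S (comp h t) p ≡ lookupArgs S h q
  lookup-comp-mvar h t p {q} e =
    trans (lookup-comp h t p) (trans (cong (msub S (wk₀ _ h)) e) (msub-allVars h q))

  lookup-comp-inl : (h : Args S Θ 0 (ks ++ l)) (p : ks ∋ k) →
                    lookupArgs S (comp h (inlArgs ks l)) p ≡ lookupArgs S h (∋-inl l p)
  lookup-comp-inl {ks = ks} h p = lookup-comp-mvar h (inlArgs ks _) p (lookup-tab ks _ p)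

  lookup-comp-inr : ∀ ks (h : Args S Θ 0 (ks ++ l)) (p : l ∋ k) →
                    lookupArgs S (comp h (inrArgs ks l)) p ≡ lookupArgs S h (∋-inr ks p)
  lookup-comp-inr {l = l} ks h p = lookup-comp-mvar h (inrArgs ks l) p (lookup-tab l _ p)

  -- Currying on terms: the last metavariable, of arity 0, turns into a variable. That variable is
  -- `fromℕ n`, behind the n old ones, because this is where `ev` puts its argument.
  bindArgs : ∀ n → Args S Θ (suc n) (Θ ++ (0 ∷ []))
  bindArgs n = appendArgs (idArgsₙ (suc n)) (valueArgs 1 (λ _ → var (fromℕ n)))

  abstractTm : Tm S (Θ ++ (0 ∷ [])) k → Tm S Θ (suc k)
  abstractTm {k = k} t = msub S (bindArgs k) (ren S inject₁ t)

  newMeta : ∀ Θ → Tm S (Θ ++ (0 ∷ [])) n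
  newMeta Θ = mvar (∋-inr Θ here) []

  -- Uncurrying on terms: the last variable is replaced by a new metavariable of arity 0.
  concreteTm : Tm S Θ (suc k) → Tm S (Θ ++ (0 ∷ [])) k
  concreteTm {Θ = Θ} {k = k} u = sub S (snoc var (newMeta Θ)) (msub S (wk₀ (suc k) (inlArgs Θ (0 ∷ []))) u)

  -- The two metasubstitutions compose to β, which still mentions the bound variable. Once σ
  -- replaces that variable by the new metavariable, β becomes the identity; this is checked
  -- separately on the old metavariables and on the new one.
  concrete-abstract : (t : Tm S (Θ ++ (0 ∷ [])) k) → concreteTm (abstractTm t) ≡ t
  concrete-abstract {Θ = Θ} {k = k} t = begin
    sub S σ (msub S ι (msub S (bindArgs k) (ren S inject₁ t)))
      ≡⟨ cong (sub S σ) (msub-msub ι (bindArgs k) (ren S inject₁ t)) ⟩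
    sub S σ (msub S (msubArgs S ι (bindArgs k)) (ren S inject₁ t))
      ≡⟨ sub-msub {γ = idArgsₙ k} (λ i → msub-id (σ i)) (Args-ext (++-elim Θ _ old new)) (ren S inject₁ t) ⟨
    msub S (idArgsₙ k) (sub S σ (ren S inject₁ t))
      ≡⟨ msub-id _ ⟩
    sub S σ (ren S inject₁ t)
      ≡⟨ sub-ren-id σ inject₁ (λ i → snoc-inject₁ var _ i) t ⟩
    t ∎
    where
    open ≡-Reasoning
    Θ₁ = Θ ++ (0 ∷ [])
    σ : Fin (suc k) → Tm S Θ₁ k
    σ = snoc var (newMeta Θ)
    ι = wk₀ (suc k) (inlArgs Θ (0 ∷ []))
    β = msubArgs S ι (bindArgs k)
    looked : ∀ {j} (p : Θ₁ ∋ j) → lookupArgs S (subArgs S σ β) p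
             ≡ sub S (liftSub S j σ) (msub S (wk₀ (suc k + j) (inlArgs Θ (0 ∷ []))) (lookupArgs S (bindArgs k) p))
    looked {j} p = trans (lookup-subArgs σ β p) (cong (sub S (liftSub S j σ))
      (trans (lookup-msubArgs ι (bindArgs k) p)
        (cong (λ γ → msub S γ (lookupArgs S (bindArgs k) p)) (renArgs-wk₀ (_↑ˡ j) (inlArgs Θ (0 ∷ []))))))
    old : ∀ {j} (p : Θ ∋ j) → lookupArgs S (subArgs S σ β) (∋-inl (0 ∷ []) p) ≡ lookupArgs S (idArgsₙ k) (∋-inl (0 ∷ []) p)
    old {j} p = begin
      lookupArgs S (subArgs S σ β) (∋-inl (0 ∷ []) p)
        ≡⟨ looked (∋-inl (0 ∷ []) p) ⟩
      sub S (liftSub S j σ) (msub S ι′ (lookupArgs S (bindArgs k) (∋-inl (0 ∷ []) p)))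
        ≡⟨ cong (sub S (liftSub S j σ) ⊙ msub S ι′)
             (trans (lookup-inl (idArgsₙ (suc k)) _ p) (lookup-tab {n = suc k} Θ _ p)) ⟩
      sub S (liftSub S j σ) (msub S ι′ (mvar p (tabTms S (var ⊙ (suc k ↑ʳ_)))))
        ≡⟨ cong (sub S (liftSub S j σ)) (msub-mvar (inlArgs Θ (0 ∷ [])) p _) ⟩
      sub S (liftSub S j σ) (sub S (λ i → msub S ι′ (indexTms S (tabTms S (var ⊙ (suc k ↑ʳ_))) i)) (lookupArgs S (inlArgs Θ (0 ∷ [])) p))
        ≡⟨ sub-sub _ _ (lookupArgs S (inlArgs Θ (0 ∷ [])) p) ⟩
      sub S (λ i → sub S (liftSub S j σ) (msub S ι′ (indexTms S (tabTms S (var ⊙ (suc k ↑ʳ_))) i))) (lookupArgs S (inlArgs Θ (0 ∷ [])) p)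
        ≡⟨ cong (sub S _) (lookup-tab Θ _ p) ⟩
      mvar (∋-inl (0 ∷ []) p) (subTms S _ (allVars S))
        ≡⟨ cong (mvar _) (Tms-ext λ i → trans (index-subTms _ (allVars S) i)
             (trans (cong (sub S _) (index-tab var i))
             (trans (cong (sub S (liftSub S j σ) ⊙ msub S ι′) (index-tab (var ⊙ (suc k ↑ʳ_)) i))
             (trans (liftSub-↑ʳ j σ i) (sym (index-tab _ i)))))) ⟩
      mvar (∋-inl (0 ∷ []) p) (tabTms S (var ⊙ (k ↑ʳ_)))
        ≡⟨ lookup-tab Θ₁ _ (∋-inl (0 ∷ []) p) ⟨
      lookupArgs S (idArgsₙ k) (∋-inl (0 ∷ []) p) ∎
      where ι′ = wk₀ (suc k + j) (inlArgs Θ (0 ∷ []))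
    new : ∀ {j} (p : (0 ∷ []) ∋ j) → lookupArgs S (subArgs S σ β) (∋-inr Θ p) ≡ lookupArgs S (idArgsₙ k) (∋-inr Θ p)
    new here = begin
      lookupArgs S (subArgs S σ β) (∋-inr Θ here)
        ≡⟨ looked (∋-inr Θ here) ⟩
      sub S (liftSub S 0 σ) (msub S ι′ (lookupArgs S (bindArgs k) (∋-inr Θ here)))
        ≡⟨ cong (sub S (liftSub S 0 σ) ⊙ msub S ι′) (lookup-inr (idArgsₙ (suc k)) _ here) ⟩
      liftSub S 0 σ (fromℕ k ↑ˡ 0)
        ≡⟨ liftSub-↑ˡ 0 σ (fromℕ k) ⟩
      ren S (_↑ˡ 0) (σ (fromℕ k))
        ≡⟨ cong (ren S (_↑ˡ 0)) (snoc-fromℕ k var _) ⟩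
      mvar (∋-inr Θ here) []
        ≡⟨ lookup-tab Θ₁ _ (∋-inr Θ here) ⟨
      lookupArgs S (idArgsₙ k) (∋-inr Θ here) ∎
      where ι′ = wk₀ (suc k + 0) (inlArgs Θ (0 ∷ []))

  abstract-concrete : (u : Tm S Θ (suc k)) → abstractTm (concreteTm u) ≡ u
  abstract-concrete {Θ = Θ} {k = k} u = begin
    msub S (bindArgs k) (ren S inject₁ (sub S σ (msub S ι u)))
      ≡⟨ cong (msub S (bindArgs k)) (ren-sub inject₁ σ (msub S ι u)) ⟩
    msub S (bindArgs k) (sub S (ren S inject₁ ⊙ σ) (msub S ι u))
      ≡⟨ sub-msub pointwise (subArgs-var (bindArgs k)) (msub S ι u) ⟩
    sub S var (msub S (bindArgs k) (msub S ι u))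
      ≡⟨ sub-var _ ⟩
    msub S (bindArgs k) (msub S ι u)
      ≡⟨ msub-msub (bindArgs k) ι u ⟩
    msub S (msubArgs S (bindArgs k) ι) u
      ≡⟨ cong (λ γ → msub S γ u) (msubArgs-inl _) ⟩
    msub S (idArgsₙ (suc k)) u
      ≡⟨ msub-id u ⟩
    u ∎
    where
    open ≡-Reasoning
    σ : Fin (suc k) → Tm S (Θ ++ (0 ∷ [])) k
    σ = snoc var (newMeta Θ)
    ι = wk₀ (suc k) (inlArgs Θ (0 ∷ []))
    pointwise : ∀ i → msub S (bindArgs k) (ren S inject₁ (σ i)) ≡ var i
    pointwise = snoc-elim _
      (λ i → cong (msub S (bindArgs k) ⊙ ren S inject₁) (snoc-inject₁ var _ i))
      (trans (cong (msub S (bindArgs k) ⊙ ren S inject₁) (snoc-fromℕ k var _))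
        (msub-inr-value 1 (idArgsₙ (suc k)) (λ _ → var (fromℕ k)) zero))

Mcomp≡comp : ∀ {l m n} (s : MHom l m) (t : MHom m n) → Mcomp s t ≡ ClosedArgs.comp EmptySig s t
Mcomp≡comp s []       = refl
Mcomp≡comp s (t ∷ ts) = cong (_ ∷_) (Mcomp≡comp s ts)

-- Finite products and iterated exponentials in a theory

module Kit {ℓ} (𝕋 : Theory ℓ) where
  open Theory 𝕋 public
  private
    module M = Metatheory EmptySig
    module C = ClosedArgs EmptySig

  private variable
    a b c d : List ℕ
    k n : ℕ

  hom : List ℕ → List ℕ → Setoid ℓ ℓ
  hom a b = record { Carrier = Hom a b ; _≈_ = _≈_ ; isEquivalence = ≈-isEquivalence }

  ≈-refl : {f : Hom a b} → f ≈ f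
  ≈-refl = IsEquivalence.refl ≈-isEquivalence

  ≈-sym : {f g : Hom a b} → f ≈ g → g ≈ f
  ≈-sym = IsEquivalence.sym ≈-isEquivalence

  ≈-trans : {f g h : Hom a b} → f ≈ g → g ≈ h → f ≈ h
  ≈-trans = IsEquivalence.trans ≈-isEquivalence

  ≡⇒≈ : {f g : Hom a b} → f ≡ g → f ≈ g
  ≡⇒≈ refl = ≈-refl

  module ≈-Reasoning {a} {b} = SetoidReasoning (hom a b)

  ∘-congˡ : {f : Hom b c} {g h : Hom a b} → g ≈ h → f ∘ g ≈ f ∘ h
  ∘-congˡ = ∘-resp-≈ ≈-refl

  ∘-congʳ : {f g : Hom b c} {h : Hom a b} → f ≈ g → f ∘ h ≈ g ∘ h
  ∘-congʳ p = ∘-resp-≈ p ≈-refl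

  pullˡ : {f : Hom c d} {g : Hom b c} {h : Hom a b} {k : Hom b d} → f ∘ g ≈ k → f ∘ (g ∘ h) ≈ k ∘ h
  pullˡ p = ≈-trans (≈-sym (assoc _ _ _)) (∘-congʳ p)

  Env : List ℕ → List ℕ → Set ℓ
  Env c Θ = ∀ {k} → Θ ∋ k → Hom c (k ∷ [])

  VEnv : List ℕ → ℕ → Set ℓ
  VEnv c n = Fin n → Hom c (0 ∷ [])

  T-comp : (s : MHom a b) (t : MHom b c) → T t ∘ T s ≈ T (C.comp s t)
  T-comp s t = ≈-trans (≈-sym (T-∘ s t)) (≡⇒≈ (cong T (Mcomp≡comp s t)))

  T₁ : Tm EmptySig a k → Hom a (k ∷ [])
  T₁ t = T (t ∷ [])

  proj : Env a a
  proj p = T₁ (mvar p (allVars EmptySig))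

  proj-T : (s : MHom a b) (p : b ∋ k) → proj p ∘ T s ≈ T₁ (lookupArgs EmptySig s p)
  proj-T s p = ≈-trans (T-comp s _) (≡⇒≈ (cong T₁ (C.msub-allVars s p)))

  proj-π₁ : (p : a ∋ k) → proj p ∘ T (π₁ a b) ≈ proj (∋-inl b p)
  proj-π₁ {a = a} {b = b} p = ≈-trans (proj-T (π₁ a b) p) (≡⇒≈ (cong T₁ (M.lookup-tab a _ p)))

  proj-π₂ : (p : b ∋ k) → proj p ∘ T (π₂ a b) ≈ proj (∋-inr a p)
  proj-π₂ {b = b} {a = a} p = ≈-trans (proj-T (π₂ a b) p) (≡⇒≈ (cong T₁ (M.lookup-tab b _ p)))

  ⟨⟩-β₁ : (f : Hom c a) (g : Hom c b) → T (π₁ a b) ∘ ⟨ f , g ⟩ ≈ f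
  ⟨⟩-β₁ f g = proj₁ (proj₁ (proj₂ (product f g)))

  ⟨⟩-β₂ : (f : Hom c a) (g : Hom c b) → T (π₂ a b) ∘ ⟨ f , g ⟩ ≈ g
  ⟨⟩-β₂ f g = proj₂ (proj₁ (proj₂ (product f g)))

  ⟨⟩-ext : {g h : Hom c (a ++ b)} → T (π₁ a b) ∘ g ≈ T (π₁ a b) ∘ h →
           T (π₂ a b) ∘ g ≈ T (π₂ a b) ∘ h → g ≈ h
  ⟨⟩-ext {a = a} {b = b} {g} {h} e₁ e₂ =
    ≈-trans (unique g (e₁ , e₂)) (≈-sym (unique h (≈-refl , ≈-refl)))
    where unique = proj₂ (proj₂ (product (T (π₁ a b) ∘ h) (T (π₂ a b) ∘ h)))

  -- Every object is the product of its one-element sublists: `k ∷ a` is `(k ∷ []) ++ a` by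
  -- computation, so binary products and the terminal object suffice.
  tup : Env c a → Hom c a
  tup {a = []}    γ = proj₁ (terminal _)
  tup {a = k ∷ a} γ = ⟨_,_⟩ {a = k ∷ []} (γ here) (tup (λ p → γ (there p)))

  proj-tup : (γ : Env c a) (p : a ∋ k) → proj p ∘ tup γ ≈ γ p
  proj-tup γ here                  = ⟨⟩-β₁ _ _
  proj-tup {a = j ∷ a} γ (there p) = begin
    proj (there p) ∘ tup γ               ≈⟨ pullˡ (proj-π₂ {a = j ∷ []} p) ⟨
    proj p ∘ (T (π₂ (j ∷ []) a) ∘ tup γ) ≈⟨ ∘-congˡ (⟨⟩-β₂ {a = j ∷ []} _ _) ⟩
    proj p ∘ tup (λ q → γ (there q))     ≈⟨ proj-tup (λ q → γ (there q)) p ⟩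
    γ (there p)                          ∎
    where open ≈-Reasoning

  tup-ext : {g h : Hom c a} → (∀ {k} (p : a ∋ k) → proj p ∘ g ≈ proj p ∘ h) → g ≈ h
  tup-ext {a = []}    {g} {h} e = ≈-trans (unique g _) (≈-sym (unique h _))
    where unique = proj₂ (proj₂ (terminal _))
  tup-ext {a = j ∷ a} {g} {h} e = ⟨⟩-ext {a = j ∷ []} (e here)
    (tup-ext λ p → ≈-trans (pullˡ (proj-π₂ {a = j ∷ []} p))
                     (≈-trans (e (there p)) (≈-sym (pullˡ (proj-π₂ {a = j ∷ []} p)))))

  tup-unique : {h : Hom c a} {γ : Env c a} → (∀ {k} (p : a ∋ k) → proj p ∘ h ≈ γ p) → h ≈ tup γ
  tup-unique {γ = γ} e = tup-ext λ p → ≈-trans (e p) (≈-sym (proj-tup γ p))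

  tup-cong : {γ δ : Env c a} → (∀ {k} (p : a ∋ k) → γ p ≈ δ p) → tup γ ≈ tup δ
  tup-cong {γ = γ} e = tup-unique λ p → ≈-trans (proj-tup γ p) (e p)

  tup-∘ : (γ : Env d a) (h : Hom c d) → tup γ ∘ h ≈ tup (λ p → γ p ∘ h)
  tup-∘ γ h = tup-unique λ p → pullˡ (proj-tup γ p)

  -- The object `c ++ zeros k` is the stage c with k generic elements of ⟨0⟩ adjoined: `W` forgets
  -- them and `V` lists them.
  W : ∀ c k → Hom (c ++ zeros k) c
  W c k = T (π₁ c (zeros k))

  V : ∀ c k → VEnv (c ++ zeros k) k
  V c k i = proj (∋-inr c (pos i))

  tupV : VEnv c k → Hom c (zeros k)
  tupV {c = c} {k} δ = tup (zeros-elim k (λ {j} _ → Hom c (j ∷ [])) δ)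

  proj-tupV : (δ : VEnv c k) → ∀ i → proj (pos i) ∘ tupV δ ≈ δ i
  proj-tupV {c = c} {k} δ i = ≈-trans (proj-tup (zeros-elim k (λ {j} _ → Hom c (j ∷ [])) δ) (pos i))
    (≡⇒≈ (zeros-elim-pos k (λ {j} _ → Hom c (j ∷ [])) δ i))

  tupV-ext : ∀ k {g h : Hom c (zeros k)} → (∀ i → proj (pos {k} i) ∘ g ≈ proj (pos i) ∘ h) → g ≈ h
  tupV-ext k {g} {h} e = tup-ext (zeros-elim k (λ p → proj p ∘ g ≈ proj p ∘ h) e)

  pair : Hom d c → VEnv d k → Hom d (c ++ zeros k)
  pair h δ = ⟨ h , tupV δ ⟩

  W-pair : (h : Hom d c) (δ : VEnv d k) → W c k ∘ pair h δ ≈ h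
  W-pair h δ = ⟨⟩-β₁ h (tupV δ)

  V-pair : (h : Hom d c) (δ : VEnv d k) → ∀ i → V c k i ∘ pair h δ ≈ δ i
  V-pair {c = c} {k} h δ i = begin
    V c k i ∘ pair h δ                          ≈⟨ pullˡ (proj-π₂ {a = c} (pos i)) ⟨
    proj (pos i) ∘ (T (π₂ c (zeros k)) ∘ pair h δ) ≈⟨ ∘-congˡ (⟨⟩-β₂ h (tupV δ)) ⟩
    proj (pos i) ∘ tupV δ                       ≈⟨ proj-tupV δ i ⟩
    δ i                                         ∎
    where open ≈-Reasoning

  pair-ext : ∀ c k {g h : Hom d (c ++ zeros k)} → W c k ∘ g ≈ W c k ∘ h →
             (∀ i → V c k i ∘ g ≈ V c k i ∘ h) → g ≈ h
  pair-ext c k e₁ e₂ = ⟨⟩-ext e₁ (tupV-ext k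
    λ i → ≈-trans (pullˡ (proj-π₂ {a = c} (pos i)))
            (≈-trans (e₂ i) (≈-sym (pullˡ (proj-π₂ {a = c} (pos i))))))

  pair-unique : {g : Hom d (c ++ zeros k)} (h : Hom d c) (δ : VEnv d k) →
                W c k ∘ g ≈ h → (∀ i → V c k i ∘ g ≈ δ i) → g ≈ pair h δ
  pair-unique {c = c} {k = k} h δ e₁ e₂ =
    pair-ext c k (≈-trans e₁ (≈-sym (W-pair h δ))) λ i → ≈-trans (e₂ i) (≈-sym (V-pair h δ i))

  pair-cong : {g h : Hom d c} (δ ε : VEnv d k) → g ≈ h → (∀ i → δ i ≈ ε i) → pair g δ ≈ pair h ε
  pair-cong {g = g} {h} δ ε e₁ e₂ =
    pair-unique h ε (≈-trans (W-pair g δ) e₁) λ i → ≈-trans (V-pair g δ i) (e₂ i)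

  pair-∘ : (g : Hom d c) (δ : VEnv d k) (h : Hom a d) → pair g δ ∘ h ≈ pair (g ∘ h) (λ i → δ i ∘ h)
  pair-∘ g δ h = pair-unique (g ∘ h) (λ i → δ i ∘ h) (pullˡ (W-pair g δ)) λ i → pullˡ (V-pair g δ i)

  -- All k arguments are consumed by one arrow of 𝕄 instead of k uses of `ev`, so on arrows in the
  -- image of `T` it computes as a substitution (`apply-T`). The link with `ev` is `apply-suc`.
  apply : Hom c (k ∷ []) → VEnv c k → Hom c (0 ∷ [])
  apply {k = k} f δ = T₁ (C.evTm k) ∘ pair f δ

  apply-cong : {f g : Hom c (k ∷ [])} (δ ε : VEnv c k) → f ≈ g → (∀ i → δ i ≈ ε i) → apply f δ ≈ apply g ε
  apply-cong δ ε e₁ e₂ = ∘-congˡ (pair-cong δ ε e₁ e₂)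

  apply-congʳ : {f g : Hom c (k ∷ [])} (δ : VEnv c k) → f ≈ g → apply f δ ≈ apply g δ
  apply-congʳ δ e = apply-cong δ δ e (λ _ → ≈-refl)

  apply-∘ : (f : Hom c (k ∷ [])) (δ : VEnv c k) (h : Hom d c) →
            apply f δ ∘ h ≈ apply (f ∘ h) (λ i → δ i ∘ h)
  apply-∘ f δ h = ≈-trans (assoc _ _ _) (∘-congˡ (pair-∘ f δ h))

  pair-T : (u : Tm EmptySig c k) (t : Fin n → Tm EmptySig c 0) →
           pair (T₁ u) (λ i → T₁ (t i)) ≈ T (u ∷ C.zeroArgs n t)
  pair-T {n = n} u t = ≈-sym (pair-unique (T₁ u) (λ i → T₁ (t i))
    (proj-T (u ∷ C.zeroArgs n t) here)
    λ i → ≈-trans (proj-T (u ∷ C.zeroArgs n t) (there (pos i))) (≡⇒≈ (cong T₁ (C.lookup-zeroArgs n t i))))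

  apply-T : (u : Tm EmptySig c k) (t : Fin k → Tm EmptySig c 0) →
            apply (T₁ u) (λ i → T₁ (t i)) ≈ T₁ (sub EmptySig t u)
  apply-T u t = ≈-trans (∘-congˡ (pair-T u t))
    (≈-trans (T-comp _ _) (≡⇒≈ (cong T₁ (C.msub-evTm _ u t))))

  apply-zero : (f : Hom c (0 ∷ [])) (δ : VEnv c 0) → apply f δ ≈ f
  apply-zero f δ = W-pair f δ

  pair₁ : Hom d c → Hom d (0 ∷ []) → Hom d (c ++ zeros 1)
  pair₁ h x = pair {k = 1} h (λ _ → x)

  pair₁-cong : {g h : Hom d c} {x y : Hom d (0 ∷ [])} → g ≈ h → x ≈ y → pair₁ g x ≈ pair₁ h y
  pair₁-cong e₁ e₂ = pair-cong {k = 1} (λ _ → _) (λ _ → _) e₁ (λ _ → e₂)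

  applyLast : Hom c (suc k ∷ []) → Hom c (0 ∷ []) → Hom c (k ∷ [])
  applyLast {k = k} f x = T (ev (k ∷ [])) ∘ pair₁ f x

  applyLast-cong : {f g : Hom c (suc k ∷ [])} {x y : Hom c (0 ∷ [])} → f ≈ g → x ≈ y →
                   applyLast f x ≈ applyLast g y
  applyLast-cong e₁ e₂ = ∘-congˡ (pair₁-cong e₁ e₂)

  applyLast-∘ : (f : Hom c (suc k ∷ [])) (x : Hom c (0 ∷ [])) (h : Hom d c) →
                applyLast f x ∘ h ≈ applyLast (f ∘ h) (x ∘ h)
  applyLast-∘ f x h = ≈-trans (assoc _ _ _) (∘-congˡ (pair-∘ {k = 1} f (λ _ → x) h))

  applyLast-T : (u : Tm EmptySig c (suc k)) (t : Tm EmptySig c 0) →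
                applyLast (T₁ u) (T₁ t) ≈ T₁ (sub EmptySig (snoc var (ren EmptySig (λ ()) t)) u)
  applyLast-T u t = ≈-trans (∘-congˡ (pair-T {n = 1} u (λ _ → t)))
    (≈-trans (T-comp _ _) (≡⇒≈ (cong T₁ (C.msub-evLastTm _ u t))))

  -- For the generic f and δ both sides lie in the image of `T`, where the equation is a computation
  -- with terms; the general case follows by precomposing with `pair f δ`.
  apply-suc : (f : Hom c (suc k ∷ [])) (δ : VEnv c (suc k)) →
              apply f δ ≈ apply (applyLast f (δ (fromℕ k))) (δ ⊙ inject₁)
  apply-suc {k = k} f δ = begin
    T₁ (C.evTm (suc k)) ∘ q
      ≈⟨ ∘-congʳ universal ⟨
    apply (applyLast f₀ (V₀ (fromℕ k))) (V₀ ⊙ inject₁) ∘ q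
      ≈⟨ apply-∘ _ (V₀ ⊙ inject₁) q ⟩
    apply (applyLast f₀ (V₀ (fromℕ k)) ∘ q) (λ i → V₀ (inject₁ i) ∘ q)
      ≈⟨ apply-cong _ (δ ⊙ inject₁)
           (≈-trans (applyLast-∘ f₀ _ q) (applyLast-cong (W-pair f δ) (V-pair f δ (fromℕ k))))
           (λ i → V-pair f δ (inject₁ i)) ⟩
    apply (applyLast f (δ (fromℕ k))) (δ ⊙ inject₁) ∎
    where
    open ≈-Reasoning
    q = pair f δ
    E = EmptySig
    f₀ : Hom (suc k ∷ zeros (suc k)) (suc k ∷ [])
    f₀ = proj here
    V₀ : VEnv (suc k ∷ zeros (suc k)) (suc k)
    V₀ = V (suc k ∷ []) (suc k)
    v : Fin (suc k) → Tm E (suc k ∷ zeros (suc k)) 0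
    v i = mvar (there (pos i)) []
    σ : Fin (suc k) → Tm E (suc k ∷ zeros (suc k)) k
    σ = snoc var (ren E (λ ()) (v (fromℕ k)))
    pointwise : ∀ i → sub E (v ⊙ inject₁) (σ i) ≡ v i
    pointwise = snoc-elim _ (λ i → cong (sub E (v ⊙ inject₁)) (snoc-inject₁ _ _ i))
      (cong (sub E (v ⊙ inject₁)) (snoc-fromℕ k _ _))
    universal : apply (applyLast f₀ (V₀ (fromℕ k))) (V₀ ⊙ inject₁) ≈ T₁ (C.evTm (suc k))
    universal = begin
      apply (applyLast f₀ (V₀ (fromℕ k))) (V₀ ⊙ inject₁)
        ≈⟨ apply-congʳ (V₀ ⊙ inject₁) (applyLast-T _ (v (fromℕ k))) ⟩
      apply (T₁ (sub E σ (mvar here (allVars E)))) (λ i → T₁ (v (inject₁ i)))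
        ≈⟨ apply-T _ (v ⊙ inject₁) ⟩
      T₁ (sub E (v ⊙ inject₁) (sub E σ (mvar here (allVars E))))
        ≡⟨ cong T₁ (M.sub-sub _ _ (mvar here (allVars E))) ⟩
      T₁ (sub E (sub E (v ⊙ inject₁) ⊙ σ) (mvar here (allVars E)))
        ≡⟨ cong T₁ (M.sub-cong pointwise (mvar here (allVars E))) ⟩
      T₁ (sub E v (mvar here (allVars E)))
        ≡⟨ cong (λ ts → T₁ (mvar here ts)) (M.Tms-ext λ i →
             trans (M.index-subTms v (allVars E) i)
               (trans (cong (sub E v) (M.index-tab var i)) (sym (M.index-tab v i)))) ⟩
      T₁ (C.evTm (suc k)) ∎

  curry : Hom (c ++ zeros 1) (k ∷ []) → Hom c (suc k ∷ [])
  curry f = proj₁ (exponential f)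

  uncurry : Hom c (suc k ∷ []) → Hom (c ++ zeros 1) (k ∷ [])
  uncurry {c = c} g = applyLast (g ∘ W c 1) (V c 1 zero)

  ev-×id : (g : Hom c (suc k ∷ [])) → T (ev (k ∷ [])) ∘ (g ×id) ≈ uncurry g
  ev-×id {c = c} g = ∘-congˡ (⟨⟩-ext
    (≈-trans (⟨⟩-β₁ _ _) (≈-sym (W-pair {k = 1} _ (λ _ → V c 1 zero))))
    (≈-trans (⟨⟩-β₂ _ _) (≈-sym (≈-trans (⟨⟩-β₂ _ _) (tupV-ext 1
      λ { zero → ≈-trans (proj-tupV {k = 1} (λ _ → V c 1 zero) zero) (≈-sym (proj-π₂ {a = c} here)) })))))

  curry-β : (f : Hom (c ++ zeros 1) (k ∷ [])) → uncurry (curry f) ≈ f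
  curry-β f = ≈-trans (≈-sym (ev-×id (curry f))) (proj₁ (proj₂ (exponential f)))

  curry-ext : {g h : Hom c (suc k ∷ [])} → uncurry g ≈ uncurry h → g ≈ h
  curry-ext {g = g} {h} e =
    ≈-trans (unique g (≈-trans (ev-×id g) e)) (≈-sym (unique h (ev-×id h)))
    where unique = proj₂ (proj₂ (exponential (uncurry h)))

  -- ev binds the last of k + 1 variables, so an iterated exponential transposes that one first.
  rotate : ∀ c k → Hom ((c ++ zeros 1) ++ zeros k) (c ++ zeros (suc k))
  rotate c k = pair (W c 1 ∘ W c₁ k) (snoc (V c₁ k) (V c 1 zero ∘ W c₁ k))
    where c₁ = c ++ zeros 1

  split₁ : ∀ c k → Hom (c ++ zeros (suc k)) (c ++ zeros 1)
  split₁ c k = pair₁ (W c (suc k)) (V c (suc k) (fromℕ k))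

  rotate⁻¹ : ∀ c k → Hom (c ++ zeros (suc k)) ((c ++ zeros 1) ++ zeros k)
  rotate⁻¹ c k = pair (split₁ c k) (V c (suc k) ⊙ inject₁)

  W-split₁ : ∀ c k → W c 1 ∘ split₁ c k ≈ W c (suc k)
  W-split₁ c k = W-pair {k = 1} (W c (suc k)) (λ _ → V c (suc k) (fromℕ k))

  V-split₁ : ∀ c k → V c 1 zero ∘ split₁ c k ≈ V c (suc k) (fromℕ k)
  V-split₁ c k = V-pair {k = 1} (W c (suc k)) (λ _ → V c (suc k) (fromℕ k)) zero

  W-rotate⁻¹ : ∀ c k → W (c ++ zeros 1) k ∘ rotate⁻¹ c k ≈ split₁ c k
  W-rotate⁻¹ c k = W-pair (split₁ c k) (V c (suc k) ⊙ inject₁)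

  V-rotate⁻¹ : ∀ c k i → V (c ++ zeros 1) k i ∘ rotate⁻¹ c k ≈ V c (suc k) (inject₁ i)
  V-rotate⁻¹ c k = V-pair (split₁ c k) (V c (suc k) ⊙ inject₁)

  W-rotate : ∀ c k → W c (suc k) ∘ rotate c k ≈ W c 1 ∘ W (c ++ zeros 1) k
  W-rotate c k = W-pair _ (snoc (V c₁ k) (V c 1 zero ∘ W c₁ k))
    where c₁ = c ++ zeros 1

  V-rotate : ∀ c k i → V c (suc k) i ∘ rotate c k ≈
             snoc (V (c ++ zeros 1) k) (V c 1 zero ∘ W (c ++ zeros 1) k) i
  V-rotate c k = V-pair (W c 1 ∘ W c₁ k) (snoc (V c₁ k) (V c 1 zero ∘ W c₁ k))
    where c₁ = c ++ zeros 1

  V-rotate-inject₁ : ∀ c k i → V c (suc k) (inject₁ i) ∘ rotate c k ≈ V (c ++ zeros 1) k i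
  V-rotate-inject₁ c k i = ≈-trans (V-rotate c k (inject₁ i)) (≡⇒≈ (snoc-inject₁ _ _ i))

  V-rotate-fromℕ : ∀ c k → V c (suc k) (fromℕ k) ∘ rotate c k ≈ V c 1 zero ∘ W (c ++ zeros 1) k
  V-rotate-fromℕ c k = ≈-trans (V-rotate c k (fromℕ k)) (≡⇒≈ (snoc-fromℕ k _ _))

  rotate-rotate⁻¹ : ∀ c k → rotate c k ∘ rotate⁻¹ c k ≈ id
  rotate-rotate⁻¹ c k = pair-ext c (suc k)
    (begin
      W c (suc k) ∘ (rotate c k ∘ r)  ≈⟨ pullˡ (W-rotate c k) ⟩
      (W c 1 ∘ W c₁ k) ∘ r            ≈⟨ assoc _ _ _ ⟩
      W c 1 ∘ (W c₁ k ∘ r)            ≈⟨ ∘-congˡ (W-rotate⁻¹ c k) ⟩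
      W c 1 ∘ split₁ c k              ≈⟨ W-split₁ c k ⟩
      W c (suc k)                     ≈⟨ identityʳ _ ⟨
      W c (suc k) ∘ id                ∎)
    (snoc-elim _
      (λ i → begin
        V c (suc k) (inject₁ i) ∘ (rotate c k ∘ r) ≈⟨ pullˡ (V-rotate-inject₁ c k i) ⟩
        V c₁ k i ∘ r                               ≈⟨ V-rotate⁻¹ c k i ⟩
        V c (suc k) (inject₁ i)                    ≈⟨ identityʳ _ ⟨
        V c (suc k) (inject₁ i) ∘ id               ∎)
      (begin
        V c (suc k) (fromℕ k) ∘ (rotate c k ∘ r) ≈⟨ pullˡ (V-rotate-fromℕ c k) ⟩
        (V c 1 zero ∘ W c₁ k) ∘ r                ≈⟨ assoc _ _ _ ⟩
        V c 1 zero ∘ (W c₁ k ∘ r)                ≈⟨ ∘-congˡ (W-rotate⁻¹ c k) ⟩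
        V c 1 zero ∘ split₁ c k                  ≈⟨ V-split₁ c k ⟩
        V c (suc k) (fromℕ k)                    ≈⟨ identityʳ _ ⟨
        V c (suc k) (fromℕ k) ∘ id               ∎))
    where
    open ≈-Reasoning
    c₁ = c ++ zeros 1
    r = rotate⁻¹ c k

  unlam : ∀ k {c} → Hom c (k ∷ []) → Hom (c ++ zeros k) (0 ∷ [])
  unlam k {c} g = apply (g ∘ W c k) (V c k)

  unlam-∘-pair : (g : Hom c (k ∷ [])) (h : Hom d c) (δ : VEnv d k) →
                 unlam k g ∘ pair h δ ≈ apply (g ∘ h) δ
  unlam-∘-pair {c = c} {k = k} g h δ = ≈-trans (apply-∘ _ (V c k) _)
    (apply-cong _ δ (≈-trans (assoc _ _ _) (∘-congˡ (W-pair h δ))) (V-pair h δ))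

  -- The induction step for k-fold exponentials: up to the order of the variables, uncurrying k + 1
  -- of them is one `uncurry` followed by k more.
  unlam-rotate : ∀ k {c} (g : Hom c (suc k ∷ [])) → unlam (suc k) g ∘ rotate c k ≈ unlam k (uncurry g)
  unlam-rotate k {c} g = begin
    unlam (suc k) g ∘ rotate c k
      ≈⟨ unlam-∘-pair g _ δ ⟩
    apply (g ∘ (W c 1 ∘ W c₁ k)) δ
      ≈⟨ apply-suc _ δ ⟩
    apply (applyLast (g ∘ (W c 1 ∘ W c₁ k)) (δ (fromℕ k))) (δ ⊙ inject₁)
      ≈⟨ apply-cong (δ ⊙ inject₁) (V c₁ k)
           (applyLast-cong (≈-sym (assoc _ _ _)) (≡⇒≈ (snoc-fromℕ k _ _))) (λ i → ≡⇒≈ (snoc-inject₁ _ _ i)) ⟩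
    apply (applyLast ((g ∘ W c 1) ∘ W c₁ k) (V c 1 zero ∘ W c₁ k)) (V c₁ k)
      ≈⟨ apply-congʳ (V c₁ k) (applyLast-∘ _ _ _) ⟨
    unlam k (uncurry g) ∎
    where
    open ≈-Reasoning
    c₁ = c ++ zeros 1
    δ = snoc (V c₁ k) (V c 1 zero ∘ W c₁ k)

  -- At zero, `c ++ []` is not c by computation, and `pair id (λ ())` is the isomorphism between
  -- them.
  lam : ∀ k {c} → Hom (c ++ zeros k) (0 ∷ []) → Hom c (k ∷ [])
  lam zero    f = f ∘ pair id (λ ())
  lam (suc k) f = curry (lam k (f ∘ rotate _ k))

  lam-β : ∀ k {c} (f : Hom (c ++ zeros k) (0 ∷ [])) → unlam k (lam k f) ≈ f
  lam-β zero {c} f = begin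
    unlam 0 (f ∘ pair id (λ ()))     ≈⟨ apply-zero _ (V c 0) ⟩
    (f ∘ pair id (λ ())) ∘ W c 0     ≈⟨ assoc _ _ _ ⟩
    f ∘ (pair id (λ ()) ∘ W c 0)     ≈⟨ ∘-congˡ (pair-ext c 0
      (≈-trans (pullˡ (W-pair {k = 0} id (λ ()))) (≈-trans (identityˡ _) (≈-sym (identityʳ _)))) (λ ())) ⟩
    f ∘ id                           ≈⟨ identityʳ f ⟩
    f                                ∎
    where open ≈-Reasoning
  lam-β (suc k) {c} f = begin
    -- `rotate` and its inverse are inserted so that `unlam-rotate` applies.
    unlam (suc k) (lam (suc k) f)               ≈⟨ ≈-trans (assoc _ _ _) (≈-trans (∘-congˡ (rotate-rotate⁻¹ c k)) (identityʳ _)) ⟨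
    (unlam (suc k) (lam (suc k) f) ∘ rotate c k) ∘ rotate⁻¹ c k ≈⟨ ∘-congʳ (unlam-rotate k _) ⟩
    unlam k (uncurry (lam (suc k) f)) ∘ rotate⁻¹ c k ≈⟨ ∘-congʳ (apply-congʳ (V c₁ k) (∘-congʳ (curry-β _))) ⟩
    unlam k (lam k (f ∘ rotate c k)) ∘ rotate⁻¹ c k ≈⟨ ∘-congʳ (lam-β k (f ∘ rotate c k)) ⟩
    (f ∘ rotate c k) ∘ rotate⁻¹ c k ≈⟨ ≈-trans (assoc _ _ _) (≈-trans (∘-congˡ (rotate-rotate⁻¹ c k)) (identityʳ f)) ⟩
    f ∎
    where
    open ≈-Reasoning
    c₁ = c ++ zeros 1

  lam-ext : ∀ k {c} {g h : Hom c (k ∷ [])} → unlam k g ≈ unlam k h → g ≈ h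
  lam-ext zero {c} {g} {h} e = begin
    g                         ≈⟨ contract g ⟨
    unlam 0 g ∘ pair id (λ ()) ≈⟨ ∘-congʳ e ⟩
    unlam 0 h ∘ pair id (λ ()) ≈⟨ contract h ⟩
    h                         ∎
    where
    open ≈-Reasoning
    contract : (f : Hom c (0 ∷ [])) → unlam 0 f ∘ pair id (λ ()) ≈ f
    contract f = ≈-trans (unlam-∘-pair f id (λ ())) (≈-trans (apply-zero _ (λ ())) (identityʳ f))
  lam-ext (suc k) {c} {g} {h} e = curry-ext (lam-ext k
    (≈-trans (≈-sym (unlam-rotate k g)) (≈-trans (∘-congʳ e) (unlam-rotate k h))))

  lam-unique : ∀ k {c} {g : Hom c (k ∷ [])} {f : Hom (c ++ zeros k) (0 ∷ [])} → unlam k g ≈ f → g ≈ lam k f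
  lam-unique k {f = f} e = lam-ext k (≈-trans e (≈-sym (lam-β k f)))

  lam-cong : ∀ k {c} {f g : Hom (c ++ zeros k) (0 ∷ [])} → f ≈ g → lam k f ≈ lam k g
  lam-cong k e = lam-unique k (≈-trans (lam-β k _) e)

  -- By uniqueness of transposes, since `unlam` commutes with a change of stage. This naturality
  -- carries `eval-∘` under binders.
  lam-∘ : ∀ k {c} (f : Hom (c ++ zeros k) (0 ∷ [])) (h : Hom d c) →
          lam k f ∘ h ≈ lam k (f ∘ pair (h ∘ W d k) (V d k))
  lam-∘ {d = d} k {c} f h = lam-unique k (begin
    unlam k (lam k f ∘ h)                              ≈⟨ apply-congʳ (V d k) (assoc _ _ _) ⟩
    apply (lam k f ∘ (h ∘ W d k)) (V d k)              ≈⟨ unlam-∘-pair (lam k f) (h ∘ W d k) (V d k) ⟨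
    unlam k (lam k f) ∘ pair (h ∘ W d k) (V d k)       ≈⟨ ∘-congʳ (lam-β k f) ⟩
    f ∘ pair (h ∘ W d k) (V d k)                       ∎)
    where open ≈-Reasoning

  apply-lam : ∀ k {c} (f : Hom (c ++ zeros k) (0 ∷ [])) (δ : VEnv c k) → apply (lam k f) δ ≈ f ∘ pair id δ
  apply-lam k f δ = begin
    apply (lam k f) δ             ≈⟨ apply-congʳ δ (identityʳ _) ⟨
    apply (lam k f ∘ id) δ        ≈⟨ unlam-∘-pair (lam k f) id δ ⟨
    unlam k (lam k f) ∘ pair id δ ≈⟨ ∘-congʳ (lam-β k f) ⟩
    f ∘ pair id δ                 ∎
    where open ≈-Reasoning

-- The classifying theory of a presentation

module Derivations {ℓ} (P : Presentation ℓ) where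
  private
    S = sig P
    module L = Logic P
  open Metatheory S
  open ClosedArgs S

  private variable
    Θ Θ′ Θ″ ks l : List ℕ
    n m p q k : ℕ

  infix 3 _≃_ _≃*_
  _≃_ : Tm S Θ n → Tm S Θ n → Set ℓ
  _≃_ = Derivable P

  _≃*_ : Args S Θ n ks → Args S Θ n ks → Set ℓ
  _≃*_ = ArgsDeriv P

  ≡⇒≃ : {s t : Tm S Θ n} → s ≡ t → s ≃ t
  ≡⇒≃ refl = L.refl

  ≃-respˡʳ : {s s′ t t′ : Tm S Θ n} → s ≡ s′ → t ≡ t′ → s ≃ t → s′ ≃ t′
  ≃-respˡʳ refl refl d = d

  lookup-≃ : {as bs : Args S Θ n ks} → as ≃* bs → (p : ks ∋ k) → lookupArgs S as p ≃ lookupArgs S bs p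
  lookup-≃ (d L.∷ ds) here      = d
  lookup-≃ (d L.∷ ds) (there p) = lookup-≃ ds p

  ≃*-ext : {as bs : Args S Θ n ks} → (∀ {k} (p : ks ∋ k) → lookupArgs S as p ≃ lookupArgs S bs p) → as ≃* bs
  ≃*-ext {as = []}     {[]}     h = L.[]
  ≃*-ext {as = t ∷ as} {u ∷ bs} h = h here L.∷ ≃*-ext (λ p → h (there p))

  ≃*-ext-++ : ∀ ks {as bs : Args S Θ n (ks ++ l)} →
              (∀ {k} (p : ks ∋ k) → lookupArgs S as (∋-inl l p) ≃ lookupArgs S bs (∋-inl l p)) →
              (∀ {k} (p : l ∋ k) → lookupArgs S as (∋-inr ks p) ≃ lookupArgs S bs (∋-inr ks p)) → as ≃* bs
  ≃*-ext-++ ks {as} {bs} h h′ = ≃*-ext (++-elim ks (λ p → lookupArgs S as p ≃ lookupArgs S bs p) h h′)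

  opaque
    ≃*-isEquivalence : IsEquivalence (_≃*_ {Θ} {n} {ks})
    ≃*-isEquivalence = record
      { refl  = ≃*-ext λ _ → L.refl
      ; sym   = λ d → ≃*-ext λ p → L.sym (lookup-≃ d p)
      ; trans = λ d e → ≃*-ext λ p → L.trans (lookup-≃ d p) (lookup-≃ e p)
      }

  ≃*-refl : {as : Args S Θ n ks} → as ≃* as
  ≃*-refl = IsEquivalence.refl ≃*-isEquivalence

  opaque
    ≡⇒≃* : {as bs : Args S Θ n ks} → as ≡ bs → as ≃* bs
    ≡⇒≃* refl = ≃*-refl

  -- The rule concatenates variable contexts by itself; with the identity metasubstitution over m
  -- variables, only the weakening remains.
  weaken-≃ : ∀ m {s t : Tm S Θ n} → s ≃ t → ren S (_↑ˡ m) s ≃ ren S (_↑ˡ m) t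
  weaken-≃ {Θ = Θ} {n = n} m {s} {t} d =
    ≃-respˡʳ (simplify s) (simplify t) (L.msubst d (≃*-refl {as = idArgsₙ m}))
    where
    simplify : ∀ u → msub S (L.wkR n (idArgsₙ m)) (L.wkL m u) ≡ ren S (_↑ˡ m) u
    simplify u = trans (cong (λ γ → msub S γ (ren S (_↑ˡ m) u)) (ren-idArgsₙ (n ↑ʳ_))) (msub-id _)

  -- The rules never substitute for variables, so the n variables are traded for
  -- metavariables of arity 0 by instantiating m := (x⃗)s in m[m₁[],…,mₙ[]].
  -- Here N is n + 0, the context in which the rule delivers an instance of s.
  sub-≃ : {s t : Tm S Θ n} {σ σ′ : Fin n → Tm S Θ p} → s ≃ t → (∀ i → σ i ≃ σ′ i) → sub S σ s ≃ sub S σ′ t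
  sub-≃ {Θ = Θ} {n = n} {p = p} {s} {t} {σ} {σ′} d e =
    -- The last of three uses of the rule: `moved` makes room for the names, `closed` trades the
    -- variables for them, and here they are instantiated over p variables.
    ≃-respˡʳ (simplify s σ) (simplify t σ′) (L.msubst closed (instances-≃ e))
    where
    N = n + 0
    z = zeros N
    ι = inlArgs Θ z

    moved : Tm S Θ n → Tm S (Θ ++ z) N
    moved u = msub S (wk₀ N ι) (ren S (_↑ˡ 0) u)

    moved-≃ : moved s ≃ moved t
    moved-≃ = ≃-respˡʳ (simp s) (simp t) (L.msubst d (≃*-refl {as = ι}))
      where
      simp : ∀ u → msub S (L.wkR n ι) (L.wkL 0 u) ≡ moved u
      simp u = cong (λ γ → msub S γ (ren S (_↑ˡ 0) u)) (renArgs-cong (λ ()) ι)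

    names : Fin N → Tm S (Θ ++ z) 0
    names i = mvar (∋-inr Θ (pos i)) []

    closed : sub S names (moved s) ≃ sub S names (moved t)
    -- The derivation enters through an argument of the rule: the term being instantiated is fixed,
    -- and its metavariable m receives the two sides.
    closed = ≃-respˡʳ (simp (moved s)) (simp (moved t))
      (L.msubst (L.refl {t = evTm N}) (moved-≃ L.∷ ≃*-refl {as = zeroArgs N names}))
      where
      simp : ∀ u → msub S (L.wkR 0 (u ∷ zeroArgs N names)) (L.wkL 0 (evTm N)) ≡ sub S names u
      simp u = trans (cong₂ (msub S) (renArgs-cong (λ ()) (u ∷ zeroArgs N names)) (ren-id (λ ()) (evTm N)))
        (msub-evTm N u names)

    padded : (Fin n → Tm S Θ p) → Fin N → Tm S Θ p
    padded σ = σ ⊞ (λ ())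

    instances : ∀ {q} → (Fin N → Tm S Θ q) → Args S Θ q (Θ ++ z)
    instances δ = appendArgs (idArgsₙ _) (valueArgs N δ)

    instances-≃ : (∀ i → σ i ≃ σ′ i) → instances (padded σ) ≃* instances (padded σ′)
    instances-≃ e = ≃*-ext-++ Θ
      (λ q → ≡⇒≃ (trans (lookup-inl (idArgsₙ p) (valueArgs N _) q) (sym (lookup-inl (idArgsₙ p) (valueArgs N _) q))))
      (zeros-elim N
        (λ q → lookupArgs S (instances (padded σ)) (∋-inr Θ q) ≃ lookupArgs S (instances (padded σ′)) (∋-inr Θ q))
        λ i → ≃-respˡʳ (sym (value σ i)) (sym (value σ′ i)) (weaken-≃ 0 (padded-≃ i)))
      where
      value : ∀ σ i → lookupArgs S (instances (padded σ)) (∋-inr Θ (pos i)) ≡ ren S (_↑ˡ 0) (padded σ i)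
      value σ i = trans (lookup-inr (idArgsₙ p) _ (pos i)) (lookup-zeroArgs {n = p} N _ i)
      padded-≃ : ∀ i → padded σ i ≃ padded σ′ i
      padded-≃ = ↑-elim n _
        (λ i → ≃-respˡʳ (sym (⊞-↑ˡ σ (λ ()) i)) (sym (⊞-↑ˡ σ′ (λ ()) i)) (e i)) (λ ())

    simplify : ∀ u σ → msub S (L.wkR 0 (instances (padded σ))) (L.wkL p (sub S names (moved u))) ≡ sub S σ u
    simplify u σ = begin
      msub S (renArgs S (0 ↑ʳ_) (instances σ̂)) (ren S (_↑ˡ p) (sub S names (moved u)))
        ≡⟨ cong₂ (msub S) (renArgs-id (λ _ → refl) (instances σ̂)) (ren-sub _ names (moved u)) ⟩
      msub S (instances σ̂) (sub S (ren S (_↑ˡ p) ⊙ names) (moved u))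
        -- Instantiating the names by σ̂ amounts to instantiating them by the N variables and then
        -- substituting σ̂.
        ≡⟨ sub-msub {γ′ = instances var} (msub-inr-value N (idArgsₙ p) σ̂)
             (trans (subArgs-append σ̂ (idArgsₙ N) _)
               (cong₂ appendArgs (subArgs-idArgsₙ σ̂) (subArgs-valueArgs N σ̂ var)))
             (moved u) ⟩
      sub S σ̂ (msub S (instances var) (moved u))
        ≡⟨ cong (sub S σ̂) (msub-msub (instances var) (wk₀ N ι) (ren S (_↑ˡ 0) u)) ⟩
      sub S σ̂ (msub S (msubArgs S (instances var) (wk₀ N ι)) (ren S (_↑ˡ 0) u))
        ≡⟨ cong (λ γ → sub S σ̂ (msub S γ (ren S (_↑ˡ 0) u))) (msubArgs-inl _) ⟩
      sub S σ̂ (msub S (idArgsₙ N) (ren S (_↑ˡ 0) u))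
        ≡⟨ cong (sub S σ̂) (msub-id (ren S (_↑ˡ 0) u)) ⟩
      sub S σ̂ (ren S (_↑ˡ 0) u)
        ≡⟨ trans (sub-ren _ _ u) (sub-cong (⊞-↑ˡ σ (λ ())) u) ⟩
      sub S σ u ∎
      where
      open ≡-Reasoning
      σ̂ = padded σ

  ren-≃ : {s t : Tm S Θ n} (ρ : Fin n → Fin p) → s ≃ t → ren S ρ s ≃ ren S ρ t
  ren-≃ {s = s} {t} ρ d = ≃-respˡʳ (sym (ren≡sub ρ s)) (sym (ren≡sub ρ t)) (sub-≃ d (λ _ → L.refl))

  renArgs-≃ : {as bs : Args S Θ n ks} (ρ : Fin n → Fin p) → as ≃* bs → renArgs S ρ as ≃* renArgs S ρ bs
  renArgs-≃ {as = as} {bs} ρ d = ≃*-ext λ p →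
    ≃-respˡʳ (sym (lookup-renArgs ρ as p)) (sym (lookup-renArgs ρ bs p)) (ren-≃ _ (lookup-≃ d p))

  -- The rule concludes over n + n variables, the two copies coming from the term and from the
  -- arguments; the substitution `merge` identifies them.
  msub-≃ : {γ γ′ : Args S Θ′ n Θ} {s t : Tm S Θ n} → γ ≃* γ′ → s ≃ t → msub S γ s ≃ msub S γ′ t
  msub-≃ {n = n} {γ = γ} {γ′} {s} {t} d e =
    ≃-respˡʳ (simplify γ s) (simplify γ′ t) (sub-≃ (L.msubst e d) (λ _ → L.refl))
    where
    merge : Fin (n + n) → Fin n
    merge = (λ i → i) ⊞ (λ i → i)
    simplify : ∀ γ u → sub S (var ⊙ merge) (msub S (L.wkR n γ) (L.wkL n u)) ≡ msub S γ u
    simplify γ u = begin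
      sub S (var ⊙ merge) (msub S (renArgs S (n ↑ʳ_) γ) (ren S (_↑ˡ n) u))
        ≡⟨ sub-msub {σ = var ⊙ merge} (λ _ → refl)
             (subArgs-ren-id (var ⊙ merge) (n ↑ʳ_) (λ i → cong var (⊞-↑ʳ (λ i → i) (λ i → i) i)) γ) (ren S (_↑ˡ n) u) ⟨
      msub S γ (sub S (var ⊙ merge) (ren S (_↑ˡ n) u))
        ≡⟨ cong (msub S γ) (sub-ren-id (var ⊙ merge) (_↑ˡ n) (λ i → cong var (⊞-↑ˡ (λ i → i) (λ i → i) i)) u) ⟩
      msub S γ u ∎
      where open ≡-Reasoning

  opaque
    comp-≃ : {s s′ : Args S Θ 0 Θ′} {t t′ : Args S Θ′ 0 ks} → s ≃* s′ → t ≃* t′ → comp s t ≃* comp s′ t′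
    comp-≃ {s = s} {s′} {t} {t′} d e = ≃*-ext λ p →
      ≃-respˡʳ (sym (lookup-comp s t p)) (sym (lookup-comp s′ t′ p))
        (msub-≃ (renArgs-≃ _ d) (lookup-≃ e p))

  abstract-≃ : {s t : Tm S (Θ ++ (0 ∷ [])) k} → s ≃ t → abstractTm s ≃ abstractTm t
  abstract-≃ d = msub-≃ ≃*-refl (ren-≃ inject₁ d)

-- Terms over the empty signature inside any signature

module Embedding {ℓ} (S : Signature ℓ) where
  private
    E = EmptySig
    module M = Metatheory E
  open Metatheory S
  open ClosedArgs S

  private variable
    Θ Θ′ Θ″ ks l : List ℕ
    n m p q k : ℕ

  mutual
    embed : Tm E Θ n → Tm S Θ n
    embed (var i)     = var i
    embed (mvar m ts) = mvar m (embedTms ts)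
    embed (op () as)

    embedTms : Tms E Θ n k → Tms S Θ n k
    embedTms []       = []
    embedTms (t ∷ ts) = embed t ∷ embedTms ts

  embedArgs : Args E Θ n ks → Args S Θ n ks
  embedArgs []       = []
  embedArgs (t ∷ ts) = embed t ∷ embedArgs ts

  index-embedTms : (ts : Tms E Θ n k) → ∀ i → indexTms S (embedTms ts) i ≡ embed (indexTms E ts i)
  index-embedTms (t ∷ ts) zero    = refl
  index-embedTms (t ∷ ts) (suc i) = index-embedTms ts i

  lookup-embedArgs : (as : Args E Θ n ks) (p : ks ∋ k) → lookupArgs S (embedArgs as) p ≡ embed (lookupArgs E as p)
  lookup-embedArgs (t ∷ ts) here      = refl
  lookup-embedArgs (t ∷ ts) (there p) = lookup-embedArgs ts p

  embed-tabTms : (f : Fin k → Tm E Θ n) → embedTms (tabTms E f) ≡ tabTms S (embed ⊙ f)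
  embed-tabTms {k = zero}  f = refl
  embed-tabTms {k = suc k} f = cong (embed (f zero) ∷_) (embed-tabTms (f ⊙ suc))

  embed-snocTms : (ts : Tms E Θ n k) (u : Tm E Θ n) → embedTms (snocTms E ts u) ≡ snocTms S (embedTms ts) (embed u)
  embed-snocTms []       u = refl
  embed-snocTms (t ∷ ts) u = cong (_ ∷_) (embed-snocTms ts u)

  embed-tabArgs : ∀ ks {f : ∀ {k} → ks ∋ k → Tm E Θ (n + k)} {g : ∀ {k} → ks ∋ k → Tm S Θ (n + k)} →
                  (∀ {k} (p : ks ∋ k) → embed (f p) ≡ g p) → embedArgs (tabArgs E ks f) ≡ tabArgs S ks g
  embed-tabArgs []       h = refl
  embed-tabArgs (k ∷ ks) h = cong₂ _∷_ (h here) (embed-tabArgs ks (λ p → h (there p)))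

  embed-allVars : (p : Θ ∋ k) → embed (mvar p (allVars E)) ≡ mvar p (allVars S)
  embed-allVars p = cong (mvar p) (embed-tabTms var)

  embed-id : ∀ Θ → embedArgs (idArgs E Θ) ≡ idArgs S Θ
  embed-id Θ = embed-tabArgs Θ embed-allVars

  embed-π₁ : ∀ Θ l → embedArgs (π₁ Θ l) ≡ inlArgs Θ l
  embed-π₁ Θ l = embed-tabArgs Θ (λ p → embed-allVars (∋-inl l p))

  embed-π₂ : ∀ Θ l → embedArgs (π₂ Θ l) ≡ inrArgs Θ l
  embed-π₂ Θ l = embed-tabArgs l (λ p → embed-allVars (∋-inr Θ p))

  mutual
    embed-sub : {σ : Fin n → Tm E Θ p} {σ′ : Fin n → Tm S Θ p} → (∀ i → embed (σ i) ≡ σ′ i) →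
                ∀ t → embed (sub E σ t) ≡ sub S σ′ (embed t)
    embed-sub h (var i)     = h i
    embed-sub h (mvar m ts) = cong (mvar m) (embedTms-sub h ts)
    embed-sub h (op () as)

    embedTms-sub : {σ : Fin n → Tm E Θ p} {σ′ : Fin n → Tm S Θ p} → (∀ i → embed (σ i) ≡ σ′ i) →
                   (ts : Tms E Θ n k) → embedTms (subTms E σ ts) ≡ subTms S σ′ (embedTms ts)
    embedTms-sub h []       = refl
    embedTms-sub h (t ∷ ts) = cong₂ _∷_ (embed-sub h t) (embedTms-sub h ts)

  embed-ren : (ρ : Fin n → Fin p) (t : Tm E Θ n) → embed (ren E ρ t) ≡ ren S ρ (embed t)
  embed-ren ρ t = trans (cong embed (M.ren≡sub ρ t))
    (trans (embed-sub (λ _ → refl) t) (sym (ren≡sub ρ (embed t))))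

  -- `liftRen` takes the signature as a module parameter, so its two instances are distinct until
  -- `splitAt` has been resolved.
  liftRen-embed : ∀ k (ρ : Fin n → Fin p) i → liftRen E k ρ i ≡ liftRen S k ρ i
  liftRen-embed {n = n} k ρ i with splitAt n i
  ... | inj₁ _ = refl
  ... | inj₂ _ = refl

  embedArgs-ren : (ρ : Fin n → Fin p) (as : Args E Θ n ks) → embedArgs (renArgs E ρ as) ≡ renArgs S ρ (embedArgs as)
  embedArgs-ren ρ []                 = refl
  embedArgs-ren ρ (_∷_ {k = k} t ts) = cong₂ _∷_
    (trans (embed-ren _ t) (ren-cong (liftRen-embed k ρ) (embed t))) (embedArgs-ren ρ ts)

  mutual
    embed-msub : (γ : Args E Θ′ n Θ) (t : Tm E Θ n) → embed (msub E γ t) ≡ msub S (embedArgs γ) (embed t)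
    embed-msub γ (var i)     = refl
    embed-msub {n = n} γ (mvar m ts)
      rewrite lookup-embedArgs γ m | sym (embedTms-msub γ ts) = embed-sub pointwise (lookupArgs E γ m)
      where
      us = msubTms E γ ts
      pointwise : ∀ i → embed (instSub E us i) ≡ instSub S (embedTms us) i
      pointwise i with splitAt n i
      ... | inj₁ _ = refl
      ... | inj₂ j = sym (index-embedTms us j)
    embed-msub γ (op () as)

    embedTms-msub : (γ : Args E Θ′ n Θ) (ts : Tms E Θ n k) →
                    embedTms (msubTms E γ ts) ≡ msubTms S (embedArgs γ) (embedTms ts)
    embedTms-msub γ []       = refl
    embedTms-msub γ (t ∷ ts) = cong₂ _∷_ (embed-msub γ t) (embedTms-msub γ ts)

  embed-Mcomp : (s : MHom Θ Θ′) (t : MHom Θ′ ks) → embedArgs (Mcomp s t) ≡ comp (embedArgs s) (embedArgs t)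
  embed-Mcomp s []                 = refl
  embed-Mcomp s (_∷_ {k = k} t ts) = cong₂ _∷_
    (trans (embed-msub (ClosedArgs.wk₀ E k s) t) (cong (λ γ → msub S γ (embed t)) (embedArgs-ren _ s)))
    (embed-Mcomp s ts)

-- Products and exponentials of tuples of terms modulo derivability

module Classifying {ℓ} (P : Presentation ℓ) where
  private S = sig P
  private module L = Logic P
  open Metatheory S
  open ClosedArgs S
  open Embedding S
  open Derivations P

  private variable
    a b c : List ℕ
    k : ℕ

  abstractArgs : Args S (c ++ (0 ∷ [])) 0 a → Args S c 0 (⇒0 a)
  abstractArgs []       = []
  abstractArgs (t ∷ ts) = abstractTm t ∷ abstractArgs ts

  lookup-abstractArgs : (as : Args S (c ++ (0 ∷ [])) 0 a) (p : a ∋ k) →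
                        lookupArgs S (abstractArgs as) (∋-suc p) ≡ abstractTm (lookupArgs S as p)
  lookup-abstractArgs (t ∷ ts) here      = refl
  lookup-abstractArgs (t ∷ ts) (there p) = lookup-abstractArgs ts p

  -- This is `T (ev a) ∘ (g ×id)` with the pairing written out as concatenation.
  evaluate : Args S c 0 (⇒0 a) → Args S (c ++ (0 ∷ [])) 0 a
  evaluate {c = c} {a} g = comp
    (appendArgs (comp (embedArgs (π₁ c (0 ∷ []))) g) (embedArgs (π₂ c (0 ∷ [])))) (embedArgs (ev a))

  -- Reduces the universal property of the exponential, one component at a time, to `abstractTm` and
  -- `concreteTm` being mutually inverse.
  lookup-evaluate : (g : Args S c 0 (⇒0 a)) (p : a ∋ k) →
                    lookupArgs S (evaluate g) p ≡ concreteTm (lookupArgs S g (∋-suc p))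
  lookup-evaluate {c = c} {a} {k} g p = begin
    lookupArgs S (evaluate g) p
      ≡⟨ lookup-comp h (embedArgs (ev a)) p ⟩
    msub S (wk₀ k h) (lookupArgs S (embedArgs (ev a)) p)
      ≡⟨ cong (msub S (wk₀ k h)) (trans (lookup-embedArgs (ev a) p)
           (cong embed (Metatheory.lookup-tab EmptySig a _ p))) ⟩
    msub S (wk₀ k h) (mvar (∋-inl (0 ∷ []) (∋-suc p)) (embedTms (snocTms EmptySig (allVars EmptySig) (mvar new []))))
      ≡⟨ cong (λ ts → msub S (wk₀ k h) (mvar (∋-inl (0 ∷ []) (∋-suc p)) ts))
           (trans (embed-snocTms (allVars EmptySig) (mvar new [])) (cong (λ ts → snocTms S ts (mvar new [])) (embed-tabTms var))) ⟩
    msub S (wk₀ k h) (mvar (∋-inl (0 ∷ []) (∋-suc p)) ts)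
      ≡⟨ msub-mvar h _ ts ⟩
    sub S (λ i → msub S (wk₀ k h) (indexTms S ts i)) (lookupArgs S h (∋-inl (0 ∷ []) (∋-suc p)))
      ≡⟨ sub-cong pointwise (lookupArgs S h (∋-inl (0 ∷ []) (∋-suc p))) ⟩
    sub S (snoc var (newMeta c)) (lookupArgs S h (∋-inl (0 ∷ []) (∋-suc p)))
      ≡⟨ cong (sub S _) (trans (lookup-inl (comp (embedArgs (π₁ c (0 ∷ []))) g) _ (∋-suc p)) (lookup-comp _ g (∋-suc p))) ⟩
    sub S (snoc var (newMeta c)) (msub S (wk₀ (suc k) (embedArgs (π₁ c (0 ∷ [])))) (lookupArgs S g (∋-suc p)))
      ≡⟨ cong (λ γ → sub S (snoc var (newMeta c)) (msub S (wk₀ (suc k) γ) (lookupArgs S g (∋-suc p)))) (embed-π₁ c (0 ∷ [])) ⟩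
    concreteTm (lookupArgs S g (∋-suc p)) ∎
    where
    open ≡-Reasoning
    h = appendArgs (comp (embedArgs (π₁ c (0 ∷ []))) g) (embedArgs (π₂ c (0 ∷ [])))
    new : (⇒0 a ++ (0 ∷ [])) ∋ 0
    new = ∋-inr (⇒0 a) here
    ts : Tms S (⇒0 a ++ (0 ∷ [])) k (suc k)
    ts = snocTms S (allVars S) (mvar new [])
    pointwise : ∀ i → msub S (wk₀ k h) (indexTms S ts i) ≡ snoc var (newMeta c) i
    pointwise i = trans (cong (msub S (wk₀ k h)) (index-snocTms (allVars S) (mvar new []) i)) (snoc-elim
      (λ i → msub S (wk₀ k h) (snoc (indexTms S (allVars S)) (mvar new []) i) ≡ snoc var (newMeta c) i)
      (λ j → trans (cong (msub S (wk₀ k h)) (trans (snoc-inject₁ _ _ j) (index-tab var j))) (sym (snoc-inject₁ var _ j)))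
      (trans (cong (msub S (wk₀ k h)) (snoc-fromℕ k _ _)) (trans (msub-mvar h new [])
        (trans (cong (sub S _) (trans (lookup-inr (comp (embedArgs (π₁ c (0 ∷ []))) g) _ here)
                 (cong (λ as → lookupArgs S as here) (embed-π₂ c (0 ∷ [])))))
               (sym (snoc-fromℕ k var _)))))
      i)

  lookup-comp-π₁ : ∀ a b (h : Args S c 0 (a ++ b)) (p : a ∋ k) →
                   lookupArgs S (comp h (embedArgs (π₁ a b))) p ≡ lookupArgs S h (∋-inl b p)
  lookup-comp-π₁ a b h p rewrite embed-π₁ a b = lookup-comp-inl h p

  lookup-comp-π₂ : ∀ a b (h : Args S c 0 (a ++ b)) (p : b ∋ k) →
                   lookupArgs S (comp h (embedArgs (π₂ a b))) p ≡ lookupArgs S h (∋-inr a p)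
  lookup-comp-π₂ a b h p rewrite embed-π₂ a b = lookup-comp-inr a h p

  -- Opaque, lest comparing two classifying theories unfold their proof fields.
  opaque
    terminals : ∀ c → ∃! _≃*_ (λ (_ : Args S c 0 []) → Level.Lift ℓ ⊤)
    terminals c = [] , lift tt , λ { [] _ → L.[] }

    products : (f : Args S c 0 a) (g : Args S c 0 b) →
               ∃! _≃*_ (λ h → (comp h (embedArgs (π₁ a b)) ≃* f) × (comp h (embedArgs (π₂ a b)) ≃* g))
    products {a = a} {b} f g = appendArgs f g ,
      ( ≃*-ext (λ p → ≡⇒≃ (trans (lookup-comp-π₁ a b _ p) (lookup-inl f g p)))
      , ≃*-ext (λ p → ≡⇒≃ (trans (lookup-comp-π₂ a b _ p) (lookup-inr f g p)))) ,
      λ h (d , e) → ≃*-ext-++ a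
        (λ p → ≃-respˡʳ (lookup-comp-π₁ a b h p) (sym (lookup-inl f g p)) (lookup-≃ d p))
        (λ p → ≃-respˡʳ (lookup-comp-π₂ a b h p) (sym (lookup-inr f g p)) (lookup-≃ e p))

  opaque
    -- The pairing in the type must compute to `appendArgs`, as otherwise the left-hand side is not
    -- `evaluate g`.
    unfolding products

    exponentials : (f : Args S (c ++ (0 ∷ [])) 0 a) →
                   ∃! _≃*_ (λ (g : Args S c 0 (⇒0 a)) →
                     comp (proj₁ (products (comp (embedArgs (π₁ c (0 ∷ []))) g) (embedArgs (π₂ c (0 ∷ [])))))
                       (embedArgs (ev a)) ≃* f)
    exponentials {a = a} f = abstractArgs f ,
      ≃*-ext (λ p → ≡⇒≃ (trans (lookup-evaluate (abstractArgs f) p)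
        (trans (cong concreteTm (lookup-abstractArgs f p)) (concrete-abstract (lookupArgs S f p))))) ,
      λ g d → ≃*-ext (lmap-suc-elim a (λ p → lookupArgs S g p ≃ lookupArgs S (abstractArgs f) p) λ p →
        ≃-respˡʳ (trans (cong abstractTm (lookup-evaluate g p)) (abstract-concrete (lookupArgs S g (∋-suc p))))
          (sym (lookup-abstractArgs f p)) (abstract-≃ (lookup-≃ d p)))

  theory : Theory ℓ
  theory = record
    { Hom             = λ a b → Args S a 0 b
    ; _≈_             = _≃*_
    ; ≈-isEquivalence = ≃*-isEquivalence
    ; id              = idArgs S _
    ; _∘_             = λ t s → comp s t
    ; ∘-resp-≈        = λ d e → comp-≃ e d
    -- `comp` is diagrammatic and `_∘_` is not, so the arguments of associativity are reversed and
    -- the two unit laws exchange.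
    ; assoc           = λ f g h → ≡⇒≃* (comp-assoc h g f)
    ; identityˡ       = λ f → ≡⇒≃* (comp-idʳ f)
    ; identityʳ       = λ f → ≡⇒≃* (comp-idˡ f)
    ; T               = embedArgs
    ; T-id            = λ a → ≡⇒≃* (embed-id a)
    ; T-∘             = λ s t → ≡⇒≃* (embed-Mcomp s t)
    ; terminal        = terminals
    ; product         = products
    ; exponential     = exponentials
    }

-- Interpretation of terms in a theory

module Evaluation {ℓ} (𝕋 : Theory ℓ) {S : Signature ℓ} where
  open Kit 𝕋

  private variable
    Θ Θ′ ks : List ℕ
    c d : List ℕ
    n m p k : ℕ

  Interpretation : Set ℓ
  Interpretation = ∀ o → Hom (arity S o) (0 ∷ [])

  weakenEnv : ∀ k → Env c Θ → Env (c ++ zeros k) Θ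
  weakenEnv k γ p = γ p ∘ W _ k

  liftVEnv : ∀ k → VEnv c n → VEnv (c ++ zeros k) (n + k)
  liftVEnv k δ = (λ i → δ i ∘ W _ k) ⊞ V _ k

  liftVEnv-rel : ∀ k {δ : VEnv c n} (h : Hom d (c ++ zeros k)) {ε : VEnv d n} {ζ : VEnv d k} →
                 (∀ i → (δ i ∘ W c k) ∘ h ≈ ε i) → (∀ j → V c k j ∘ h ≈ ζ j) →
                 ∀ i → liftVEnv k δ i ∘ h ≈ (ε ⊞ ζ) i
  liftVEnv-rel {n = n} k h e₁ e₂ i with splitAt n i
  ... | inj₁ j = e₁ j
  ... | inj₂ j = e₂ j

  ⊞-cong : {δ δ′ : VEnv c n} {ε ε′ : VEnv c k} → (∀ i → δ i ≈ δ′ i) → (∀ i → ε i ≈ ε′ i) →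
           ∀ i → (δ ⊞ ε) i ≈ (δ′ ⊞ ε′) i
  ⊞-cong {n = n} e₁ e₂ i with splitAt n i
  ... | inj₁ j = e₁ j
  ... | inj₂ j = e₂ j

  module _ (I : Interpretation) where
    mutual
      -- The stage c is independent of Θ and n, so that going under a binder only enlarges c, and a
      -- substitution only alters γ or δ.
      eval : Tm S Θ n → Env c Θ → VEnv c n → Hom c (0 ∷ [])
      eval (var i)     γ δ = δ i
      eval (mvar m ts) γ δ = apply (γ m) (evalTms ts γ δ)
      eval (op o as)   γ δ = I o ∘ tup (evalArgs as γ δ)

      evalTms : Tms S Θ n k → Env c Θ → VEnv c n → VEnv c k
      evalTms (t ∷ ts) γ δ zero    = eval t γ δ
      evalTms (t ∷ ts) γ δ (suc i) = evalTms ts γ δ i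

      evalArgs : Args S Θ n ks → Env c Θ → VEnv c n → Env c ks
      evalArgs (_∷_ {k = k} t ts) γ δ here      = lam k (eval t (weakenEnv k γ) (liftVEnv k δ))
      evalArgs (t ∷ ts)           γ δ (there p) = evalArgs ts γ δ p

  interpret : Interpretation → Args S c 0 ks → Hom c ks
  interpret I as = tup (evalArgs I as proj (λ ()))

  evalTms-index : ∀ I (ts : Tms S Θ n k) (γ : Env c Θ) δ i →
                  evalTms I ts γ δ i ≡ eval I (indexTms S ts i) γ δ
  evalTms-index I (t ∷ ts) γ δ zero    = refl
  evalTms-index I (t ∷ ts) γ δ (suc i) = evalTms-index I ts γ δ i

  evalArgs-lookup : ∀ I (as : Args S Θ n ks) (γ : Env c Θ) δ (p : ks ∋ k) →
                    evalArgs I as γ δ p ≡ lam k (eval I (lookupArgs S as p) (weakenEnv k γ) (liftVEnv k δ))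
  evalArgs-lookup I (t ∷ ts) γ δ here      = refl
  evalArgs-lookup I (t ∷ ts) γ δ (there p) = evalArgs-lookup I ts γ δ p

  mutual
    eval-cong : ∀ {I J} (t : Tm S Θ n) {γ γ′ : Env c Θ} {δ δ′ : VEnv c n} → (∀ o → I o ≈ J o) →
                (∀ {k} (p : Θ ∋ k) → γ p ≈ γ′ p) → (∀ i → δ i ≈ δ′ i) →
                eval I t γ δ ≈ eval J t γ′ δ′
    eval-cong (var i)     eI eγ eδ = eδ i
    eval-cong (mvar m ts) eI eγ eδ = apply-cong _ _ (eγ m) (evalTms-cong ts eI eγ eδ)
    eval-cong (op o as)   eI eγ eδ = ∘-resp-≈ (eI o) (tup-cong (evalArgs-cong as eI eγ eδ))

    evalTms-cong : ∀ {I J} (ts : Tms S Θ n k) {γ γ′ : Env c Θ} {δ δ′ : VEnv c n} → (∀ o → I o ≈ J o) →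
                   (∀ {k} (p : Θ ∋ k) → γ p ≈ γ′ p) → (∀ i → δ i ≈ δ′ i) →
                   ∀ i → evalTms I ts γ δ i ≈ evalTms J ts γ′ δ′ i
    evalTms-cong (t ∷ ts) eI eγ eδ zero    = eval-cong t eI eγ eδ
    evalTms-cong (t ∷ ts) eI eγ eδ (suc i) = evalTms-cong ts eI eγ eδ i

    evalArgs-cong : ∀ {I J} (as : Args S Θ n ks) {γ γ′ : Env c Θ} {δ δ′ : VEnv c n} → (∀ o → I o ≈ J o) →
                    (∀ {k} (p : Θ ∋ k) → γ p ≈ γ′ p) → (∀ i → δ i ≈ δ′ i) →
                    ∀ {k} (p : ks ∋ k) → evalArgs I as γ δ p ≈ evalArgs J as γ′ δ′ p
    evalArgs-cong (_∷_ {k = k} t ts) eI eγ eδ here = lam-cong k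
      (eval-cong t eI (λ p → ∘-congʳ (eγ p)) (⊞-cong (λ i → ∘-congʳ (eδ i)) (λ _ → ≈-refl)))
    evalArgs-cong (t ∷ ts) eI eγ eδ (there p) = evalArgs-cong ts eI eγ eδ p

  module _ {I : Interpretation} where

    mutual
      -- Naturality in the stage. It moves evaluations past the projection `W` that each binder
      -- introduces.
      eval-∘ : (t : Tm S Θ n) (γ : Env c Θ) (δ : VEnv c n) (h : Hom d c) →
               eval I t γ δ ∘ h ≈ eval I t (λ p → γ p ∘ h) (λ i → δ i ∘ h)
      eval-∘ (var i)     γ δ h = ≈-refl
      eval-∘ (mvar m ts) γ δ h = ≈-trans (apply-∘ (γ m) _ h) (apply-cong _ _ ≈-refl (evalTms-∘ ts γ δ h))
      eval-∘ (op o as)   γ δ h = ≈-trans (assoc _ _ _)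
        (∘-congˡ (≈-trans (tup-∘ _ h) (tup-cong (evalArgs-∘ as γ δ h))))

      evalTms-∘ : (ts : Tms S Θ n k) (γ : Env c Θ) (δ : VEnv c n) (h : Hom d c) →
                  ∀ i → evalTms I ts γ δ i ∘ h ≈ evalTms I ts (λ p → γ p ∘ h) (λ i → δ i ∘ h) i
      evalTms-∘ (t ∷ ts) γ δ h zero    = eval-∘ t γ δ h
      evalTms-∘ (t ∷ ts) γ δ h (suc i) = evalTms-∘ ts γ δ h i

      evalArgs-∘ : (as : Args S Θ n ks) (γ : Env c Θ) (δ : VEnv c n) (h : Hom d c) →
                   ∀ {k} (p : ks ∋ k) → evalArgs I as γ δ p ∘ h ≈ evalArgs I as (λ p → γ p ∘ h) (λ i → δ i ∘ h) p
      evalArgs-∘ {c = c} {d = d} (_∷_ {k = k} t ts) γ δ h here = ≈-trans (lam-∘ k _ h) (lam-cong k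
        (≈-trans (eval-∘ t _ _ h′) (eval-cong t (λ _ → ≈-refl) (λ p → slide (γ p))
          (liftVEnv-rel k h′ (λ i → slide (δ i)) (V-pair (h ∘ W d k) (V d k))))))
        where
        h′ = pair (h ∘ W d k) (V d k)
        slide : ∀ {b} (f : Hom c b) → (f ∘ W c k) ∘ h′ ≈ (f ∘ h) ∘ W d k
        slide f = ≈-trans (assoc _ _ _) (≈-trans (∘-congˡ (W-pair _ (V d k))) (≈-sym (assoc _ _ _)))
      evalArgs-∘ (t ∷ ts) γ δ h (there p) = evalArgs-∘ ts γ δ h p

    mutual
      eval-ren : {ρ : Fin n → Fin m} (t : Tm S Θ n) {γ : Env c Θ} {δ : VEnv c m} {δ′ : VEnv c n} →
                 (∀ i → δ (ρ i) ≈ δ′ i) → eval I (ren S ρ t) γ δ ≈ eval I t γ δ′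
      eval-ren (var i)     e = e i
      eval-ren (mvar m ts) e = apply-cong _ _ ≈-refl (evalTms-ren ts e)
      eval-ren (op o as)   e = ∘-congˡ (tup-cong (evalArgs-ren as e))

      evalTms-ren : {ρ : Fin n → Fin m} (ts : Tms S Θ n k) {γ : Env c Θ} {δ : VEnv c m} {δ′ : VEnv c n} →
                    (∀ i → δ (ρ i) ≈ δ′ i) → ∀ i → evalTms I (renTms S ρ ts) γ δ i ≈ evalTms I ts γ δ′ i
      evalTms-ren (t ∷ ts) e zero    = eval-ren t e
      evalTms-ren (t ∷ ts) e (suc i) = evalTms-ren ts e i

      evalArgs-ren : {ρ : Fin n → Fin m} (as : Args S Θ n ks) {γ : Env c Θ} {δ : VEnv c m} {δ′ : VEnv c n} →
                     (∀ i → δ (ρ i) ≈ δ′ i) →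
                     ∀ {k} (p : ks ∋ k) → evalArgs I (renArgs S ρ as) γ δ p ≈ evalArgs I as γ δ′ p
      evalArgs-ren {n = n} {ρ = ρ} (_∷_ {k = k} t ts) {δ = δ} {δ′} e here = lam-cong k (eval-ren t lifted)
        where
        lifted : ∀ i → liftVEnv k δ (liftRen S k ρ i) ≈ liftVEnv k δ′ i
        lifted i with splitAt n i
        ... | inj₁ j = ≈-trans (≡⇒≈ (⊞-↑ˡ (λ i → δ i ∘ W _ k) _ (ρ j))) (∘-congʳ (e j))
        ... | inj₂ j = ≡⇒≈ (⊞-↑ʳ (λ i → δ i ∘ W _ k) _ j)
      evalArgs-ren (t ∷ ts) e (there p) = evalArgs-ren ts e p

    mutual
      eval-sub : {σ : Fin n → Tm S Θ m} (t : Tm S Θ n) {γ : Env c Θ} {δ : VEnv c m} {δ′ : VEnv c n} →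
                 (∀ i → eval I (σ i) γ δ ≈ δ′ i) → eval I (sub S σ t) γ δ ≈ eval I t γ δ′
      eval-sub (var i)     e = e i
      eval-sub (mvar m ts) e = apply-cong _ _ ≈-refl (evalTms-sub ts e)
      eval-sub (op o as)   e = ∘-congˡ (tup-cong (evalArgs-sub as e))

      evalTms-sub : {σ : Fin n → Tm S Θ m} (ts : Tms S Θ n k) {γ : Env c Θ} {δ : VEnv c m} {δ′ : VEnv c n} →
                    (∀ i → eval I (σ i) γ δ ≈ δ′ i) → ∀ i → evalTms I (subTms S σ ts) γ δ i ≈ evalTms I ts γ δ′ i
      evalTms-sub (t ∷ ts) e zero    = eval-sub t e
      evalTms-sub (t ∷ ts) e (suc i) = evalTms-sub ts e i

      evalArgs-sub : {σ : Fin n → Tm S Θ m} (as : Args S Θ n ks) {γ : Env c Θ} {δ : VEnv c m} {δ′ : VEnv c n} →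
                     (∀ i → eval I (σ i) γ δ ≈ δ′ i) →
                     ∀ {k} (p : ks ∋ k) → evalArgs I (subArgs S σ as) γ δ p ≈ evalArgs I as γ δ′ p
      evalArgs-sub {n = n} {σ = σ} (_∷_ {k = k} t ts) {γ} {δ} {δ′} e here = lam-cong k (eval-sub t lifted)
        where
        lifted : ∀ i → eval I (liftSub S k σ i) (weakenEnv k γ) (liftVEnv k δ) ≈ liftVEnv k δ′ i
        lifted i with splitAt n i
        ... | inj₁ j = ≈-trans (eval-ren (σ j) (λ i → ≡⇒≈ (⊞-↑ˡ (λ i → δ i ∘ W _ k) _ i)))
                         (≈-trans (≈-sym (eval-∘ (σ j) γ δ (W _ k))) (∘-congʳ (e j)))
        ... | inj₂ j = ≡⇒≈ (⊞-↑ʳ (λ i → δ i ∘ W _ k) _ j)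
      evalArgs-sub (t ∷ ts) e (there p) = evalArgs-sub ts e p

    mutual
      -- The metavariable case is a β-step: the left side evaluates the body of ρ at `δ ⊞ ε`, the
      -- right side applies its transpose to ε. The hypothesis is only up to `≈`, so that it can be
      -- re-established under a binder.
      eval-msub : {ρ : Args S Θ′ n Θ} (t : Tm S Θ n) {γ : Env c Θ′} {γ′ : Env c Θ} {δ : VEnv c n} →
                  (∀ {k} (p : Θ ∋ k) → evalArgs I ρ γ δ p ≈ γ′ p) → eval I (msub S ρ t) γ δ ≈ eval I t γ′ δ
      eval-msub (var i) e = ≈-refl
      eval-msub {n = n} {c = c} {ρ = ρ} (mvar {k = k} m ts) {γ} {γ′} {δ} e = begin
        eval I (sub S (instSub S (msubTms S ρ ts)) u) γ δ
          ≈⟨ eval-sub u inst ⟩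
        eval I u γ (δ ⊞ ε)
          ≈⟨ eval-cong u (λ _ → ≈-refl) (λ p → cancel (γ p)) (liftVEnv-rel k (pair id ε) (λ i → cancel (δ i)) (V-pair id ε)) ⟨
        eval I u (λ p → weakenEnv k γ p ∘ pair id ε) (λ i → liftVEnv k δ i ∘ pair id ε)
          ≈⟨ eval-∘ u _ _ (pair id ε) ⟨
        eval I u (weakenEnv k γ) (liftVEnv k δ) ∘ pair id ε
          ≈⟨ apply-lam k _ ε ⟨
        apply (lam k (eval I u (weakenEnv k γ) (liftVEnv k δ))) ε
          ≡⟨ cong (λ f → apply f ε) (evalArgs-lookup I ρ γ δ m) ⟨
        apply (evalArgs I ρ γ δ m) ε
          ≈⟨ apply-cong ε _ (e m) (evalTms-msub ts e) ⟩
        apply (γ′ m) (evalTms I ts γ′ δ) ∎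
        where
        open ≈-Reasoning
        u = lookupArgs S ρ m
        ε = evalTms I (msubTms S ρ ts) γ δ
        cancel : ∀ {b} (f : Hom c b) → (f ∘ W c k) ∘ pair id ε ≈ f
        cancel f = ≈-trans (assoc _ _ _) (≈-trans (∘-congˡ (W-pair id ε)) (identityʳ f))
        inst : ∀ i → eval I (instSub S (msubTms S ρ ts) i) γ δ ≈ (δ ⊞ ε) i
        inst i with splitAt n i
        ... | inj₁ j = ≈-refl
        ... | inj₂ j = ≡⇒≈ (sym (evalTms-index I (msubTms S ρ ts) γ δ j))
      eval-msub (op o as) e = ∘-congˡ (tup-cong (evalArgs-msub as e))

      evalTms-msub : {ρ : Args S Θ′ n Θ} (ts : Tms S Θ n k) {γ : Env c Θ′} {γ′ : Env c Θ} {δ : VEnv c n} →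
                     (∀ {k} (p : Θ ∋ k) → evalArgs I ρ γ δ p ≈ γ′ p) →
                     ∀ i → evalTms I (msubTms S ρ ts) γ δ i ≈ evalTms I ts γ′ δ i
      evalTms-msub (t ∷ ts) e zero    = eval-msub t e
      evalTms-msub (t ∷ ts) e (suc i) = evalTms-msub ts e i

      evalArgs-msub : {ρ : Args S Θ′ n Θ} (as : Args S Θ n ks) {γ : Env c Θ′} {γ′ : Env c Θ} {δ : VEnv c n} →
                      (∀ {k} (p : Θ ∋ k) → evalArgs I ρ γ δ p ≈ γ′ p) →
                      ∀ {k} (p : ks ∋ k) → evalArgs I (msubArgs S ρ as) γ δ p ≈ evalArgs I as γ′ δ p
      evalArgs-msub {ρ = ρ} (_∷_ {k = k} t ts) {γ} {δ = δ} e here = lam-cong k (eval-msub t λ p →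
        ≈-trans (evalArgs-ren ρ (λ i → ≡⇒≈ (⊞-↑ˡ (λ i → δ i ∘ W _ k) _ i)) p)
          (≈-trans (≈-sym (evalArgs-∘ ρ γ δ (W _ k) p)) (∘-congʳ (e p))))
      evalArgs-msub (t ∷ ts) e (there p) = evalArgs-msub ts e p

    -- The η-law of transposition: the body applies `γ q` to exactly the bound variables, so its
    -- transpose is `γ q` by uniqueness.
    evalArgs-allVars : (as : Args S Θ 0 ks) (γ : Env c Θ) (δ : VEnv c 0) (p : ks ∋ k) {q : Θ ∋ k} →
                       lookupArgs S as p ≡ mvar q (allVars S) → evalArgs I as γ δ p ≈ γ q
    evalArgs-allVars {c = c} {k = k} as γ δ p {q} e = ≈-trans (≡⇒≈ (evalArgs-lookup I as γ δ p))
      (≈-trans (≡⇒≈ (cong (λ t → lam k (eval I t (weakenEnv k γ) (liftVEnv k δ))) e))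
        (≈-sym (lam-unique k (apply-cong (V c k) _ ≈-refl λ i →
          ≡⇒≈ (sym (trans (evalTms-index I (allVars S) (weakenEnv k γ) (liftVEnv k δ) i)
            (cong (λ t → eval I t (weakenEnv k γ) (liftVEnv k δ)) (Metatheory.index-tab S var i))))))))

    -- The right side lies in the image of `T`: it is `T₁` of t with its variables turned into
    -- metavariables of arity 0. Computing that term in 𝕄 matches evaluation case by case. An
    -- extended interpretation thereby agrees with `T`.
    eval-embed : (t : Tm EmptySig Θ n) →
                 eval I (Embedding.embed S t) (weakenEnv n proj) (V Θ n) ≈ unlam n (T₁ t)
    eval-embed {Θ = Θ} {n = n} t = go t
      where
      open ≈-Reasoning
      E = EmptySig
      module M = Metatheory E
      module C = ClosedArgs E
      ι = C.wk₀ n (π₁ Θ (zeros n))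
      names : Fin n → Tm E (Θ ++ zeros n) 0
      names i = mvar (∋-inr Θ (pos i)) []
      closed : Tm E Θ n → Tm E (Θ ++ zeros n) 0
      closed u = sub E names (msub E ι u)
      unlam-T : ∀ u → unlam n (T₁ u) ≈ T₁ (closed u)
      unlam-T u = ≈-trans (apply-congʳ (V Θ n) (T-comp (π₁ Θ (zeros n)) (u ∷ []))) (apply-T (msub E ι u) names)
      mutual
        go : (t : Tm E Θ n) → eval I (Embedding.embed S t) (weakenEnv n proj) (V Θ n) ≈ unlam n (T₁ t)
        go (var i)             = ≈-sym (unlam-T (var i))
        go (mvar {k = k} m ts) = begin
          apply (proj m ∘ W Θ n) (evalTms I (Embedding.embedTms S ts) (weakenEnv n proj) (V Θ n))
            ≈⟨ apply-cong _ (λ i → T₁ (closed (indexTms E ts i))) (proj-π₁ m) (λ i → ≈-trans (goTms ts i) (unlam-T _)) ⟩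
          apply (proj (∋-inl (zeros n) m)) (λ i → T₁ (closed (indexTms E ts i)))
            ≈⟨ apply-T (mvar (∋-inl (zeros n) m) (allVars E)) (closed ⊙ indexTms E ts) ⟩
          T₁ (sub E (closed ⊙ indexTms E ts) (mvar (∋-inl (zeros n) m) (allVars E)))
            ≡⟨ cong (T₁ ⊙ sub E (closed ⊙ indexTms E ts)) (M.lookup-tab Θ _ m) ⟨
          T₁ (sub E (closed ⊙ indexTms E ts) (lookupArgs E (π₁ Θ (zeros n)) m))
            ≡⟨ cong T₁ (M.sub-sub _ _ (lookupArgs E (π₁ Θ (zeros n)) m)) ⟨
          T₁ (sub E names (sub E (msub E ι ⊙ indexTms E ts) (lookupArgs E (π₁ Θ (zeros n)) m)))
            ≡⟨ cong (T₁ ⊙ sub E names) (C.msub-mvar (π₁ Θ (zeros n)) m ts) ⟨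
          T₁ (closed (mvar m ts))
            ≈⟨ unlam-T (mvar m ts) ⟨
          unlam n (T₁ (mvar m ts)) ∎
        go (op () as)

        goTms : (ts : Tms E Θ n k) → ∀ i →
                evalTms I (Embedding.embedTms S ts) (weakenEnv n proj) (V Θ n) i ≈ unlam n (T₁ (indexTms E ts i))
        goTms (t ∷ ts) zero    = go t
        goTms (t ∷ ts) (suc i) = goTms ts i

-- Soundness, and translations induced by models

module Model {ℓ} (P : Presentation ℓ) (𝕋 : Theory ℓ) where
  open Kit 𝕋
  open Evaluation 𝕋 {sig P}
  private
    S = sig P
    module L = Logic P

  private variable
    Θ ks c : List ℕ
    n : ℕ

  Satisfies : Interpretation → Set ℓ
  Satisfies I = ∀ a {c} (γ : Env c (axMeta P a)) (δ : VEnv c (axVars P a)) →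
                eval I (lhs P a) γ δ ≈ eval I (rhs P a) γ δ

  module _ {I : Interpretation} (sat : Satisfies I) where
    mutual
      sound : {s t : Tm S Θ n} → Derivable P s t → (γ : Env c Θ) (δ : VEnv c n) → eval I s γ δ ≈ eval I t γ δ
      sound (L.axiom a)   γ δ = sat a γ δ
      sound L.refl        γ δ = ≈-refl
      sound (L.sym d)     γ δ = ≈-sym (sound d γ δ)
      sound (L.trans d e) γ δ = ≈-trans (sound d γ δ) (sound e γ δ)
      -- The rule keeps the variables of its two premises apart: s and t read the first n entries of
      -- δ, the arguments the last m.
      sound (L.msubst {n = n} {m} {s} {t} {ss} {ts} d ds) γ δ = begin
        eval I (msub S (L.wkR n ss) (L.wkL m s)) γ δ
          ≈⟨ eval-msub (L.wkL m s) (evalArgs-ren ss (λ _ → ≈-refl)) ⟩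
        eval I (L.wkL m s) (evalArgs I ss γ δᵣ) δ
          ≈⟨ eval-ren s (λ _ → ≈-refl) ⟩
        eval I s (evalArgs I ss γ δᵣ) (δ ⊙ (_↑ˡ m))
          ≈⟨ sound d _ _ ⟩
        eval I t (evalArgs I ss γ δᵣ) (δ ⊙ (_↑ˡ m))
          ≈⟨ eval-cong t (λ _ → ≈-refl) (soundArgs ds γ δᵣ) (λ _ → ≈-refl) ⟩
        eval I t (evalArgs I ts γ δᵣ) (δ ⊙ (_↑ˡ m))
          ≈⟨ eval-ren t (λ _ → ≈-refl) ⟨
        eval I (L.wkL m t) (evalArgs I ts γ δᵣ) δ
          ≈⟨ eval-msub (L.wkL m t) (evalArgs-ren ts (λ _ → ≈-refl)) ⟨
        eval I (msub S (L.wkR n ts) (L.wkL m t)) γ δ ∎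
        where
        open ≈-Reasoning
        δᵣ = δ ⊙ (n ↑ʳ_)

      soundArgs : {as bs : Args S Θ n ks} → ArgsDeriv P as bs → (γ : Env c Θ) (δ : VEnv c n) →
                  ∀ {k} (p : ks ∋ k) → evalArgs I as γ δ p ≈ evalArgs I bs γ δ p
      soundArgs (L._∷_ {k = k} d ds) γ δ here      = lam-cong k (sound d _ _)
      soundArgs (d L.∷ ds)           γ δ (there p) = soundArgs ds γ δ p

    open ClosedArgs S using (comp; wk₀; lookup-comp)

    interpret-comp : ∀ {a b c} (g : Args S a 0 b) (f : Args S b 0 c) → interpret I (comp g f) ≈ interpret I f ∘ interpret I g
    interpret-comp {a} {b} {c} g f = tup-ext λ {k} p → begin
      proj p ∘ interpret I (comp g f)
        ≈⟨ proj-tup _ p ⟩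
      evalArgs I (comp g f) proj (λ ()) p
        ≡⟨ evalArgs-lookup I (comp g f) proj (λ ()) p ⟩
      lam k (eval I (lookupArgs S (comp g f) p) (weakenEnv k proj) (liftVEnv k (λ ())))
        ≡⟨ cong (λ t → lam k (eval I t (weakenEnv k proj) (liftVEnv k (λ ())))) (lookup-comp g f p) ⟩
      lam k (eval I (msub S (wk₀ k g) (lookupArgs S f p)) (weakenEnv k proj) (liftVEnv k (λ ())))
        ≈⟨ lam-cong k (eval-msub (lookupArgs S f p) (pulled k)) ⟩
      lam k (eval I (lookupArgs S f p) (weakenEnv k (λ q → proj q ∘ interpret I g)) (liftVEnv k (λ ())))
        ≡⟨ evalArgs-lookup I f _ _ p ⟨
      evalArgs I f (λ q → proj q ∘ interpret I g) _ p
        ≈⟨ evalArgs-∘ f proj (λ ()) (interpret I g) p ⟨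
      evalArgs I f proj (λ ()) p ∘ interpret I g
        ≈⟨ pullˡ (proj-tup _ p) ⟨
      proj p ∘ (interpret I f ∘ interpret I g) ∎
      where
      open ≈-Reasoning
      pulled : ∀ k {j} (q : b ∋ j) →
               evalArgs I (wk₀ k g) (weakenEnv k proj) (liftVEnv k (λ ())) q ≈ (proj q ∘ interpret I g) ∘ W a k
      pulled k q = begin
        evalArgs I (wk₀ k g) (weakenEnv k proj) (liftVEnv k (λ ())) q ≈⟨ evalArgs-ren g (λ ()) q ⟩
        evalArgs I g (weakenEnv k proj) _ q                           ≈⟨ evalArgs-∘ g proj (λ ()) (W a k) q ⟨
        evalArgs I g proj (λ ()) q ∘ W a k                            ≈⟨ ∘-congʳ (proj-tup _ q) ⟨
        (proj q ∘ interpret I g) ∘ W a k                                   ∎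

    -- The universal property of the classifying theory, existence part. Both the action of Ψ on
    -- arrows and the translation η are instances.
    extension : AlgTrans (Classifying.theory P) 𝕋
    extension = record
      { F₁     = interpret I
      ; F-resp = λ d → tup-cong (soundArgs d proj (λ ()))
      ; F-id   = λ {a} → ≈-sym (tup-unique λ p → ≈-trans (identityʳ _)
                   (≈-sym (evalArgs-allVars (idArgs S a) proj (λ ()) p (Metatheory.lookup-tab S a _ p))))
      ; F-∘    = λ f g → interpret-comp g f
      ; F-T    = λ s → ≈-sym (tup-unique λ {k} p → ≈-trans (proj-T s p) (≈-sym (≈-trans
                   (≡⇒≈ (trans (evalArgs-lookup I (embedArgs s) proj (λ ()) p)
                     (cong (λ t → lam k (eval I t (weakenEnv k proj) (liftVEnv k (λ ())))) (lookup-embedArgs s p))))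
                   (≈-sym (lam-unique k (≈-sym (eval-embed (lookupArgs EmptySig s p))))))))
      }
      where open Embedding S

-- Algebraic translations commute with interpretation

module Preservation {ℓ} {𝕋 𝕋′ : Theory ℓ} (F : AlgTrans 𝕋 𝕋′) where
  private
    module A = Kit 𝕋
    module B = Kit 𝕋′
    module EA = Evaluation 𝕋
    module EB = Evaluation 𝕋′
    F′ : ∀ {a b} → A.Hom a b → B.Hom a b
    F′ = F₁ F
  open B using (_≈_; _∘_; ≈-refl; ≈-sym; ≈-trans; ∘-congˡ; ∘-congʳ; ≡⇒≈)

  private variable
    a b c d Θ ks : List ℕ
    k n : ℕ

  -- Projections and evaluations belong to the image of `T`, which F fixes. A tuple or transpose is
  -- characterised by equations with them, so F preserves it as well.
  F-square : {f : A.Hom b c} {g : A.Hom a b} {h : A.Hom a c} {f′ : B.Hom b c} →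
             f A.∘ g A.≈ h → F′ f ≈ f′ → f′ ∘ F′ g ≈ F′ h
  F-square e e′ = ≈-trans (∘-congʳ (≈-sym e′)) (≈-trans (≈-sym (F-∘ F _ _)) (F-resp F e))

  F-tup : (γ : A.Env c a) → F′ (A.tup γ) ≈ B.tup (λ p → F′ (γ p))
  F-tup γ = B.tup-unique λ p → F-square (A.proj-tup γ p) (F-T F _)

  F-pair : (h : A.Hom d c) (δ : A.VEnv d k) → F′ (A.pair h δ) ≈ B.pair (F′ h) (F′ ⊙ δ)
  F-pair h δ = B.pair-unique (F′ h) (F′ ⊙ δ) (F-square (A.W-pair h δ) (F-T F _))
    (λ i → F-square (A.V-pair h δ i) (F-T F _))

  F-apply : (f : A.Hom c (k ∷ [])) (δ : A.VEnv c k) → F′ (A.apply f δ) ≈ B.apply (F′ f) (F′ ⊙ δ)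
  F-apply f δ = ≈-trans (F-∘ F _ _) (B.∘-resp-≈ (F-T F _) (F-pair f δ))

  F-∘W : (f : A.Hom c d) → F′ (f A.∘ A.W c k) ≈ F′ f ∘ B.W c k
  F-∘W f = ≈-trans (F-∘ F _ _) (∘-congˡ (F-T F _))

  F-lam : ∀ k (f : A.Hom (c ++ zeros k) (0 ∷ [])) → F′ (A.lam k f) ≈ B.lam k (F′ f)
  F-lam {c = c} k f = B.lam-unique k (begin
    B.unlam k (F′ (A.lam k f))   ≈⟨ B.apply-cong (F′ ⊙ A.V c k) (B.V c k) (F-∘W (A.lam k f)) (λ i → F-T F _) ⟨
    B.apply (F′ (A.lam k f A.∘ A.W c k)) (F′ ⊙ A.V c k) ≈⟨ F-apply _ _ ⟨
    F′ (A.unlam k (A.lam k f))   ≈⟨ F-resp F (A.lam-β k f) ⟩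
    F′ f                         ∎)
    where open B.≈-Reasoning

  module _ {S : Signature ℓ} (I : EA.Interpretation {S}) where
    mutual
      F-eval : (t : Tm S Θ n) (γ : A.Env c Θ) (δ : A.VEnv c n) →
               F′ (EA.eval I t γ δ) ≈ EB.eval (F′ ⊙ I) t (λ p → F′ (γ p)) (F′ ⊙ δ)
      F-eval (var i)     γ δ = ≈-refl
      F-eval (mvar m ts) γ δ = ≈-trans (F-apply (γ m) _) (B.apply-cong _ _ ≈-refl (F-evalTms ts γ δ))
      F-eval (op o as)   γ δ = ≈-trans (F-∘ F _ _)
        (∘-congˡ (≈-trans (F-tup _) (B.tup-cong (F-evalArgs as γ δ))))

      F-evalTms : (ts : Tms S Θ n k) (γ : A.Env c Θ) (δ : A.VEnv c n) → ∀ i →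
                  F′ (EA.evalTms I ts γ δ i) ≈ EB.evalTms (F′ ⊙ I) ts (λ p → F′ (γ p)) (F′ ⊙ δ) i
      F-evalTms (t ∷ ts) γ δ zero    = F-eval t γ δ
      F-evalTms (t ∷ ts) γ δ (suc i) = F-evalTms ts γ δ i

      F-evalArgs : (as : Args S Θ n ks) (γ : A.Env c Θ) (δ : A.VEnv c n) → ∀ {k} (p : ks ∋ k) →
                   F′ (EA.evalArgs I as γ δ p) ≈ EB.evalArgs (F′ ⊙ I) as (λ p → F′ (γ p)) (F′ ⊙ δ) p
      F-evalArgs {n = n} (_∷_ {k = k} t ts) γ δ here = ≈-trans (F-lam k _) (B.lam-cong k
        (≈-trans (F-eval t _ _) (EB.eval-cong t (λ _ → ≈-refl) (λ p → F-∘W (γ p)) lifted)))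
        where
        lifted : ∀ i → F′ (EA.liftVEnv {S} k δ i) ≈ EB.liftVEnv {S} k (F′ ⊙ δ) i
        lifted i with splitAt n i
        ... | inj₁ j = F-∘W (δ j)
        ... | inj₂ j = F-T F _
      F-evalArgs (t ∷ ts) γ δ (there p) = F-evalArgs ts γ δ p

-- Evaluation in the generic environment

module EvaluationProperties {ℓ} (𝕋 : Theory ℓ) {S : Signature ℓ} where
  open Kit 𝕋
  open Evaluation 𝕋 {S}

  private variable
    Θ ks c d : List ℕ
    k n : ℕ

  module _ {I : Interpretation} where

    -- An equation that holds in the generic environment at stage `Θ ++ zeros n` hence holds in all
    -- environments.
    eval-universal : (t : Tm S Θ n) (γ : Env c Θ) (δ : VEnv c n) →
                     eval I t γ δ ≈ eval I t (weakenEnv n proj) (V Θ n) ∘ pair (tup γ) δ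
    eval-universal t γ δ = ≈-sym (≈-trans (eval-∘ t _ _ (pair (tup γ) δ)) (eval-cong t (λ _ → ≈-refl)
      (λ p → ≈-trans (assoc _ _ _) (≈-trans (∘-congˡ (W-pair (tup γ) δ)) (proj-tup γ p)))
      (V-pair (tup γ) δ)))

    eval-closed : (t : Tm S Θ 0) (γ : Env c Θ) (δ : VEnv c 0) →
                  eval I t γ δ ≈ eval I t proj (λ ()) ∘ tup γ
    eval-closed t γ δ = ≈-sym (≈-trans (eval-∘ t proj (λ ()) (tup γ))
      (eval-cong t (λ _ → ≈-refl) (proj-tup γ) (λ ())))

    tup-proj : tup {c = Θ} proj ≈ id
    tup-proj = ≈-sym (tup-unique λ p → identityʳ _)

    eval-op-id : ∀ o (γ : Env c (arity S o)) (δ : VEnv c 0) → eval I (op o (idArgs S (arity S o))) γ δ ≈ I o ∘ tup γ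
    eval-op-id o γ δ = ∘-congˡ (tup-cong λ p → evalArgs-allVars (idArgs S (arity S o)) γ δ p
      (Metatheory.lookup-tab S (arity S o) _ p))

    eval-op-id-proj : ∀ o → eval I (op o (idArgs S (arity S o))) proj (λ ()) ≈ I o
    eval-op-id-proj o = ≈-trans (eval-op-id o proj (λ ())) (≈-trans (∘-congˡ tup-proj) (identityʳ _))

    -- Two identifications: the projection from ⟨0⟩ to itself is `T` of an identity, and transposing
    -- no variables undoes the extension by `zeros 0`.
    interpret-closed : (t : Tm S Θ 0) → interpret I (t ∷ []) ≈ eval I t proj (λ ())
    interpret-closed {Θ} t = ≈-sym (tup-unique {γ = evalArgs I (t ∷ []) proj (λ ())} λ { here → ≈-trans (≈-trans (∘-congʳ (T-id (0 ∷ []))) (identityˡ _))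
      (lam-unique 0 (≈-trans (apply-zero _ (V Θ 0))
        (≈-trans (eval-∘ t proj (λ ()) (W Θ 0)) (eval-cong t (λ _ → ≈-refl) (λ _ → ≈-refl) (λ ()))))) })

  interpret-cong : ∀ {I J} (as : Args S c 0 ks) → (∀ o → I o ≈ J o) → interpret I as ≈ interpret J as
  interpret-cong as e = tup-cong (evalArgs-cong as e (λ _ → ≈-refl) (λ ()))

  -- By `lam-β` transposition is injective, so equal components have equal generic evaluations, and
  -- these determine the others.
  interpret-reflects : ∀ {I} (as bs : Args S Θ 0 ks) → interpret I as ≈ interpret I bs → (p : ks ∋ k) →
                       ∀ {c} (γ : Env c Θ) (δ : VEnv c k) →
                       eval I (lookupArgs S as p) γ δ ≈ eval I (lookupArgs S bs p) γ δ
  interpret-reflects {Θ = Θ} {k = k} {I = I} as bs e p γ δ =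
    ≈-trans (eval-universal (lookupArgs S as p) γ δ)
      (≈-trans (∘-congʳ universal) (≈-sym (eval-universal (lookupArgs S bs p) γ δ)))
    where
    component : ∀ cs → proj p ∘ interpret I cs ≈ lam k (eval I (lookupArgs S cs p) (weakenEnv k proj) (V Θ k))
    component cs = ≈-trans (proj-tup _ p) (≡⇒≈ (evalArgs-lookup I cs proj (λ ()) p))
    universal : eval I (lookupArgs S as p) (weakenEnv k proj) (V Θ k) ≈ eval I (lookupArgs S bs p) (weakenEnv k proj) (V Θ k)
    universal = ≈-trans (≈-sym (lam-β k _)) (≈-trans (apply-congʳ (V Θ k) (∘-congʳ
      (≈-trans (≈-sym (component as)) (≈-trans (∘-congˡ e) (component bs))))) (lam-β k _))

-- Evaluation of translated terms

module Translation {ℓ} (𝕋 : Theory ℓ) {S S′ : Signature ℓ} (σ : RawTrans S S′) where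
  open Kit 𝕋
  open Evaluation 𝕋
  open EvaluationProperties 𝕋

  private variable
    Θ ks c d : List ℕ
    k n : ℕ

  module _ (J : Interpretation {S′}) where
    pullback : Interpretation {S}
    pullback o = eval J (σ o) proj (λ ())

    mutual
      eval-translate : (t : Tm S Θ n) (γ : Env c Θ) (δ : VEnv c n) →
                       eval J (translate σ t) γ δ ≈ eval pullback t γ δ
      eval-translate (var i)     γ δ = ≈-refl
      eval-translate (mvar m ts) γ δ = apply-cong _ _ ≈-refl (evalTms-translate ts γ δ)
      eval-translate (op o as)   γ δ = begin
        eval J (msub S′ (transArgs σ as) (ren S′ (λ ()) (σ o))) γ δ
          ≈⟨ eval-msub (ren S′ (λ ()) (σ o)) (evalArgs-translate as γ δ) ⟩
        eval J (ren S′ (λ ()) (σ o)) (evalArgs pullback as γ δ) δ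
          ≈⟨ eval-ren (σ o) (λ ()) ⟩
        eval J (σ o) (evalArgs pullback as γ δ) (λ ())
          ≈⟨ eval-closed (σ o) _ (λ ()) ⟩
        pullback o ∘ tup (evalArgs pullback as γ δ) ∎
        where open ≈-Reasoning

      evalTms-translate : (ts : Tms S Θ n k) (γ : Env c Θ) (δ : VEnv c n) → ∀ i →
                          evalTms J (transTms σ ts) γ δ i ≈ evalTms pullback ts γ δ i
      evalTms-translate (t ∷ ts) γ δ zero    = eval-translate t γ δ
      evalTms-translate (t ∷ ts) γ δ (suc i) = evalTms-translate ts γ δ i

      evalArgs-translate : (as : Args S Θ n ks) (γ : Env c Θ) (δ : VEnv c n) → ∀ {k} (p : ks ∋ k) →
                           evalArgs J (transArgs σ as) γ δ p ≈ evalArgs pullback as γ δ p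
      evalArgs-translate (_∷_ {k = k} t ts) γ δ here      = lam-cong k (eval-translate t _ _)
      evalArgs-translate (t ∷ ts)           γ δ (there p) = evalArgs-translate ts γ δ p

-- The canonical model in the classifying theory, and completeness

module Canonical {ℓ} (P : Presentation ℓ) where
  private S = sig P
  open Metatheory S
  open ClosedArgs S
  open Embedding S
  open Derivations P
  open Kit (Classifying.theory P)
  open Evaluation (Classifying.theory P) {S}
  open EvaluationProperties (Classifying.theory P) {S}
  open Model P (Classifying.theory P)
  private module L = Logic P

  private variable
    Θ ks c d : List ℕ
    k n : ℕ

  canonical : Interpretation
  canonical o = op o (idArgs S (arity S o)) ∷ []

  -- `Args` is a data type without η, so the converse `wrap-unwrap` holds only propositionally.
  unwrap : Args S c 0 (k ∷ []) → Tm S c k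
  unwrap (t ∷ []) = t

  wrap-unwrap : (x : Args S c 0 (k ∷ [])) → unwrap x ∷ [] ≡ x
  wrap-unwrap (t ∷ []) = refl

  unwrap-≃ : {x y : Args S c 0 (k ∷ [])} → x ≃* y → unwrap x ≃ unwrap y
  unwrap-≃ {x = t ∷ []} {u ∷ []} (d L.∷ L.[]) = d

  unwrap-∘ : (x : Hom c (k ∷ [])) (h : Hom d c) → unwrap (x ∘ h) ≡ msub S (wk₀ k h) (unwrap x)
  unwrap-∘ (t ∷ []) h = refl

  proj-lookup : (h : Hom c ks) (p : ks ∋ k) → proj p ∘ h ≈ lookupArgs S h p ∷ []
  proj-lookup h p = ≡⇒≈ (cong (_∷ []) (trans (cong (msub S (wk₀ _ h)) (embed-allVars p)) (msub-allVars h p)))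

  apply-sub : (x : Hom c (k ∷ [])) (δ : VEnv c k) → apply x δ ≈ sub S (unwrap ⊙ δ) (unwrap x) ∷ []
  apply-sub {k = k} (u ∷ []) δ = ≈-trans
    (∘-congˡ {f = T₁ (ClosedArgs.evTm EmptySig k)} (≈-sym (pair-unique {g = h} (u ∷ []) δ (proj-lookup h here)
      λ i → ≈-trans (proj-lookup h (there (pos i)))
        (≡⇒≈ (trans (cong (_∷ []) (lookup-zeroArgs {n = 0} k (unwrap ⊙ δ) i)) (wrap-unwrap (δ i)))))))
    (≡⇒≈ (cong (_∷ []) (trans (cong (λ ts → msub S (wk₀ 0 h) (mvar here ts)) (embed-tabTms _))
      (msub-evTm k u (unwrap ⊙ δ)))))
    where h = u ∷ zeroArgs k (unwrap ⊙ δ)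

  metas : Env c Θ → Args S c 0 Θ
  metas {Θ = Θ} γ = tabArgs S Θ (λ p → unwrap (γ p))

  substitute : Env c Θ → VEnv c n → Tm S Θ n → Tm S c 0
  substitute {n = n} γ δ t = sub S (unwrap ⊙ δ) (msub S (wk₀ n (metas γ)) t)

  substituteArgs : Env c Θ → VEnv c n → Args S Θ n ks → Args S c 0 ks
  substituteArgs {n = n} γ δ as = subArgs S (unwrap ⊙ δ) (msubArgs S (wk₀ n (metas γ)) as)

  substitute-≃ : {s t : Tm S Θ n} (γ : Env c Θ) (δ : VEnv c n) → s ≃ t → substitute γ δ s ≃ substitute γ δ t
  substitute-≃ γ δ d = sub-≃ (msub-≃ ≃*-refl d) (λ _ → L.refl)

  metas-weaken : ∀ k (γ : Env c Θ) → comp (W c k) (metas γ) ≡ metas (weakenEnv k γ)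
  metas-weaken {c = c} {Θ = Θ} k γ = Args-ext λ p → begin
    lookupArgs S (comp (W c k) (metas γ)) p        ≡⟨ lookup-comp (W c k) (metas γ) p ⟩
    msub S (wk₀ _ (W c k)) (lookupArgs S (metas γ) p) ≡⟨ cong (msub S (wk₀ _ (W c k))) (lookup-tab Θ _ p) ⟩
    msub S (wk₀ _ (W c k)) (unwrap (γ p))          ≡⟨ unwrap-∘ (γ p) (W c k) ⟨
    unwrap (weakenEnv k γ p)                       ≡⟨ lookup-tab Θ _ p ⟨
    lookupArgs S (metas (weakenEnv k γ)) p         ∎
    where open ≡-Reasoning

  -- By uniqueness of transposes this settles the binder case of `eval-canonical`: the substituted
  -- body, uncurried, is the body substituted at the enlarged stage.
  unlam-substitute : ∀ k (t : Tm S Θ (n + k)) (γ : Env c Θ) (δ : VEnv c n) →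
    unlam k (sub S (liftSub S k (unwrap ⊙ δ)) (msub S (renArgs S (_↑ˡ k) (wk₀ n (metas γ))) t) ∷ [])
    ≈ substitute (weakenEnv k γ) (liftVEnv k δ) t ∷ []
  unlam-substitute {n = n} {c = c} k t γ δ = ≈-trans (apply-sub (body ∘ W c k) (V c k)) (≡⇒≈ (cong (_∷ []) (begin
    sub S names (msub S (wk₀ k π) (sub S lifted (msub S (renArgs S (_↑ˡ k) (wk₀ n g)) t)))
      ≡⟨ cong (λ γ → sub S names (msub S (wk₀ k π) (sub S lifted (msub S γ t)))) (renArgs-wk₀ (_↑ˡ k) g) ⟩
    sub S names (msub S (wk₀ k π) (sub S lifted (msub S (wk₀ (n + k) g) t)))
      ≡⟨ cong (sub S names) (msub-wk₀-sub π lifted (msub S (wk₀ (n + k) g) t)) ⟩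
    sub S names (sub S (msub S (wk₀ k π) ⊙ lifted) (msub S (wk₀ (n + k) π) (msub S (wk₀ (n + k) g) t)))
      ≡⟨ sub-sub _ _ (msub S (wk₀ (n + k) π) (msub S (wk₀ (n + k) g) t)) ⟩
    sub S (sub S names ⊙ msub S (wk₀ k π) ⊙ lifted) (msub S (wk₀ (n + k) π) (msub S (wk₀ (n + k) g) t))
      ≡⟨ sub-cong pointwise (msub S (wk₀ (n + k) π) (msub S (wk₀ (n + k) g) t)) ⟩
    sub S (unwrap ⊙ liftVEnv k δ) (msub S (wk₀ (n + k) π) (msub S (wk₀ (n + k) g) t))
      ≡⟨ cong (sub S (unwrap ⊙ liftVEnv k δ)) (trans (msub-msub (wk₀ (n + k) π) (wk₀ (n + k) g) t)
           (cong (λ γ → msub S γ t) (trans (sym (wk₀-comp π g)) (cong (wk₀ (n + k)) (metas-weaken k γ))))) ⟩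
    substitute (weakenEnv k γ) (liftVEnv k δ) t ∎)))
    where
    open ≡-Reasoning
    body : Args S c 0 (k ∷ [])
    body = sub S (liftSub S k (unwrap ⊙ δ)) (msub S (renArgs S (_↑ˡ k) (wk₀ n (metas γ))) t) ∷ []
    g = metas γ
    π = W c k
    names = unwrap ⊙ V c k
    lifted = liftSub S k (unwrap ⊙ δ)
    pointwise : ∀ i → sub S names (msub S (wk₀ k π) (lifted i)) ≡ unwrap (liftVEnv k δ i)
    pointwise i with splitAt n i
    ... | inj₂ j = refl
    ... | inj₁ j = begin
      sub S names (msub S (wk₀ k π) (ren S (_↑ˡ k) (unwrap (δ j))))
        ≡⟨ cong (sub S names) (msub-wk₀-ren π (_↑ˡ k) (unwrap (δ j))) ⟩
      sub S names (ren S (_↑ˡ k) (msub S (wk₀ 0 π) (unwrap (δ j))))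
        ≡⟨ sub-ren-id names (_↑ˡ k) (λ ()) (msub S (wk₀ 0 π) (unwrap (δ j))) ⟩
      msub S (wk₀ 0 π) (unwrap (δ j))
        ≡⟨ unwrap-∘ (δ j) π ⟨
      unwrap (δ j ∘ π) ∎

  mutual
    -- Application in this theory is substitution, tupling is concatenation and transposition is
    -- abstraction, so evaluation replaces metavariables by γ and variables by δ. It does so up to
    -- derivability, as pairings and transposes are known only by their universal properties.
    eval-canonical : (t : Tm S Θ n) (γ : Env c Θ) (δ : VEnv c n) →
                     eval canonical t γ δ ≈ substitute γ δ t ∷ []
    eval-canonical (var i)     γ δ = ≡⇒≈ (sym (wrap-unwrap (δ i)))
    eval-canonical {Θ = Θ} {n = n} (mvar m ts) γ δ = ≈-trans (apply-sub (γ m) _) (fused L.∷ L.[])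
      where
      g = wk₀ n (metas γ)
      fused : sub S (unwrap ⊙ evalTms canonical ts γ δ) (unwrap (γ m)) ≃ substitute γ δ (mvar m ts)
      fused = ≃-respˡʳ refl
        (trans (cong (sub S _) (sym (lookup-tab Θ _ m)))
          (trans (sym (sub-sub (unwrap ⊙ δ) (msub S g ⊙ indexTms S ts) (lookupArgs S (metas γ) m)))
            (cong (sub S (unwrap ⊙ δ)) (sym (msub-mvar (metas γ) m ts)))))
        (sub-≃ (L.refl {t = unwrap (γ m)}) (λ i → unwrap-≃ (evalTms-canonical ts γ δ i)))
    eval-canonical (op o as) γ δ = ≈-trans
      (∘-congˡ {f = canonical o} (≈-sym (tup-unique {h = ys} λ p → ≈-trans (proj-lookup ys p) (evalArgs-canonical as γ δ p))))
      (≡⇒≈ (cong (λ as → op o as ∷ []) (trans (cong (λ γ → msubArgs S γ (idArgs S (arity S o))) (wk₀-0 ys)) (msubArgs-idArgs ys))))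
      where
      ys = substituteArgs γ δ as
      msubArgs-idArgs : ∀ {ks} (s : Args S c 0 ks) → msubArgs S s (idArgs S ks) ≡ s
      msubArgs-idArgs {ks = ks} s = Args-ext λ p → begin
        lookupArgs S (msubArgs S s (idArgs S ks)) p
          ≡⟨ lookup-msubArgs s (idArgs S ks) p ⟩
        msub S (renArgs S (_↑ˡ _) s) (lookupArgs S (idArgs S ks) p)
          ≡⟨ cong₂ (msub S) (renArgs-cong (λ ()) s) (lookup-tab ks _ p) ⟩
        msub S (wk₀ _ s) (mvar p (allVars S))
          ≡⟨ msub-allVars s p ⟩
        lookupArgs S s p ∎
        where open ≡-Reasoning

    evalTms-canonical : (ts : Tms S Θ n k) (γ : Env c Θ) (δ : VEnv c n) → ∀ i →
                        evalTms canonical ts γ δ i ≈ substitute γ δ (indexTms S ts i) ∷ []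
    evalTms-canonical (t ∷ ts) γ δ zero    = eval-canonical t γ δ
    evalTms-canonical (t ∷ ts) γ δ (suc i) = evalTms-canonical ts γ δ i

    evalArgs-canonical : (as : Args S Θ n ks) (γ : Env c Θ) (δ : VEnv c n) → ∀ {k} (p : ks ∋ k) →
                         lookupArgs S (substituteArgs γ δ as) p ∷ [] ≈ evalArgs canonical as γ δ p
    evalArgs-canonical (_∷_ {k = k} t ts) γ δ here =
      lam-unique k (≈-trans (unlam-substitute k t γ δ) (≈-sym (eval-canonical t _ _)))
    evalArgs-canonical (t ∷ ts) γ δ (there p) = evalArgs-canonical ts γ δ p

  interpret-canonical : (as : Args S c 0 ks) → interpret canonical as ≈ as
  interpret-canonical {c = c} as = ≈-sym (tup-unique λ p → ≈-trans (proj-lookup as p)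
    (≈-trans (≡⇒≈ (cong (λ as → lookupArgs S as p ∷ []) (sym simplify))) (evalArgs-canonical as proj (λ ()) p)))
    where
    simplify : substituteArgs proj (λ ()) as ≡ as
    simplify = begin
      subArgs S _ (msubArgs S (wk₀ 0 (metas proj)) as)
        ≡⟨ trans (subArgs-cong (λ ()) _) (subArgs-var _) ⟩
      msubArgs S (wk₀ 0 (metas proj)) as
        ≡⟨ cong (λ γ → msubArgs S γ as) (trans (cong (wk₀ 0) metas-proj) wk₀-idArgs) ⟩
      msubArgs S (idArgsₙ 0) as
        ≡⟨ msubArgs-id as ⟩
      as ∎
      where
      open ≡-Reasoning
      metas-proj : metas proj ≡ idArgs S c
      metas-proj = Args-ext λ p → trans (lookup-tab c _ p) (trans (embed-allVars p) (sym (lookup-tab c _ p)))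

  eval-canonical-closed : (t : Tm S c 0) → eval canonical t proj (λ ()) ≈ t ∷ []
  eval-canonical-closed t = ≈-trans (≈-sym (interpret-closed t)) (interpret-canonical (t ∷ []))

  eval-canonical-op : ∀ o (γ : Env c (arity S o)) (δ : VEnv c 0) →
                      eval canonical (op o (idArgs S (arity S o))) γ δ ≈ canonical o ∘ tup γ
  eval-canonical-op = eval-op-id {I = canonical}

  canonical-satisfies : Satisfies canonical
  canonical-satisfies a γ δ = ≈-trans (eval-canonical (lhs P a) γ δ)
    (≈-trans (substitute-≃ γ δ (L.axiom a) L.∷ L.[]) (≈-sym (eval-canonical (rhs P a) γ δ)))

  -- In the generic environment, and after transposition, the two evaluations are the terms s and t
  -- themselves.
  canonical-complete : {s t : Tm S Θ n} →
                       (∀ {c} (γ : Env c Θ) (δ : VEnv c n) → eval canonical s γ δ ≈ eval canonical t γ δ) → s ≃ t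
  canonical-complete {s = s} {t} e = unwrap-≃ (≈-trans (≈-sym (interpret-canonical (s ∷ [])))
    (≈-trans (tup-cong {γ = evalArgs canonical (s ∷ []) proj (λ ())} {evalArgs canonical (t ∷ []) proj (λ ())}
      λ { here → lam-cong _ (e (weakenEnv _ proj) (V _ _)) }) (interpret-canonical (t ∷ []))))

  module _ {S₀ : Signature ℓ} (σ : RawTrans S₀ S) where
    eval-translate-canonical : ∀ (t : Tm S₀ Θ n) (γ : Env c Θ) (δ : VEnv c n) →
      eval canonical (translate σ t) γ δ ≈ Evaluation.eval (Classifying.theory P) (λ o → σ o ∷ []) t γ δ
    eval-translate-canonical t γ δ = ≈-trans (Translation.eval-translate (Classifying.theory P) σ canonical t γ δ)
      (Evaluation.eval-cong (Classifying.theory P) t (λ o → eval-canonical-closed (σ o)) (λ _ → ≈-refl) (λ _ → ≈-refl))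

-- The internal language of 𝕋 has an operator for every arrow into ⟨0⟩ and an axiom
-- for every equation valid in 𝕋. Arrows into ⟨n⟩ need no operators of their own, as
-- ⟨n⟩ is an n-fold exponential of ⟨0⟩.
module InternalLanguage {ℓ} (𝕋 : Theory ℓ) where
  open Kit 𝕋

  signature : Signature ℓ
  signature = record { Op = Σ (List ℕ) (λ a → Hom a (0 ∷ [])) ; arity = proj₁ }

  open Evaluation 𝕋 {signature}
  open EvaluationProperties 𝕋 {signature}

  private variable
    Θ ks a b c : List ℕ
    k n : ℕ

  arrow : Interpretation
  arrow = proj₂

  operator : Hom a (0 ∷ []) → Tm signature a 0
  operator {a} f = op (a , f) (idArgs signature a)

  eval-operator : (f : Hom a (0 ∷ [])) (γ : Env c a) (δ : VEnv c 0) → eval arrow (operator f) γ δ ≈ f ∘ tup γ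
  eval-operator f = eval-op-id {I = arrow} (_ , f)

  eval-operator-proj : (f : Hom a (0 ∷ [])) → eval arrow (operator f) proj (λ ()) ≈ f
  eval-operator-proj f = eval-op-id-proj {I = arrow} (_ , f)

  Valid : Tm signature Θ n → Tm signature Θ n → Set ℓ
  Valid {Θ} {n} s t = ∀ {c} (γ : Env c Θ) (δ : VEnv c n) → eval arrow s γ δ ≈ eval arrow t γ δ

  -- The quantifier over stages in `Valid` ranges over lists of naturals, so these axioms do not
  -- raise the universe level of the presentation.
  record ValidEquation : Set ℓ where
    constructor equation
    field
      {meta} : List ℕ
      {vars} : ℕ
      left   : Tm signature meta vars
      right  : Tm signature meta vars
      valid  : Valid left right

  presentation : Presentation ℓ
  presentation = record
    { sig    = signature
    ; Ax     = ValidEquation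
    ; axMeta = ValidEquation.meta
    ; axVars = ValidEquation.vars
    ; lhs    = ValidEquation.left
    ; rhs    = ValidEquation.right
    }

  private
    module ℂ = Kit (Classifying.theory presentation)

  open Model presentation 𝕋

  arrow-satisfies : Satisfies arrow
  arrow-satisfies e = ValidEquation.valid e

  derive : {s t : Tm signature Θ n} → Valid s t → Derivable presentation s t
  derive v = Logic.axiom (equation _ _ v)

  η⃗ : AlgTrans (Classifying.theory presentation) 𝕋
  η⃗ = extension arrow-satisfies

  -- Faithfulness of η: tuples with equal interpretations have valid component equations, and valid
  -- equations are axioms.
  η-reflects : {f g : ℂ.Hom a b} → F₁ η⃗ f ≈ F₁ η⃗ g → f ℂ.≈ g
  η-reflects {f = f} {g} e = Derivations.≃*-ext presentation λ p → derive (interpret-reflects f g e p)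

  -- An arrow into ⟨k⟩ is made into an operator by uncurrying its k variables, then applied to all
  -- metavariables and to the k variables that its term has free.
  generic : Hom a (k ∷ []) → Tm signature a k
  generic {a} {k} f = op (a ++ zeros k , unlam k f) (appendArgs (idArgsₙ k) (valueArgs k var))
    where
    open Metatheory signature
    open ClosedArgs signature

  eval-generic : (f : Hom a (k ∷ [])) (γ : Env c a) (δ : VEnv c k) →
                 eval arrow (generic f) γ δ ≈ apply (f ∘ tup γ) δ
  eval-generic {a} {k} {c} f γ δ = begin
    unlam k f ∘ tup args                ≈⟨ ∘-congˡ (pair-unique (tup γ) δ onMetas onVars) ⟩
    unlam k f ∘ pair (tup γ) δ          ≈⟨ unlam-∘-pair f (tup γ) δ ⟩
    apply (f ∘ tup γ) δ                 ∎
    where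
    open ≈-Reasoning
    open Metatheory signature
    open ClosedArgs signature
    as = appendArgs (idArgsₙ k) (valueArgs k var)
    args : Env c (a ++ zeros k)
    args = evalArgs arrow as γ δ
    onMetas : W a k ∘ tup args ≈ tup γ
    onMetas = tup-unique λ {j} p → ≈-trans (pullˡ (proj-π₁ p)) (≈-trans (proj-tup args (∋-inl (zeros k) p))
      (≈-trans (≡⇒≈ (trans (evalArgs-lookup arrow as γ δ (∋-inl (zeros k) p))
          (cong (λ t → lam j (eval arrow t (weakenEnv j γ) (liftVEnv j δ)))
            (trans (lookup-inl (idArgsₙ k) (valueArgs k var) p) (lookup-tab {n = k} a _ p)))))
        (≈-sym (lam-unique j (apply-cong (V c j) _ ≈-refl λ i → ≡⇒≈ (sym (trans
          (evalTms-index arrow (tabTms signature (var ⊙ (k ↑ʳ_))) (weakenEnv j γ) (liftVEnv j δ) i)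
          (trans (cong (λ t → eval arrow t (weakenEnv j γ) (liftVEnv j δ)) (index-tab (var ⊙ (k ↑ʳ_)) i))
            (⊞-↑ʳ (λ i → δ i ∘ W c j) (V c j) i)))))))))
    onVars : ∀ i → V a k i ∘ tup args ≈ δ i
    onVars i = ≈-trans (proj-tup args (∋-inr a (pos i))) (≈-trans
      (≡⇒≈ (trans (evalArgs-lookup arrow as γ δ (∋-inr a (pos i)))
        (cong (λ t → lam 0 (eval arrow t (weakenEnv 0 γ) (liftVEnv 0 δ)))
          (trans (lookup-inr (idArgsₙ k) (valueArgs k var) (pos i)) (lookup-zeroArgs {n = k} k _ i)))))
      (≈-sym (lam-unique 0 (≈-trans (apply-zero _ (V c 0)) (≡⇒≈ (sym (⊞-↑ˡ (λ i → δ i ∘ W c 0) (V c 0) i)))))))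

  reify : Hom a b → Args signature a 0 b
  reify {b = b} f = tabArgs signature b (λ p → generic (proj p ∘ f))

  η-reify : (f : Hom a b) → F₁ η⃗ (reify f) ≈ f
  η-reify {a} {b} f = ≈-sym (tup-unique λ {k} p → lam-ext k (begin
    unlam k (proj p ∘ f)
      ≈⟨ apply-congʳ (V a k) (assoc _ _ _) ⟩
    apply (proj p ∘ (f ∘ W a k)) (V a k)
      ≈⟨ apply-congʳ (V a k) (≈-trans (≈-sym (assoc _ _ _)) (∘-congˡ (tup-unique λ _ → ≈-refl))) ⟩
    apply ((proj p ∘ f) ∘ tup (weakenEnv k proj)) (V a k)
      ≈⟨ eval-generic (proj p ∘ f) (weakenEnv k proj) (V a k) ⟨
    eval arrow (generic (proj p ∘ f)) (weakenEnv k proj) (V a k)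
      ≈⟨ lam-β k _ ⟨
    unlam k (lam k (eval arrow (generic (proj p ∘ f)) (weakenEnv k proj) (V a k)))
      ≡⟨ cong (λ t → unlam k (lam k (eval arrow t (weakenEnv k proj) (V a k)))) (Metatheory.lookup-tab signature b _ p) ⟨
    unlam k (lam k (eval arrow (lookupArgs signature (reify f) p) (weakenEnv k proj) (V a k)))
      ≡⟨ cong (unlam k) (evalArgs-lookup arrow (reify f) proj (λ ()) p) ⟨
    unlam k (evalArgs arrow (reify f) proj (λ ()) p) ∎))
    where open ≈-Reasoning

  -- Each law is reflected by the faithful η, under which `reify` cancels.
  η⃖ : AlgTrans 𝕋 (Classifying.theory presentation)
  η⃖ = record
    { F₁     = reify
    ; F-resp = λ {_} {_} {f} {g} e → η-reflects (≈-trans (η-reify f) (≈-trans e (≈-sym (η-reify g))))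
    ; F-id   = η-reflects (≈-trans (η-reify id) (≈-sym (F-id η⃗)))
    ; F-∘    = λ f g → η-reflects (≈-trans (η-reify (f ∘ g))
                 (≈-sym (≈-trans (F-∘ η⃗ (reify f) (reify g)) (∘-resp-≈ (η-reify f) (η-reify g)))))
    ; F-T    = λ s → η-reflects (≈-trans (η-reify (T s)) (≈-sym (F-T η⃗ s)))
    }

open InternalLanguage using (presentation; arrow; derive)

-- From algebraic to syntactic translations

module OnAlgTrans {ℓ} {𝕋 𝕋′ : Theory ℓ} (F : AlgTrans 𝕋 𝕋′) where
  private
    module I = InternalLanguage 𝕋
    module I′ = InternalLanguage 𝕋′
    module E = Evaluation 𝕋
    module E′ = Evaluation 𝕋′
  open Kit 𝕋′
  open EvaluationProperties 𝕋′ using (eval-universal)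

  private variable
    Θ c : List ℕ
    n : ℕ

  onOps : RawTrans I.signature I′.signature
  onOps (a , f) = I′.operator (F₁ F f)

  eval-onOps : (t : Tm I.signature Θ n) (γ : Env c Θ) (δ : VEnv c n) →
               E′.eval I′.arrow (translate onOps t) γ δ ≈ E′.eval (λ o → F₁ F (I.arrow o)) t γ δ
  eval-onOps t γ δ = ≈-trans (Translation.eval-translate 𝕋′ onOps I′.arrow t γ δ)
    (E′.eval-cong t (λ o → I′.eval-operator-proj (F₁ F (I.arrow o))) (λ _ → ≈-refl) (λ _ → ≈-refl))

  -- The environment γ, δ lives in 𝕋′ and need not come from 𝕋, so the validity in 𝕋 does not apply
  -- to it. It does apply to the generic environment of 𝕋, which F carries to that of 𝕋′ because it
  -- is built from arrows in the image of `T`.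
  transport : {s t : Tm I.signature Θ n} → I.Valid s t → (γ : Env c Θ) (δ : VEnv c n) →
              E′.eval (λ o → F₁ F (I.arrow o)) s γ δ ≈ E′.eval (λ o → F₁ F (I.arrow o)) t γ δ
  transport {Θ = Θ} {n = n} {s = s} {t} v γ δ = ≈-trans (image s)
    (≈-trans (∘-congʳ (F-resp F (v _ _))) (≈-sym (image t)))
    where
    module K = Kit 𝕋
    image : ∀ u → E′.eval (λ o → F₁ F (I.arrow o)) u γ δ ≈
            F₁ F (E.eval I.arrow u (E.weakenEnv {I.signature} n K.proj) (K.V Θ n)) ∘ pair (tup γ) δ
    image u = ≈-trans (eval-universal u γ δ) (∘-congʳ (≈-sym
      (≈-trans (Preservation.F-eval F I.arrow u _ _) (E′.eval-cong u (λ _ → ≈-refl)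
        (λ p → ≈-trans (F-∘ F _ _) (∘-resp-≈ (F-T F _) (F-T F _))) (λ i → F-T F _)))))

  synTrans : SynTrans I.presentation I′.presentation
  synTrans = record
    { τ         = onOps
    ; preserves = λ (InternalLanguage.equation s t v) → I′.derive λ γ δ →
        ≈-trans (eval-onOps s γ δ) (≈-trans (transport {s = s} {t} v γ δ) (≈-sym (eval-onOps t γ δ)))
    }

  onOps-resp : {G : AlgTrans 𝕋 𝕋′} → F ≈ᴬ G → ∀ ((a , f) : Op I.signature) → I′.Valid (I′.operator (F₁ F f)) (I′.operator (F₁ G f))
  onOps-resp {G} e (a , f) γ δ = ≈-trans (I′.eval-operator (F₁ F f) γ δ)
    (≈-trans (∘-congʳ (e f)) (≈-sym (I′.eval-operator (F₁ G f) γ δ)))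

-- From syntactic to algebraic translations

module OnSynTrans {ℓ} {P P′ : Presentation ℓ} (σ : SynTrans P P′) where
  private
    module C′ = Canonical P′
  open Kit (Classifying.theory P′)
  open Evaluation (Classifying.theory P′)
  open EvaluationProperties (Classifying.theory P′)
  open Model P (Classifying.theory P′)

  private variable
    c ks : List ℕ

  images : Interpretation {sig P}
  images o = τ σ o ∷ []

  images-satisfy : Satisfies images
  images-satisfy a γ δ = ≈-trans (≈-sym (C′.eval-translate-canonical (τ σ) (lhs P a) γ δ))
    (≈-trans (Model.sound P′ (Classifying.theory P′) C′.canonical-satisfies (preserves σ a) γ δ)
      (C′.eval-translate-canonical (τ σ) (rhs P a) γ δ))

  algTrans : AlgTrans (Classifying.theory P) (Classifying.theory P′)
  algTrans = extension images-satisfy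

  algTrans-closed : (t : Tm (sig P) c 0) → F₁ algTrans (t ∷ []) ≈ translate (τ σ) t ∷ []
  algTrans-closed t = ≈-trans (interpret-closed t)
    (≈-trans (≈-sym (C′.eval-translate-canonical (τ σ) t proj (λ ()))) (C′.eval-canonical-closed _))

module _ {ℓ} {𝕋 𝕋′ : Theory ℓ} (F : AlgTrans 𝕋 𝕋′) {S : Signature ℓ} where
  open Kit 𝕋′
  open Evaluation using (interpret)

  -- Composites of translations become interpretations again, so that naturality and functoriality
  -- can be tested on operators.
  F-interpret : ∀ {c ks} (I : Evaluation.Interpretation 𝕋 {S}) (as : Args S c 0 ks) →
                F₁ F (interpret 𝕋 I as) ≈ interpret 𝕋′ (λ o → F₁ F (I o)) as
  F-interpret I as = ≈-trans (Preservation.F-tup F (Evaluation.evalArgs 𝕋 I as (Kit.proj 𝕋) (λ ()))) (tup-cong λ p →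
    ≈-trans (Preservation.F-evalArgs F I as (Kit.proj 𝕋) (λ ()) p)
      (Evaluation.evalArgs-cong 𝕋′ as (λ _ → ≈-refl) (λ q → F-T F _) (λ ()) p))

-- A presentation and the internal language of its classifying theory

module Counit {ℓ} (P : Presentation ℓ) where
  private
    module C = Canonical P
    module I = InternalLanguage (Classifying.theory P)
    S = sig P
  open Kit (Classifying.theory P)
  open Evaluation (Classifying.theory P)
  open EvaluationProperties (Classifying.theory P)

  private variable
    c Θ : List ℕ
    n : ℕ

  toTerms : RawTrans I.signature S
  toTerms (a , f) = C.unwrap f

  toOps : RawTrans S I.signature
  toOps o = I.operator (C.canonical o)

  -- Together with `eval-toOps`: neither translation changes evaluation in the classifying theory.
  -- Completeness on one side and the axioms of the internal language on the other turn this into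
  -- derivability.
  eval-toTerms : (t : Tm I.signature Θ n) (γ : Env c Θ) (δ : VEnv c n) →
                 eval C.canonical (translate toTerms t) γ δ ≈ eval I.arrow t γ δ
  eval-toTerms t γ δ = ≈-trans (C.eval-translate-canonical toTerms t γ δ)
    (eval-cong t (λ (a , f) → ≡⇒≈ (C.wrap-unwrap f)) (λ _ → ≈-refl) (λ _ → ≈-refl))

  eval-toOps : (t : Tm S Θ n) (γ : Env c Θ) (δ : VEnv c n) →
               eval I.arrow (translate toOps t) γ δ ≈ eval C.canonical t γ δ
  eval-toOps t γ δ = ≈-trans (Translation.eval-translate (Classifying.theory P) toOps I.arrow t γ δ)
    (eval-cong t (λ o → I.eval-operator-proj (C.canonical o)) (λ _ → ≈-refl) (λ _ → ≈-refl))

  ε⃗ : SynTrans I.presentation P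
  ε⃗ = record
    { τ         = toTerms
    ; preserves = λ (InternalLanguage.equation s t v) → C.canonical-complete λ γ δ →
        ≈-trans (eval-toTerms s γ δ) (≈-trans (v γ δ) (≈-sym (eval-toTerms t γ δ)))
    }

  ε⃖ : SynTrans P I.presentation
  ε⃖ = record
    { τ         = toOps
    ; preserves = λ a → I.derive λ γ δ → ≈-trans (eval-toOps (lhs P a) γ δ)
        (≈-trans (C.canonical-satisfies a γ δ) (≈-sym (eval-toOps (rhs P a) γ δ)))
    }

  ε⃗∘ε⃖ : RawEq S P (compRaw toOps toTerms) (idRaw S)
  ε⃗∘ε⃖ o = C.canonical-complete λ γ δ → ≈-trans (eval-toTerms (toOps o) γ δ)
    (≈-trans (I.eval-operator (C.canonical o) γ δ) (≈-sym (C.eval-canonical-op o γ δ)))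

  ε⃖∘ε⃗ : RawEq I.signature I.presentation (compRaw toTerms toOps) (idRaw I.signature)
  ε⃖∘ε⃗ (a , f) = I.derive λ γ δ → ≈-trans (eval-toOps (C.unwrap f) γ δ)
    (≈-trans (eval-closed (C.unwrap f) γ δ) (≈-trans (∘-congʳ
      (≈-trans (C.eval-canonical-closed (C.unwrap f)) (≡⇒≈ (C.wrap-unwrap f)))) (≈-sym (I.eval-operator f γ δ))))

-- Functoriality and naturality

module _ {ℓ} {𝕋₁ 𝕋₂ 𝕋₃ : Theory ℓ} (F : AlgTrans 𝕋₁ 𝕋₂) (G : AlgTrans 𝕋₂ 𝕋₃) where
  open Kit 𝕋₃
  open InternalLanguage 𝕋₃ using (eval-operator)

  onOps-∘ : RawEq (sig (presentation 𝕋₁)) (presentation 𝕋₃)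
              (OnAlgTrans.onOps (G ∘ᴬ F)) (compRaw (OnAlgTrans.onOps F) (OnAlgTrans.onOps G))
  onOps-∘ (a , f) = derive 𝕋₃ λ γ δ → ≈-trans (eval-operator (F₁ G (F₁ F f)) γ δ)
    (≈-sym (≈-trans (OnAlgTrans.eval-onOps G (OnAlgTrans.onOps F (a , f)) γ δ)
      (EvaluationProperties.eval-op-id 𝕋₃ {sig (presentation 𝕋₂)} {I = λ o → F₁ G (arrow 𝕋₂ o)} (a , F₁ F f) γ δ)))

module _ {ℓ} {P P′ : Presentation ℓ} where
  open Kit (Classifying.theory P′)
  open EvaluationProperties (Classifying.theory P′) {sig P}

  algTrans-resp : {σ σ′ : SynTrans P P′} → RawEq (sig P) P′ (τ σ) (τ σ′) →
                  OnSynTrans.algTrans σ ≈ᴬ OnSynTrans.algTrans σ′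
  algTrans-resp {σ} {σ′} e f =
    interpret-cong {I = OnSynTrans.images σ} {OnSynTrans.images σ′} f (λ o → e o Logic.∷ Logic.[])

  -- In the canonical model of P′ both sides evaluate to the image of f under the translation
  -- induced by σ, precomposed with `tup γ`.
  ε-natural : (σ : SynTrans P P′) →
              RawEq (sig (presentation (Classifying.theory P))) P′
                (compRaw (OnAlgTrans.onOps (OnSynTrans.algTrans σ)) (Counit.toTerms P′))
                (compRaw (Counit.toTerms P) (τ σ))
  ε-natural σ (a , f) = Canonical.canonical-complete P′ λ γ δ → begin
    eval C′.canonical (translate (Counit.toTerms P′) (I′.operator σf)) γ δ
      ≈⟨ Counit.eval-toTerms P′ (I′.operator σf) γ δ ⟩
    eval (arrow (Classifying.theory P′)) (I′.operator σf) γ δ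
      ≈⟨ I′.eval-operator σf γ δ ⟩
    σf ∘ tup γ
      ≡⟨ cong (λ g → F₁ (OnSynTrans.algTrans σ) g ∘ tup γ) (Canonical.wrap-unwrap P f) ⟨
    F₁ (OnSynTrans.algTrans σ) (t ∷ []) ∘ tup γ
      ≈⟨ ∘-congʳ (interpret-closed {I = OnSynTrans.images σ} t) ⟩
    eval (OnSynTrans.images σ) t proj (λ ()) ∘ tup γ
      ≈⟨ eval-closed t γ δ ⟨
    eval (OnSynTrans.images σ) t γ δ
      ≈⟨ C′.eval-translate-canonical (τ σ) t γ δ ⟨
    eval C′.canonical (translate (τ σ) t) γ δ ∎
    where
    open ≈-Reasoning
    open Evaluation (Classifying.theory P′)
    module C′ = Canonical P′
    module I′ = InternalLanguage (Classifying.theory P′)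
    t = Canonical.unwrap P f
    σf = F₁ (OnSynTrans.algTrans σ) f

module _ {ℓ} (P : Presentation ℓ) where
  open Kit (Classifying.theory P)

  algTrans-id : (ι : SynTrans P P) → RawEq (sig P) P (τ ι) (idRaw (sig P)) →
                OnSynTrans.algTrans ι ≈ᴬ idᴬ (Classifying.theory P)
  algTrans-id ι e f = ≈-trans
    (EvaluationProperties.interpret-cong (Classifying.theory P) {I = OnSynTrans.images ι} {Canonical.canonical P}
      f (λ o → e o Logic.∷ Logic.[]))
    (Canonical.interpret-canonical P f)

module _ {ℓ} {P₁ P₂ P₃ : Presentation ℓ} (σ : SynTrans P₁ P₂) (σ′ : SynTrans P₂ P₃) (ρ : SynTrans P₁ P₃) where
  open Kit (Classifying.theory P₃)
  open EvaluationProperties (Classifying.theory P₃) {sig P₁}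

  algTrans-∘ : RawEq (sig P₁) P₃ (τ ρ) (compRaw (τ σ) (τ σ′)) →
               OnSynTrans.algTrans ρ ≈ᴬ (OnSynTrans.algTrans σ′ ∘ᴬ OnSynTrans.algTrans σ)
  algTrans-∘ e f = ≈-trans
    (interpret-cong {I = OnSynTrans.images ρ} f
      λ o → ≈-trans (e o Logic.∷ Logic.[]) (≈-sym (OnSynTrans.algTrans-closed σ′ (τ σ o))))
    (≈-sym (F-interpret (OnSynTrans.algTrans σ′) (OnSynTrans.images σ) f))

module _ {ℓ} {𝕋 𝕋′ : Theory ℓ} (F : AlgTrans 𝕋 𝕋′) where
  open Kit 𝕋′
  open Evaluation 𝕋′ {sig (presentation 𝕋)}
  open EvaluationProperties 𝕋′ {sig (presentation 𝕋)}
  private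
    module I = InternalLanguage 𝕋
    module I′ = InternalLanguage 𝕋′

  -- Both composites interpret the internal language of 𝕋 in 𝕋′, and on an operator g both give
  -- `F₁ F g`.
  η-natural : (I′.η⃗ ∘ᴬ OnSynTrans.algTrans (OnAlgTrans.synTrans F)) ≈ᴬ (F ∘ᴬ I.η⃗)
  η-natural f = begin
    F₁ I′.η⃗ (F₁ (OnSynTrans.algTrans σ) f) ≈⟨ F-interpret I′.η⃗ (OnSynTrans.images σ) f ⟩
    interpret composite f                  ≈⟨ interpret-cong {I = composite} {F₁ F ⊙ I.arrow} f agree ⟩
    interpret (F₁ F ⊙ I.arrow) f           ≈⟨ F-interpret F I.arrow f ⟨
    F₁ F (F₁ I.η⃗ f)                        ∎
    where
    open ≈-Reasoning
    σ = OnAlgTrans.synTrans F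
    composite : Evaluation.Interpretation 𝕋′ {sig (presentation 𝕋)}
    composite o = F₁ I′.η⃗ (OnAlgTrans.onOps F o ∷ [])
    agree : ∀ o → composite o ≈ F₁ F (I.arrow o)
    agree (a , g) = ≈-trans
      (EvaluationProperties.interpret-closed 𝕋′ {I = I′.arrow} (I′.operator (F₁ F g)))
      (I′.eval-operator-proj (F₁ F g))

theorem3 : (ℓ : Level) → SOAT≃SOEP ℓ
theorem3 ℓ = record
  { Φ₀     = presentation
  ; Φ₁     = OnAlgTrans.synTrans
  ; Φ-resp = λ {𝕋} {𝕋′} {F} {G} e o → derive 𝕋′ (OnAlgTrans.onOps-resp F {G} e o)
  -- The identity of 𝕋 sends an operator to that operator applied to its own metavariables, which is
  -- `idRaw` by computation.
  ; Φ-id   = λ 𝕋 _ → Logic.refl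
  ; Φ-∘    = onOps-∘
  ; Ψ₀     = Classifying.theory
  ; Ψ₁     = OnSynTrans.algTrans
  ; Ψ-resp = λ {P} {P′} {σ} {σ′} → algTrans-resp {σ = σ} {σ′}
  ; Ψ-id   = algTrans-id
  ; Ψ-∘    = algTrans-∘
  ; η      = InternalLanguage.η⃗
  ; η⁻¹    = InternalLanguage.η⃖
  ; η-iso₁ = InternalLanguage.η-reify
  -- Faithfulness of η leaves an equation in 𝕋, which is the other inverse law at the image of f.
  ; η-iso₂ = λ 𝕋 f → InternalLanguage.η-reflects 𝕋 (InternalLanguage.η-reify 𝕋 (F₁ (InternalLanguage.η⃗ 𝕋) f))
  ; η-nat  = η-natural
  ; ε      = Counit.ε⃗
  ; ε⁻¹    = Counit.ε⃖
  ; ε-iso₁ = Counit.ε⃗∘ε⃖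
  ; ε-iso₂ = Counit.ε⃖∘ε⃗
  ; ε-nat  = ε-natural
  }
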